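{- The following axiom scheme $\nabla$ is sound for the differential $\mu$-calculus: for every $\mathsf{dL}\mu$-formula $\varphi$, every tuple of variables $x=(x_1,\dots,x_N)$ and every tuple of terms $\theta=(\theta_1,\dots,\theta_N)$ in the signature of ordered fields, the formula $$\langle x'=\theta\rangle\varphi\ \leftrightarrow\ \exists y\Big(\langle x:=y\rangle\varphi\land\exists t\ge0\ \exists M>0\ \nu X.\rho\Big)$$ is valid in $\mathfrak R$, where $y,z,u$ are $N$-tuples of fresh variables, $t,M$ are fresh variables, and $\rho$ is the conjunction of (1) $|x|\le M\land|y|\le M$; (2) $\exists z\,(|z|\le M\land|y-x|\le t\,|\theta_x^z|)$; (3) $\exists z\,(|z|\le M\land2|y-x-t\theta|\le t^2|\hat\theta_x^z|)$; (4) $\exists u\,\langle t:=\tfrac t2\rangle(\langle y:=u\rangle X\land\langle x:=u\rangle X)$; and $\hat\theta=\big(\sum_{i=1}^N(\partial_i\theta_1)\theta_i,\dots,\sum_{i=1}^N(\partial_i\theta_N)\theta_i\big)$.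
   Context: Fix an infinite set $\mathcal X$ of object variables and an infinite set $\mathcal V$ of propositional variables; each $X\in\mathcal V$ has a fresh complement $\overline X$, $\overline{\overline X}=X$, $\overline{\mathcal V}=\mathcal V\cup\{\overline X:X\in\mathcal V\}$. $\mathcal L$ is the first-order signature of ordered fields (terms are polynomials; rational constants are definable and used freely); a literal is an atomic $\mathcal L$-formula over $\mathcal X$ or its negation. $\mathrm{Act}$ consists of the transition symbols $x:=*$, $x:=\theta$ ($\theta$ an $\mathcal L$-term) and $x'=\theta\,\&\,\psi$ ($x$ an $N$-tuple of variables, $\theta$ an $N$-tuple of $\mathcal L$-terms, $\psi$ a first-order $\mathcal L$-formula); $x'=\theta$ means $\psi$ is true. $\mathfrak R$ is the structure $\mathbb R$ with states $\mathcal S=\{\omega:\mathcal X\to\mathbb R\}$ and $\mathfrak R[\![x:=\theta]\!]=\{(\omega,\omega[x\mapsto\omega[\![\theta]\!]])\}$, $\mathfrak R[\![x:=*]\!]=\{(\omega,\omega[x\mapsto r]):r\in\mathbb R\}$, and $(\omega,\nu)\in\mathfrak R[\![x'=\theta\,\&\,\psi]\!]$ iff $\nu$ agrees with $\omega$ off $x$ and for some $t\ge0$ there is a continuous $\gamma:[0,t]\to\mathbb R^N$, differentiable on $(0,t)$ with $\gamma'(s)=F(\gamma(s))$ there, with $\gamma(0)=\omega(x)$, $\gamma(t)=\nu(x)$ and $\gamma(s)\in K$ for all $s\in[0,t]$, where $F(r)=\omega[x\mapsto r][\![\theta]\!]$ and $K=\{r:\omega[x\mapsto r]\models\psi\}$.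 $\mathsf{dL}\mu$-formulas: formulas without free propositional variables given by $\varphi::=p\mid X\mid\varphi\lor\varphi\mid\varphi\land\varphi\mid\langle a\rangle\varphi\mid[a]\varphi\mid\mu X.\psi\mid\nu X.\psi$ with $p$ a literal, $X\in\overline{\mathcal V}$, $a\in\mathrm{Act}$, $\psi$ not mentioning $\overline X$. Semantics (sets of states, relative to a valuation of propositional variables by subsets of $\mathcal S$, $\overline X$ being interpreted as the complement of $X$): literals and connectives as usual; $\langle a\rangle,[a]$ are the existential/universal modalities of $\mathfrak R[\![a]\!]$; $\mu X.\varphi$, $\nu X.\varphi$ are the least/greatest fixpoints of the monotone map sending a value $D$ of $X$ to the denotation of $\varphi$. Negation, $\to$, $\leftrightarrow$ are definable. A formula is valid in $\mathfrak R$ if it holds in all states. $\exists x\,\varphi$ abbreviates $\langle x:=*\rangle\varphi$, and modalities/quantifiers over tuples are iterated. $|\cdot|$ is the norm on tuples (inequalities between norms being expressed by first-order formulas over $\mathbb R$), $\partial_i$ is the formal partial derivative with respect to $x_i$, and $\theta_x^z$ is $\theta$ with $x$ and $z$ exchanged. -}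

module Defs where

open import Algebra.Bundles using (CommutativeRing; Semiring)
import Algebra.Definitions.RawSemiring as RawSemiringOps
open import Data.Empty using (⊥)
open import Data.Fin.Properties using (any?)
open import Data.Integer.Base using (ℤ; +_; -[1+_])
open import Data.List.Base using (List; []; _∷_; _++_; concatMap)
open import Data.List.Membership.Propositional using (_∉_)
open import Data.List.Relation.Binary.Disjoint.Propositional using (Disjoint)
open import Data.List.Relation.Unary.Unique.Propositional using (Unique)
open import Data.Nat.Base using (ℕ)
open import Data.Product.Base using (Σ; ∃; _×_; _,_)
open import Data.Rational.Base using (ℚ; 0ℚ; 1ℚ; ½; ↥_; ↧ₙ_; _/_)
open import Data.Sum.Base using (_⊎_; [_,_]′)
open import Data.Unit.Base using (⊤)
open import Data.Vec.Functional using (Vector; toList; foldr)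
open import Function.Base using (_∘_; const; id)
open import Function.Definitions using (Injective)
open import Level using (Lift; 0ℓ) renaming (suc to lsuc)
open import Relation.Binary.Core using (Rel)
open import Relation.Binary.Definitions using (DecidableEquality)
open import Relation.Binary.PropositionalEquality.Core using (_≡_; _≢_)
open import Relation.Binary.Structures using (IsTotalOrder)
open import Relation.Nullary.Decidable.Core using (yes; no)
open import Relation.Nullary.Negation.Core using (¬_)
open import Relation.Unary using (Pred; _∈_; _⊆_; _≐_; Satisfiable)

Infinite : Set → Set
Infinite A = (as : List A) → ∃ λ a → a ∉ as

-- Together with excluded middle these axioms determine ℝ up to isomorphism.
-- The equality _≈_ is a setoid equality, as quotients are not available.
record CompleteOrderedField : Set₁ where
  infix  4 _≤_ _<_
  infix  9 _⁻¹
  field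
    commutativeRing : CommutativeRing 0ℓ 0ℓ
  open CommutativeRing commutativeRing public
  field
    1≉0          : ¬ (1# ≈ 0#)
    -- Total for convenience; its value at 0# is unconstrained.
    _⁻¹          : Carrier → Carrier
    ⁻¹-inverseʳ  : ∀ x → ¬ (x ≈ 0#) → x * (x ⁻¹) ≈ 1#
    _≤_          : Rel Carrier 0ℓ
    isTotalOrder : IsTotalOrder _≈_ _≤_
    +-monoʳ-≤    : ∀ x {y z} → y ≤ z → (x + y) ≤ (x + z)
    *-nonneg     : ∀ {x y} → 0# ≤ x → 0# ≤ y → 0# ≤ (x * y)

  UpperBound : Pred Carrier 0ℓ → Pred Carrier 0ℓ
  UpperBound P b = ∀ {x} → P x → x ≤ b

  field
    complete : (P : Pred Carrier 0ℓ) → Satisfiable P → Satisfiable (UpperBound P) →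
               ∃ λ s → UpperBound P s × (∀ {b} → UpperBound P b → s ≤ b)

  open IsTotalOrder isTotalOrder public using (total)
  open RawSemiringOps (Semiring.rawSemiring semiring) using () renaming (_×_ to _·_)

  _<_ : Rel Carrier 0ℓ
  x < y = x ≤ y × ¬ (x ≈ y)

  ∣_∣ : Carrier → Carrier
  ∣ x ∣ = [ const x , const (- x) ]′ (total 0# x)

  fromℤ : ℤ → Carrier
  fromℤ (+ n)    = n · 1#
  fromℤ -[1+ n ] = - (ℕ.suc n · 1#)

  fromℚ : ℚ → Carrier
  fromℚ q = fromℤ (↥ q) * ((↧ₙ q · 1#) ⁻¹)

record Variables : Set₁ where
  field
    𝒳          : Set
    _≟_        : DecidableEquality 𝒳
    𝒳-infinite : Infinite 𝒳
    𝒱          : Set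
    _≟ᵖ_       : DecidableEquality 𝒱
    𝒱-infinite : Infinite 𝒱

module Syntax (Vars : Variables) where
  open Variables Vars

  Distinct : ∀ {N} → Vector 𝒳 N → Set
  Distinct x = Injective _≡_ _≡_ x

  infixl 9  _⊕_ _⊖_
  infixl 10 _⊗_
  infix  11 ⊝_
  infix  4 _≐ᵗ_ _≼_
  infix  8 _:=_ _:=* _′=_&_

  -- Rational constants are primitive, so that t := t/2 is an assignment.
  data Term : Set where
    var     : 𝒳 → Term
    con     : ℚ → Term
    _⊕_ _⊗_ : Term → Term → Term
    ⊝_      : Term → Term

  _⊖_ : Term → Term → Term
  a ⊖ b = a ⊕ (⊝ b)

  data Atom : Set where
    _≐ᵗ_ _≼_ : Term → Term → Atom

  data Literal : Set where
    pos neg : Atom → Literal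

  data FOFormula : Set where
    atom      : Atom → FOFormula
    ¬ᶠ_       : FOFormula → FOFormula
    _∧ᶠ_ _∨ᶠ_ : FOFormula → FOFormula → FOFormula
    ∃ᶠ ∀ᶠ     : 𝒳 → FOFormula → FOFormula

  data Act : Set where
    _:=*   : 𝒳 → Act
    _:=_   : 𝒳 → Term → Act
    _′=_&_ : ∀ {N} → Σ (Vector 𝒳 N) Distinct → Vector Term N → FOFormula → Act

  trueᶠ : FOFormula
  trueᶠ = atom (con 0ℚ ≐ᵗ con 0ℚ)

  data 𝒱̄ : Set where
    prop comp : 𝒱 → 𝒱̄

  bar : 𝒱̄ → 𝒱̄
  bar (prop X) = comp X
  bar (comp X) = prop X

  base : 𝒱̄ → 𝒱
  base (prop X) = X
  base (comp X) = X

  infixr 6 _∧_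
  infixr 5 _∨_
  infixr 7 ⟨_⟩_ [_]_
  infixr 3 μ[_]_ ν[_]_

  data Formula : Set where
    lit         : Literal → Formula
    pvar        : 𝒱̄ → Formula
    _∨_ _∧_     : Formula → Formula → Formula
    ⟨_⟩_ [_]_   : Act → Formula → Formula
    μ[_]_ ν[_]_ : 𝒱̄ → Formula → Formula

  Mentions : 𝒱̄ → Formula → Set
  Mentions L (lit _)    = ⊥
  Mentions L (pvar K)   = L ≡ K
  Mentions L (φ ∨ ψ)    = Mentions L φ ⊎ Mentions L ψ
  Mentions L (φ ∧ ψ)    = Mentions L φ ⊎ Mentions L ψ
  Mentions L (⟨ _ ⟩ φ)  = Mentions L φ
  Mentions L ([ _ ] φ)  = Mentions L φ
  Mentions L (μ[ K ] φ) = L ≡ K ⊎ Mentions L φ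
  Mentions L (ν[ K ] φ) = L ≡ K ⊎ Mentions L φ

  WellFormed : Formula → Set
  WellFormed (lit _)    = ⊤
  WellFormed (pvar _)   = ⊤
  WellFormed (φ ∨ ψ)    = WellFormed φ × WellFormed ψ
  WellFormed (φ ∧ ψ)    = WellFormed φ × WellFormed ψ
  WellFormed (⟨ _ ⟩ φ)  = WellFormed φ
  WellFormed ([ _ ] φ)  = WellFormed φ
  WellFormed (μ[ L ] φ) = ¬ Mentions (bar L) φ × WellFormed φ
  WellFormed (ν[ L ] φ) = ¬ Mentions (bar L) φ × WellFormed φ

  -- A free occurrence of X or of its complement; a binder for either binds both.
  FreeIn : 𝒱 → Formula → Set
  FreeIn X (lit _)    = ⊥
  FreeIn X (pvar K)   = X ≡ base K
  FreeIn X (φ ∨ ψ)    = FreeIn X φ ⊎ FreeIn X ψ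
  FreeIn X (φ ∧ ψ)    = FreeIn X φ ⊎ FreeIn X ψ
  FreeIn X (⟨ _ ⟩ φ)  = FreeIn X φ
  FreeIn X ([ _ ] φ)  = FreeIn X φ
  FreeIn X (μ[ K ] φ) = X ≢ base K × FreeIn X φ
  FreeIn X (ν[ K ] φ) = X ≢ base K × FreeIn X φ

  record IsDLμ (φ : Formula) : Set where
    field
      wellFormed : WellFormed φ
      closed     : ∀ X → ¬ FreeIn X φ

  infix  8 ∼_
  infixr 4 _⇒_
  infix  3 _⇔_

  ∼_ : Formula → Formula
  ∼ lit (pos p)  = lit (neg p)
  ∼ lit (neg p)  = lit (pos p)
  ∼ pvar L       = pvar (bar L)
  ∼ (φ ∨ ψ)      = ∼ φ ∧ ∼ ψ
  ∼ (φ ∧ ψ)      = ∼ φ ∨ ∼ ψ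
  ∼ (⟨ a ⟩ φ)    = [ a ] ∼ φ
  ∼ ([ a ] φ)    = ⟨ a ⟩ ∼ φ
  ∼ (μ[ L ] φ)   = ν[ bar L ] ∼ φ
  ∼ (ν[ L ] φ)   = μ[ bar L ] ∼ φ

  _⇒_ _⇔_ : Formula → Formula → Formula
  φ ⇒ ψ = ∼ φ ∨ ψ
  φ ⇔ ψ = (φ ⇒ ψ) ∧ (ψ ⇒ φ)

  infixr 7 ⟨_:=⃗_⟩_

  ∃ᵘ : 𝒳 → Formula → Formula
  ∃ᵘ x φ = ⟨ x :=* ⟩ φ

  ∃* : ∀ {N} → Vector 𝒳 N → Formula → Formula
  ∃* x φ = foldr ∃ᵘ φ x

  ⟨_:=⃗_⟩_ : ∀ {N} → Vector 𝒳 N → Vector 𝒳 N → Formula → Formula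
  ⟨ x :=⃗ y ⟩ φ = foldr (λ i ψ → ⟨ x i := var (y i) ⟩ ψ) φ id

  sumᵗ : ∀ {N} → Vector Term N → Term
  sumᵗ = foldr _⊕_ (con 0ℚ)

  normSq : ∀ {N} → Vector Term N → Term
  normSq a = sumᵗ (λ i → a i ⊗ a i)

  vars* : ∀ {N} → Vector 𝒳 N → Vector Term N
  vars* x = var ∘ x

  infix 8 _≤ᶠ_ _>0ᶠ

  _≤ᶠ_ : Term → Term → Formula
  a ≤ᶠ b = lit (pos (a ≼ b))

  _>0ᶠ : Term → Formula
  a >0ᶠ = lit (neg (a ≼ con 0ℚ))

  -- |a| ≤ m for the Euclidean norm.
  ∥_∥≤_ : ∀ {N} → Vector Term N → Term → Formula
  ∥ a ∥≤ m = con 0ℚ ≤ᶠ m ∧ normSq a ≤ᶠ m ⊗ m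

  -- k|a| ≤ c|b| for a rational k > 0 and a term c of any sign: the second
  -- disjunct says that a = 0 and 0 ≤ c|b|, the only way for it to hold if c < 0.
  _·∥_∥≤_·∥_∥ : ∀ {N} → ℚ → Vector Term N → Term → Vector Term N → Formula
  k ·∥ a ∥≤ c ·∥ b ∥ =
    (con 0ℚ ≤ᶠ c ∧ (con k ⊗ con k) ⊗ normSq a ≤ᶠ (c ⊗ c) ⊗ normSq b)
    ∨ (normSq a ≤ᶠ con 0ℚ ∧ con 0ℚ ≤ᶠ c ⊗ normSq b)

  ∂ : 𝒳 → Term → Term
  ∂ x (var v) with x ≟ v
  ... | yes _   = con 1ℚ
  ... | no  _   = con 0ℚ
  ∂ x (con _)   = con 0ℚ
  ∂ x (a ⊕ b)   = ∂ x a ⊕ ∂ x b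
  ∂ x (a ⊗ b)   = (∂ x a ⊗ b) ⊕ (a ⊗ ∂ x b)
  ∂ x (⊝ a)     = ⊝ ∂ x a

  exchange : ∀ {N} → Vector 𝒳 N → Vector 𝒳 N → 𝒳 → 𝒳
  exchange x z v with any? (λ i → x i ≟ v) | any? (λ i → z i ≟ v)
  ... | yes (i , _) | _           = z i
  ... | no  _       | yes (i , _) = x i
  ... | no  _       | no  _       = v

  rename : (𝒳 → 𝒳) → Term → Term
  rename σ (var v) = var (σ v)
  rename σ (con q) = con q
  rename σ (a ⊕ b) = rename σ a ⊕ rename σ b
  rename σ (a ⊗ b) = rename σ a ⊗ rename σ b
  rename σ (⊝ a)   = ⊝ rename σ a

  _[_⇄_] : ∀ {N M} → Vector Term N → Vector 𝒳 M → Vector 𝒳 M → Vector Term N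
  (θ [ x ⇄ z ]) i = rename (exchange x z) (θ i)

  hat : ∀ {N} → Vector 𝒳 N → Vector Term N → Vector Term N
  hat x θ j = sumᵗ (λ i → ∂ (x i) (θ j) ⊗ θ i)

  varsᵗ : Term → List 𝒳
  varsᵗ (var v) = v ∷ []
  varsᵗ (con _) = []
  varsᵗ (a ⊕ b) = varsᵗ a ++ varsᵗ b
  varsᵗ (a ⊗ b) = varsᵗ a ++ varsᵗ b
  varsᵗ (⊝ a)   = varsᵗ a

  varsᵗ* : ∀ {N} → Vector Term N → List 𝒳
  varsᵗ* θ = concatMap varsᵗ (toList θ)

  varsᵃ : Atom → List 𝒳
  varsᵃ (a ≐ᵗ b) = varsᵗ a ++ varsᵗ b
  varsᵃ (a ≼ b)  = varsᵗ a ++ varsᵗ b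

  varsᶠ : FOFormula → List 𝒳
  varsᶠ (atom p)  = varsᵃ p
  varsᶠ (¬ᶠ ψ)    = varsᶠ ψ
  varsᶠ (ψ ∧ᶠ χ)  = varsᶠ ψ ++ varsᶠ χ
  varsᶠ (ψ ∨ᶠ χ)  = varsᶠ ψ ++ varsᶠ χ
  varsᶠ (∃ᶠ x ψ)  = x ∷ varsᶠ ψ
  varsᶠ (∀ᶠ x ψ)  = x ∷ varsᶠ ψ

  varsᵐ : Act → List 𝒳
  varsᵐ (x :=*)            = x ∷ []
  varsᵐ (x := θ)           = x ∷ varsᵗ θ
  varsᵐ ((x , _) ′= θ & ψ) = toList x ++ varsᵗ* θ ++ varsᶠ ψ

  -- All object variables occurring in a formula, free or bound.
  vars : Formula → List 𝒳
  vars (lit (pos p)) = varsᵃ p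
  vars (lit (neg p)) = varsᵃ p
  vars (pvar _)      = []
  vars (φ ∨ ψ)       = vars φ ++ vars ψ
  vars (φ ∧ ψ)       = vars φ ++ vars ψ
  vars (⟨ a ⟩ φ)     = varsᵐ a ++ vars φ
  vars ([ a ] φ)     = varsᵐ a ++ vars φ
  vars (μ[ _ ] φ)    = vars φ
  vars (ν[ _ ] φ)    = vars φ

  record Fresh {N} (x : Vector 𝒳 N) (θ : Vector Term N) (φ : Formula)
               (y z u : Vector 𝒳 N) (t M : 𝒳) : Set where
    new : List 𝒳
    new = toList y ++ toList z ++ toList u ++ t ∷ M ∷ []
    field
      unique   : Unique new
      disjoint : Disjoint new (toList x ++ varsᵗ* θ ++ vars φ)

  module Axiom {N} (x : Vector 𝒳 N) (θ : Vector Term N) (y z u : Vector 𝒳 N)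
               (t M : 𝒳) (X : 𝒱) where

    ρ : Formula
    ρ = (∥ vars* x ∥≤ var M ∧ ∥ vars* y ∥≤ var M)
      ∧ ∃* z (∥ vars* z ∥≤ var M
              ∧ 1ℚ ·∥ (λ i → var (y i) ⊖ var (x i)) ∥≤ var t ·∥ θ [ x ⇄ z ] ∥)
      ∧ ∃* z (∥ vars* z ∥≤ var M
              ∧ (+ 2 / 1) ·∥ (λ i → var (y i) ⊖ var (x i) ⊖ var t ⊗ θ i) ∥≤
                var t ⊗ var t ·∥ hat x θ [ x ⇄ z ] ∥)
      ∧ ∃* u (⟨ t := var t ⊗ con ½ ⟩
              (⟨ y :=⃗ u ⟩ pvar (prop X) ∧ ⟨ x :=⃗ u ⟩ pvar (prop X)))

    ∇ : Distinct x → Formula → Formula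
    ∇ dx φ =
      ⟨ (x , dx) ′= θ & trueᶠ ⟩ φ
      ⇔
      ∃* y (⟨ x :=⃗ y ⟩ φ
            ∧ ∃ᵘ t (con 0ℚ ≤ᶠ var t
                    ∧ ∃ᵘ M (var M >0ᶠ
                            ∧ (ν[ prop X ] ρ))))

module Semantics (ℝ : CompleteOrderedField) (Vars : Variables) where
  open CompleteOrderedField ℝ
  open Variables Vars
  open Syntax Vars

  State : Set
  State = 𝒳 → Carrier

  _≈ˢ_ : Rel State 0ℓ
  ω ≈ˢ ν = ∀ v → ω v ≈ ν v

  _[_↦_] : State → 𝒳 → Carrier → State
  (ω [ x ↦ r ]) v with x ≟ v
  ... | yes _ = r
  ... | no  _ = ω v

  _[_↦*_] : ∀ {N} → State → Vector 𝒳 N → Vector Carrier N → State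
  (ω [ x ↦* r ]) v with any? (λ i → x i ≟ v)
  ... | yes (i , _) = r i
  ... | no  _       = ω v

  ⟦_⟧ᵗ : Term → State → Carrier
  ⟦ var v ⟧ᵗ ω = ω v
  ⟦ con q ⟧ᵗ ω = fromℚ q
  ⟦ a ⊕ b ⟧ᵗ ω = ⟦ a ⟧ᵗ ω + ⟦ b ⟧ᵗ ω
  ⟦ a ⊗ b ⟧ᵗ ω = ⟦ a ⟧ᵗ ω * ⟦ b ⟧ᵗ ω
  ⟦ ⊝ a ⟧ᵗ   ω = - ⟦ a ⟧ᵗ ω

  _⊨ᵃ_ : State → Atom → Set
  ω ⊨ᵃ (a ≐ᵗ b) = ⟦ a ⟧ᵗ ω ≈ ⟦ b ⟧ᵗ ω
  ω ⊨ᵃ (a ≼ b)  = ⟦ a ⟧ᵗ ω ≤ ⟦ b ⟧ᵗ ω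

  _⊨ᶠ_ : State → FOFormula → Set
  ω ⊨ᶠ atom p   = ω ⊨ᵃ p
  ω ⊨ᶠ (¬ᶠ ψ)   = ¬ (ω ⊨ᶠ ψ)
  ω ⊨ᶠ (ψ ∧ᶠ χ) = (ω ⊨ᶠ ψ) × (ω ⊨ᶠ χ)
  ω ⊨ᶠ (ψ ∨ᶠ χ) = (ω ⊨ᶠ ψ) ⊎ (ω ⊨ᶠ χ)
  ω ⊨ᶠ ∃ᶠ x ψ   = ∃ λ r → (ω [ x ↦ r ]) ⊨ᶠ ψ
  ω ⊨ᶠ ∀ᶠ x ψ   = ∀ r → (ω [ x ↦ r ]) ⊨ᶠ ψ

  _∈[0,_] _∈⟨0,_⟩ : Carrier → Carrier → Set
  s ∈[0, t ] = 0# ≤ s × s ≤ t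
  s ∈⟨0, t ⟩ = 0# < s × s < t

  ContinuousOn[0,_] : Carrier → (Carrier → Carrier) → Set
  ContinuousOn[0, t ] f =
    ∀ {s} → s ∈[0, t ] → ∀ {ε} → 0# < ε →
    ∃ λ δ → 0# < δ ×
      (∀ {s′} → s′ ∈[0, t ] → ∣ s′ - s ∣ < δ → ∣ f s′ - f s ∣ < ε)

  HasDerivativeOn⟨0,_⟩ : Carrier → (f f′ : Carrier → Carrier) → Set
  HasDerivativeOn⟨0, t ⟩ f f′ =
    ∀ {s} → s ∈⟨0, t ⟩ → ∀ {ε} → 0# < ε →
    ∃ λ δ → 0# < δ ×
      (∀ {s′} → s′ ∈⟨0, t ⟩ → ¬ (s′ ≈ s) → ∣ s′ - s ∣ < δ →
       ∣ (f s′ - f s) * ((s′ - s) ⁻¹) - f′ s ∣ < ε)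

  -- γ : [0,t] → ℝᴺ is a total function of which only the values on [0,t]
  -- matter; continuity and differentiability in ℝᴺ are componentwise.
  record Evolution {N} (x : Vector 𝒳 N) (θ : Vector Term N) (ψ : FOFormula)
                   (ω ν : State) : Set where
    F : Vector Carrier N → Vector Carrier N
    F r i = ⟦ θ i ⟧ᵗ (ω [ x ↦* r ])
    K : Pred (Vector Carrier N) 0ℓ
    K r = (ω [ x ↦* r ]) ⊨ᶠ ψ
    field
      frame          : ∀ v → (∀ i → x i ≢ v) → ν v ≈ ω v
      t              : Carrier
      t≥0            : 0# ≤ t
      γ              : Carrier → Vector Carrier N
      continuous     : ∀ i → ContinuousOn[0, t ] (λ s → γ s i)
      differentiable : ∀ i → HasDerivativeOn⟨0, t ⟩ (λ s → γ s i) (λ s → F (γ s) i)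
      start          : ∀ i → γ 0# i ≈ ω (x i)
      end            : ∀ i → γ t i ≈ ν (x i)
      inside         : ∀ {s} → s ∈[0, t ] → γ s ∈ K

  ⟦_⟧ᵐ : Act → Rel State 0ℓ
  ⟦ x :=* ⟧ᵐ             ω ν = ∃ λ r → ν ≈ˢ (ω [ x ↦ r ])
  ⟦ x := θ ⟧ᵐ            ω ν = ν ≈ˢ (ω [ x ↦ ⟦ θ ⟧ᵗ ω ])
  ⟦ (x , _) ′= θ & ψ ⟧ᵐ  ω ν = Evolution x θ ψ ω ν

  -- Sets of states: predicates that respect the equality of states.
  record StateSet : Set₁ where
    constructor stateSet
    field
      holds    : Pred State 0ℓ
      respects : ∀ {ω ν} → ω ≈ˢ ν → holds ω → holds ν
  open StateSet

  ∁ : StateSet → StateSet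
  ∁ D = stateSet (λ ω → ¬ holds D ω)
                 (λ ω≈ν ¬Dω Dν → ¬Dω (respects D (λ v → sym (ω≈ν v)) Dν))

  Valuation : Set₁
  Valuation = 𝒱 → StateSet

  ⟦_⟧ᵖ : 𝒱̄ → Valuation → StateSet
  ⟦ prop X ⟧ᵖ V = V X
  ⟦ comp X ⟧ᵖ V = ∁ (V X)

  _[_↦ᵖ_] : Valuation → 𝒱 → StateSet → Valuation
  (V [ X ↦ᵖ D ]) Y with X ≟ᵖ Y
  ... | yes _ = D
  ... | no  _ = V Y

  -- Giving the value D to a complemented variable gives ∁ D to the variable.
  _[_↦ˡ_] : Valuation → 𝒱̄ → StateSet → Valuation
  V [ prop X ↦ˡ D ] = V [ X ↦ᵖ D ]
  V [ comp X ↦ˡ D ] = V [ X ↦ᵖ ∁ D ]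

  -- Predicativity puts the values of an operator one universe above its
  -- arguments; under excluded middle the two levels have the same subsets.
  Operator : Set₂
  Operator = StateSet → Pred State (lsuc 0ℓ)

  IsFixpoint IsLeastFixpoint IsGreatestFixpoint : Operator → StateSet → Set₁
  IsFixpoint         G D = holds D ≐ G D
  IsLeastFixpoint    G D = IsFixpoint G D × (∀ E → IsFixpoint G E → holds D ⊆ holds E)
  IsGreatestFixpoint G D = IsFixpoint G D × (∀ E → IsFixpoint G E → holds E ⊆ holds D)

  ⟦_⟧ : Formula → Valuation → Pred State (lsuc 0ℓ)
  ⟦ lit (pos p) ⟧ V ω = Lift _ (ω ⊨ᵃ p)
  ⟦ lit (neg p) ⟧ V ω = Lift _ (¬ (ω ⊨ᵃ p))
  ⟦ pvar L ⟧      V ω = Lift _ (holds (⟦ L ⟧ᵖ V) ω)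
  ⟦ φ ∨ ψ ⟧       V ω = ⟦ φ ⟧ V ω ⊎ ⟦ ψ ⟧ V ω
  ⟦ φ ∧ ψ ⟧       V ω = ⟦ φ ⟧ V ω × ⟦ ψ ⟧ V ω
  ⟦ ⟨ a ⟩ φ ⟧     V ω = ∃ λ ν → ⟦ a ⟧ᵐ ω ν × ⟦ φ ⟧ V ν
  ⟦ [ a ] φ ⟧     V ω = ∀ ν → ⟦ a ⟧ᵐ ω ν → ⟦ φ ⟧ V ν
  ⟦ μ[ L ] φ ⟧    V ω = ∃ λ D → IsLeastFixpoint (λ E → ⟦ φ ⟧ (V [ L ↦ˡ E ])) D × holds D ω
  ⟦ ν[ L ] φ ⟧    V ω = ∃ λ D → IsGreatestFixpoint (λ E → ⟦ φ ⟧ (V [ L ↦ˡ E ])) D × holds D ω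

  Valid : Formula → Set₁
  Valid φ = ∀ V ω → ω ∈ ⟦ φ ⟧ V

{-# OPTIONS --safe #-}
module Submission where

open import Defs
open import Algebra.Bundles using (CommutativeRing)
import Algebra.Properties.Ring as RingProperties
import Algebra.Properties.Semiring.Mult.TCOptimised as SemiringMult
import Algebra.Properties.Semiring.Sum as SemiringSum
import Algebra.Solver.Ring as RingSolver
open import Algebra.Solver.Ring.AlmostCommutativeRing using (fromCommutativeRing; _-Raw-AlmostCommutative⟶_)
open import Axiom.ExcludedMiddle using (ExcludedMiddle)
open import Data.Empty using (⊥)
open import Data.Fin.Base using (Fin; zero; suc)
open import Data.Fin.Properties using (any?; suc-injective)
open import Data.Integer.Base as ℤ using (ℤ; +_; -[1+_])
import Data.Integer.Properties as ℤ
open import Data.List.Base using (List; []; _∷_; _++_; tabulate)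
open import Data.List.Membership.Propositional using () renaming (_∈_ to _∈ˡ_; _∉_ to _∉ˡ_)
open import Data.List.Membership.Propositional.Properties using (∈-++⁺ˡ; ∈-++⁺ʳ; ∈-++⁻; ∈-tabulate⁺)
open import Data.List.Relation.Binary.Disjoint.Propositional using (Disjoint)
import Data.List.Relation.Unary.All as All
import Data.List.Relation.Unary.All.Properties as All
open import Data.List.Relation.Unary.AllPairs using ([]; _∷_)
open import Data.List.Relation.Unary.Any using (here; there)
open import Data.List.Relation.Unary.Unique.Propositional using (Unique)
open import Data.Maybe.Base using (just; nothing)
open import Data.Nat.Base as ℕ using (zero; suc)
open import Data.Product.Base using (Σ; ∃; ∃₂; _×_; _,_; proj₁; proj₂)
open import Data.Rational.Base using (0ℚ; 1ℚ; ½; _/_)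
open import Data.Sign.Base as Sign using ()
open import Data.Sum.Base using (_⊎_; inj₁; inj₂; [_,_]′)
open import Data.Unit.Base using (tt)
open import Data.Vec.Functional using (Vector; toList; foldr)
open import Function.Base using (id; const; _∘_)
open import Function.Definitions using (Injective)
open import Level using (lift; lower; 0ℓ) renaming (suc to lsuc)
open import Relation.Binary.Core using (Rel)
open import Relation.Binary.Definitions using (WeaklyDecidable)
open import Relation.Binary.PropositionalEquality.Core as ≡ using (_≡_; _≢_)
import Relation.Binary.Reasoning.Setoid as SetoidReasoning
open import Relation.Binary.Structures using (IsTotalOrder)
open import Relation.Nullary.Decidable using (True; toWitness; fromWitness)
open import Relation.Nullary.Decidable.Core using (Dec; yes; no; map′)
open import Relation.Nullary.Negation.Core using (¬_; contradiction)
open import Relation.Unary using (Pred; _⊆_; _≐_; U)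

-- From left to right, the states in which x and y are points of the given trajectory γ, with y a
-- time t after x, form a postfixpoint of ρ: conjunct (2) is the mean value theorem and (3) the
-- second-order Taylor formula, applied to the scalar function ⟨d , γ(s)⟩ with d = y − x and
-- d = y − x − tθ respectively.  From right to left, unfolding the greatest fixpoint bisects the
-- time interval for ever.  By (1) and (2) the resulting nodes depend on time in a Lipschitz way,
-- and by (3) the error of the tangent approximation is quadratic on every piece; since these
-- bounds survive concatenation of pieces, they hold between any two nodes.  A Lipschitz extension
-- of the nodes to the whole time interval is then differentiable and solves the equation.

-- Polynomial fields are Lipschitz only on bounded sets and their solutions may blow up, so no
-- existence theorem is invoked: M confines the nodes to a bounded set, and the solution is read off
-- from them. The delicate point is that tangent errors are taken at different base points. At the
-- junction of pieces of lengths h and k the slope changes by at most K L h, which costs K L h k,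
-- while replacing C h² + C k² by C (h + k)² gains only 2 C h k. The enlarged constant C + K L
-- reproduces itself under concatenation, so one constant serves at every depth. Two obligations
-- come from the logic. The two sides evaluate φ in states that differ in y, so an arbitrary
-- fixpoint formula must be shown insensitive to variables that it does not contain. And the
-- equivalence is defined through syntactic negation, which must be shown to denote the complement;
-- at fixpoints this is the duality of μ and ν, and it rests on monotonicity of the bodies.

-- Ring identities with integer coefficients

module IntegerCoefficients (R : CommutativeRing 0ℓ 0ℓ) where
  open CommutativeRing R hiding (zero)
  open RingProperties ring
    using (-0#≈0#; -‿involutive; -‿+-comm; -‿distribˡ-*; -‿distribʳ-*)
  open SemiringMult semiring using (×1-homo-*; ×-homo-+; 1+×) renaming (_×_ to _·_)
  open SetoidReasoning setoid

  embed : ℤ → Carrier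
  embed (+ n)    = n · 1#
  embed -[1+ n ] = - (suc n · 1#)

  embed-⊖ : ∀ m n → embed (m ℤ.⊖ n) ≈ m · 1# - n · 1#
  embed-⊖ m       zero    = sym (trans (+-congˡ -0#≈0#) (+-identityʳ _))
  embed-⊖ zero    (suc n) = sym (+-identityˡ _)
  embed-⊖ (suc m) (suc n) = begin
    embed (suc m ℤ.⊖ suc n)                   ≡⟨ ≡.cong embed (ℤ.[1+m]⊖[1+n]≡m⊖n m n) ⟩
    embed (m ℤ.⊖ n)                           ≈⟨ embed-⊖ m n ⟩
    m · 1# - n · 1#                           ≈⟨ +-congʳ (+-identityʳ _) ⟨
    (m · 1# + 0#) - n · 1#                    ≈⟨ +-congʳ (+-congˡ (-‿inverseʳ 1#)) ⟨
    (m · 1# + (1# - 1#)) - n · 1#             ≈⟨ +-congʳ (+-assoc _ _ _) ⟨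
    (m · 1# + 1# - 1#) - n · 1#               ≈⟨ +-assoc _ _ _ ⟩
    (m · 1# + 1#) + (- 1# - n · 1#)           ≈⟨ +-cong (+-comm _ _) (-‿+-comm _ _) ⟩
    (1# + m · 1#) - (1# + n · 1#)             ≈⟨ +-cong (1+× m 1#) (-‿cong (1+× n 1#)) ⟨
    suc m · 1# - suc n · 1#                   ∎

  embed-+ : ∀ i j → embed (i ℤ.+ j) ≈ embed i + embed j
  embed-+ (+ m)    (+ n)    = ×-homo-+ 1# m n
  embed-+ (+ m)    -[1+ n ] = embed-⊖ m (suc n)
  embed-+ -[1+ m ] (+ n)    = trans (embed-⊖ n (suc m)) (+-comm _ _)
  embed-+ -[1+ m ] -[1+ n ] = begin
    - (suc (suc (m ℕ.+ n)) · 1#)              ≈⟨ -‿cong (1+× (suc m ℕ.+ n) 1#) ⟩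
    - (1# + (suc m ℕ.+ n) · 1#)               ≈⟨ -‿cong (+-congˡ (×-homo-+ 1# (suc m) n)) ⟩
    - (1# + (suc m · 1# + n · 1#))            ≈⟨ -‿cong (trans (sym (+-assoc _ _ _)) (trans (+-congʳ (+-comm _ _)) (+-assoc _ _ _))) ⟩
    - (suc m · 1# + (1# + n · 1#))            ≈⟨ -‿cong (+-congˡ (1+× n 1#)) ⟨
    - (suc m · 1# + suc n · 1#)               ≈⟨ -‿+-comm _ _ ⟨
    - (suc m · 1#) - suc n · 1#               ∎

  embed-+◃ : ∀ n → embed (Sign.+ ℤ.◃ n) ≈ n · 1#
  embed-+◃ zero    = refl
  embed-+◃ (suc n) = refl

  embed--◃ : ∀ n → embed (Sign.- ℤ.◃ n) ≈ - (n · 1#)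
  embed--◃ zero    = sym -0#≈0#
  embed--◃ (suc n) = refl

  embed-* : ∀ i j → embed (i ℤ.* j) ≈ embed i * embed j
  embed-* (+ m)    (+ n)    = trans (embed-+◃ (m ℕ.* n)) (×1-homo-* m n)
  embed-* (+ m)    -[1+ n ] = trans (embed--◃ (m ℕ.* suc n))
    (trans (-‿cong (×1-homo-* m (suc n))) (-‿distribʳ-* _ _))
  embed-* -[1+ m ] (+ n)    = trans (embed--◃ (suc m ℕ.* n))
    (trans (-‿cong (×1-homo-* (suc m) n)) (-‿distribˡ-* _ _))
  embed-* -[1+ m ] -[1+ n ] = trans (embed-+◃ (suc m ℕ.* suc n))
    (trans (×1-homo-* (suc m) (suc n))
    (trans (sym (-‿involutive _)) (trans (-‿cong (-‿distribˡ-* _ _)) (-‿distribʳ-* _ _))))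

  embed-neg : ∀ i → embed (ℤ.- i) ≈ - embed i
  embed-neg (+ zero)  = sym -0#≈0#
  embed-neg (+ suc n) = refl
  embed-neg -[1+ n ]  = sym (-‿involutive _)

  -- Equality in the ring does not compute, so the solver takes its coefficients from ℤ, where like
  -- terms can be collected and cancelled by evaluation.
  homomorphism : ℤ.+-*-rawRing -Raw-AlmostCommutative⟶ fromCommutativeRing R
  homomorphism = record
    { ⟦_⟧    = embed
    ; +-homo = embed-+
    ; *-homo = embed-*
    ; -‿homo = embed-neg
    ; 0-homo = refl
    ; 1-homo = refl
    }

  embed≟ : WeaklyDecidable (λ i j → embed i ≈ embed j)
  embed≟ i j with i ℤ.≟ j
  ... | yes i≡j = just (reflexive (≡.cong embed i≡j))
  ... | no  _   = nothing

  open RingSolver ℤ.+-*-rawRing (fromCommutativeRing R) homomorphism embed≟ public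
    using (Polynomial; solve; _:+_; _:*_; _:-_; :-_; con; _:=_)

-- Order and two-sided bounds in an ordered field

module OrderedField (em : ExcludedMiddle 0ℓ) (ℝ : CompleteOrderedField) where
  open CompleteOrderedField ℝ
  open IntegerCoefficients commutativeRing public hiding (homomorphism)
  open IsTotalOrder isTotalOrder public using (antisym)
    renaming (refl to ≤-refl; reflexive to ≤-reflexive; trans to ≤-trans)

  -- The pattern of most inequalities below: the ring solver rewrites the difference of the two
  -- sides as an expression whose nonnegativity can be read off its factors.
  nonneg⇒≤ : ∀ {a b e} → 0# ≤ e → b - a ≈ e → a ≤ b
  nonneg⇒≤ {a} {b} {e} 0≤e b-a≈e = ≤-trans (≤-reflexive (sym (+-identityʳ a)))
    (≤-trans (+-monoʳ-≤ a 0≤e)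
    (≤-reflexive (trans (+-congˡ (sym b-a≈e)) (solve 2 (λ a b → a :+ (b :- a) := b) refl a b))))

  ≤⇒nonneg : ∀ {a b} → a ≤ b → 0# ≤ b - a
  ≤⇒nonneg {a} {b} a≤b = ≤-trans (≤-reflexive (sym (-‿inverseˡ a)))
    (≤-trans (+-monoʳ-≤ (- a) a≤b) (≤-reflexive (+-comm _ _)))

  infixl 6 _+≥0_
  infixl 7 _*≥0_
  _+≥0_ : ∀ {a b} → 0# ≤ a → 0# ≤ b → 0# ≤ a + b
  _+≥0_ {a} {b} 0≤a 0≤b = ≤-trans 0≤a
    (≤-trans (≤-reflexive (sym (+-identityʳ a))) (+-monoʳ-≤ a 0≤b))

  _*≥0_ : ∀ {a b} → 0# ≤ a → 0# ≤ b → 0# ≤ a * b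
  _*≥0_ = *-nonneg

  +-mono-≤ : ∀ {a b c d} → a ≤ b → c ≤ d → a + c ≤ b + d
  +-mono-≤ {a} {b} {c} {d} p q = nonneg⇒≤ (≤⇒nonneg p +≥0 ≤⇒nonneg q)
    (solve 4 (λ a b c d → (b :+ d) :- (a :+ c) := (b :- a) :+ (d :- c)) refl a b c d)

  *-monoˡ-≤ : ∀ {a b c} → 0# ≤ c → a ≤ b → c * a ≤ c * b
  *-monoˡ-≤ {a} {b} {c} p q = nonneg⇒≤ (p *≥0 ≤⇒nonneg q)
    (solve 3 (λ a b c → c :* b :- c :* a := c :* (b :- a)) refl a b c)

  *-mono-≤ : ∀ {a b c d} → 0# ≤ a → 0# ≤ d → a ≤ b → c ≤ d → a * c ≤ b * d
  *-mono-≤ {a} {b} {c} {d} 0≤a 0≤d p q = nonneg⇒≤ (≤⇒nonneg p *≥0 0≤d +≥0 0≤a *≥0 ≤⇒nonneg q)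
    (solve 4 (λ a b c d → b :* d :- a :* c := (b :- a) :* d :+ a :* (d :- c)) refl a b c d)

  neg-mono-≤ : ∀ {a b} → a ≤ b → - b ≤ - a
  neg-mono-≤ {a} {b} p = nonneg⇒≤ (≤⇒nonneg p)
    (solve 2 (λ a b → (:- a) :- (:- b) := b :- a) refl a b)

  ≤-resp : ∀ {a a′ b b′} → a ≈ a′ → b ≈ b′ → a ≤ b → a′ ≤ b′
  ≤-resp p q r = ≤-trans (≤-reflexive (sym p)) (≤-trans r (≤-reflexive q))

  halve-nonneg : ∀ {a} → 0# ≤ a + a → 0# ≤ a
  halve-nonneg {a} p with total 0# a
  ... | inj₁ 0≤a = 0≤a
  ... | inj₂ a≤0 = ≤-trans p (≤-resp refl (+-identityʳ a) (+-monoʳ-≤ a a≤0))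

  square-nonneg : ∀ a → 0# ≤ a * a
  square-nonneg a with total 0# a
  ... | inj₁ 0≤a = 0≤a *≥0 0≤a
  ... | inj₂ a≤0 = ≤-resp refl (solve 1 (λ a → (con (+ 0) :- a) :* (con (+ 0) :- a) := a :* a) refl a)
                     (≤⇒nonneg a≤0 *≥0 ≤⇒nonneg a≤0)

  0≤1 : 0# ≤ 1#
  0≤1 = ≤-resp refl (*-identityʳ 1#) (square-nonneg 1#)

  0<1 : 0# < 1#
  0<1 = 0≤1 , λ 0≈1 → 1≉0 (sym 0≈1)

  ≰⇒> : ∀ {a b} → ¬ (a ≤ b) → b < a
  ≰⇒> {a} {b} a≰b with total a b
  ... | inj₁ a≤b = contradiction a≤b a≰b
  ... | inj₂ b≤a = b≤a , λ b≈a → a≰b (≤-reflexive (sym b≈a))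

  <⇒≱ : ∀ {a b} → a < b → ¬ (b ≤ a)
  <⇒≱ (a≤b , a≉b) b≤a = a≉b (antisym a≤b b≤a)

  ≤-<-trans : ∀ {a b c} → a ≤ b → b < c → a < c
  ≤-<-trans a≤b b<c = ≰⇒> λ c≤a → <⇒≱ b<c (≤-trans c≤a a≤b)

  <-≤-trans : ∀ {a b c} → a < b → b ≤ c → a < c
  <-≤-trans a<b b≤c = ≰⇒> λ c≤a → <⇒≱ a<b (≤-trans b≤c c≤a)

  ≤-or-> : ∀ a b → a ≤ b ⊎ b < a
  ≤-or-> a b with em {a ≤ b}
  ... | yes p = inj₁ p
  ... | no  p = inj₂ (≰⇒> p)

  pos⇒< : ∀ {a b e} → 0# < e → b - a ≈ e → a < b
  pos⇒< {a} {b} {e} 0<e b-a≈e = nonneg⇒≤ (proj₁ 0<e) b-a≈e ,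
    λ a≈b → proj₂ 0<e (trans (sym (-‿inverseʳ a)) (trans (+-congʳ a≈b) b-a≈e))

  <⇒pos : ∀ {a b} → a < b → 0# < b - a
  <⇒pos {a} {b} (a≤b , a≉b) = ≤⇒nonneg a≤b , λ 0≈b-a → a≉b
    (trans (sym (+-identityʳ a)) (trans (+-congˡ 0≈b-a) (solve 2 (λ a b → a :+ (b :- a) := b) refl a b)))

  +-pos-nonneg : ∀ {a b} → 0# < a → 0# ≤ b → 0# < a + b
  +-pos-nonneg {a} 0<a 0≤b = <-≤-trans 0<a (≤-resp (+-identityʳ a) refl (+-monoʳ-≤ a 0≤b))

  *-pos : ∀ {a b} → 0# < a → 0# < b → 0# < a * b
  *-pos {a} {b} (0≤a , 0≉a) (0≤b , 0≉b) = 0≤a *≥0 0≤b , λ 0≈ab → 0≉b (sym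
    (trans (sym (*-identityˡ b)) (trans (*-congʳ (sym (⁻¹-inverseʳ a (λ a≈0 → 0≉a (sym a≈0)))))
    (trans (solve 3 (λ a b c → a :* c :* b := c :* (a :* b)) refl a b (a ⁻¹))
    (trans (*-congˡ (sym 0≈ab)) (zeroʳ _))))))

  inverse : ∀ {a} → 0# < a → a * a ⁻¹ ≈ 1#
  inverse {a} (_ , 0≉a) = ⁻¹-inverseʳ a (λ a≈0 → 0≉a (sym a≈0))

  ⁻¹-pos : ∀ {a} → 0# < a → 0# < a ⁻¹
  ⁻¹-pos {a} 0<a = ≰⇒> λ a⁻¹≤0 → <⇒≱ 0<1 (nonneg⇒≤ (proj₁ 0<a *≥0 ≤⇒nonneg a⁻¹≤0)
    (trans (+-congˡ (-‿cong (sym (inverse 0<a))))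
    (solve 2 (λ a b → con (+ 0) :- (a :* b) := a :* (con (+ 0) :- b)) refl a (a ⁻¹))))

  0<2 : 0# < 1# + 1#
  0<2 = +-pos-nonneg 0<1 0≤1

  half : Carrier → Carrier
  half a = a * (1# + 1#) ⁻¹

  half+half : ∀ a → half a + half a ≈ a
  half+half a = trans (solve 2 (λ a i → a :* i :+ a :* i := a :* (con (+ 2) :* i)) refl a ((1# + 1#) ⁻¹))
    (trans (*-congˡ (inverse 0<2)) (*-identityʳ a))

  half-pos : ∀ {a} → 0# < a → 0# < half a
  half-pos 0<a = *-pos 0<a (⁻¹-pos 0<2)

  half-nonneg : ∀ {a} → 0# ≤ a → 0# ≤ half a
  half-nonneg 0≤a = 0≤a *≥0 proj₁ (⁻¹-pos 0<2)

  half< : ∀ {a} → 0# < a → half a < a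
  half< {a} 0<a = pos⇒< (half-pos 0<a)
    (trans (+-congʳ (sym (half+half a))) (solve 1 (λ h → h :+ h :- h := h) refl (half a)))

  *-cancelʳ-≤ : ∀ {a b c} → 0# < c → a * c ≤ b * c → a ≤ b
  *-cancelʳ-≤ {a} {b} {c} 0<c ac≤bc with ≤-or-> a b
  ... | inj₁ a≤b = a≤b
  ... | inj₂ b<a = contradiction ac≤bc (<⇒≱ (pos⇒< (*-pos (<⇒pos b<a) 0<c)
          (solve 3 (λ a b c → a :* c :- b :* c := (a :- b) :* c) refl a b c)))

  common-lower : ∀ {a b} → 0# < a → 0# < b → ∃ λ η → 0# < η × η ≤ a × η ≤ b
  common-lower {a} {b} 0<a 0<b with total a b
  ... | inj₁ a≤b = a , 0<a , ≤-refl , a≤b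
  ... | inj₂ b≤a = b , 0<b , b≤a , ≤-refl

  -- The witness is the minimum of 1 and ε / (1 + c); the summand 1 keeps the denominator positive
  -- when c vanishes.
  scaled-lower : ∀ {ε c} → 0# < ε → 0# ≤ c → ∃ λ η → 0# < η × η ≤ 1# × c * η ≤ ε
  scaled-lower {ε} {c} 0<ε 0≤c with common-lower 0<1 (*-pos 0<ε (⁻¹-pos (+-pos-nonneg 0<1 0≤c)))
  ... | η , 0<η , η≤1 , η≤e = η , 0<η , η≤1 , ≤-trans (*-monoˡ-≤ 0≤c η≤e) (nonneg⇒≤ (proj₁ 0<e)
    (trans (+-congʳ (trans (sym (*-identityʳ ε)) (*-congˡ (sym (inverse 0<1+c)))))
    (solve 3 (λ ε c i → ε :* ((con (+ 1) :+ c) :* i) :- c :* (ε :* i) := ε :* i) refl ε c ((1# + c) ⁻¹))))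
    where
    0<1+c = +-pos-nonneg 0<1 0≤c
    0<e = *-pos 0<ε (⁻¹-pos 0<1+c)

  infix 4 _≤±_
  -- Stands for |a| ≤ b. As a pair of inequalities it passes through sums and products without the
  -- case distinction by which `∣_∣` is defined.
  _≤±_ : Carrier → Carrier → Set
  a ≤± b = - b ≤ a × a ≤ b

  ≤±-nonneg : ∀ {a b} → a ≤± b → 0# ≤ b
  ≤±-nonneg {a} {b} (-b≤a , a≤b) = halve-nonneg (≤-resp refl
    (solve 2 (λ a b → (a :- (:- b)) :+ (b :- a) := b :+ b) refl a b) (≤⇒nonneg -b≤a +≥0 ≤⇒nonneg a≤b))

  ≤±-weaken : ∀ {a b c} → b ≤ c → a ≤± b → a ≤± c
  ≤±-weaken b≤c (p , q) = ≤-trans (neg-mono-≤ b≤c) p , ≤-trans q b≤c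

  ≤±-resp : ∀ {a a′ b b′} → a ≈ a′ → b ≈ b′ → a ≤± b → a′ ≤± b′
  ≤±-resp p q (r , s) = ≤-resp (-‿cong q) p r , ≤-resp p q s

  ≤±-neg : ∀ {a b} → a ≤± b → - a ≤± b
  ≤±-neg {a} {b} (p , q) = neg-mono-≤ q , ≤-resp refl (solve 1 (λ b → :- (:- b) := b) refl b) (neg-mono-≤ p)

  infixl 6 _+±_
  infixl 7 _*±_
  _+±_ : ∀ {a b c d} → a ≤± b → c ≤± d → a + c ≤± b + d
  _+±_ {b = b} {d = d} (p , q) (r , s) =
    ≤-resp (solve 2 (λ b d → (:- b) :+ (:- d) := :- (b :+ d)) refl b d) refl (+-mono-≤ p r) , +-mono-≤ q s

  -- No case split on signs: 2(bd + ac) = (b - a)(d - c) + (a + b)(c + d) and 2(bd - ac) = (b - a)(c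
  -- + d) + (a + b)(d - c), where all factors on the right are nonnegative.
  _*±_ : ∀ {a b c d} → a ≤± b → c ≤± d → a * c ≤± b * d
  _*±_ {a} {b} {c} {d} (p , q) (r , s) =
    nonneg⇒≤ (halve-nonneg (≤-resp refl
      (solve 4 (λ a b c d → (b :- a) :* (d :- c) :+ (a :- (:- b)) :* (c :- (:- d))
                := (a :* c :- (:- (b :* d))) :+ (a :* c :- (:- (b :* d)))) refl a b c d)
      (≤⇒nonneg q *≥0 ≤⇒nonneg s +≥0 ≤⇒nonneg p *≥0 ≤⇒nonneg r))) refl ,
    nonneg⇒≤ (halve-nonneg (≤-resp refl
      (solve 4 (λ a b c d → (b :- a) :* (c :- (:- d)) :+ (a :- (:- b)) :* (d :- c)
                := (b :* d :- a :* c) :+ (b :* d :- a :* c)) refl a b c d)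
      (≤⇒nonneg q *≥0 ≤⇒nonneg r +≥0 ≤⇒nonneg p *≥0 ≤⇒nonneg s))) refl

  nonneg⇒≤± : ∀ {a b} → 0# ≤ a → a ≤ b → a ≤± b
  nonneg⇒≤± 0≤a a≤b = ≤-trans (≤-resp refl (solve 0 (:- con (+ 0) := con (+ 0)) refl) (neg-mono-≤ (≤-trans 0≤a a≤b))) 0≤a , a≤b

  ≤±-refl : ∀ {a} → 0# ≤ a → a ≤± a
  ≤±-refl 0≤a = nonneg⇒≤± 0≤a ≤-refl

  ≈0⇒≤± : ∀ {a b} → a ≈ 0# → 0# ≤ b → a ≤± b
  ≈0⇒≤± a≈0 0≤b = ≤±-resp (sym a≈0) refl (nonneg⇒≤± ≤-refl 0≤b)

  ≤±0⇒≈0 : ∀ {a} → a ≤± 0# → a ≈ 0#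
  ≤±0⇒≈0 (p , q) = antisym q (≤-resp (solve 0 (:- con (+ 0) := con (+ 0)) refl) refl p)

  ≤±-bound : ∀ a → ∃ λ b → a ≤± b
  ≤±-bound a with total 0# a
  ... | inj₁ 0≤a = a , ≤±-refl 0≤a
  ... | inj₂ a≤0 = - a , ≤-reflexive (solve 1 (λ a → :- (:- a) := a) refl a) ,
        nonneg⇒≤ (≤⇒nonneg a≤0 +≥0 ≤⇒nonneg a≤0)
          (solve 1 (λ a → (:- a) :- a := (con (+ 0) :- a) :+ (con (+ 0) :- a)) refl a)

  ∣∣<⇒≤± : ∀ {a b} → ∣ a ∣ < b → a ≤± b
  ∣∣<⇒≤± {a} {b} ∣a∣<b with total 0# a
  ... | inj₁ 0≤a = nonneg⇒≤± 0≤a (proj₁ ∣a∣<b)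
  ... | inj₂ a≤0 = ≤±-resp (solve 1 (λ a → :- (:- a) := a) refl a) refl
        (≤±-neg (nonneg⇒≤± (≤-resp refl (solve 1 (λ a → con (+ 0) :- a := :- a) refl a) (≤⇒nonneg a≤0)) (proj₁ ∣a∣<b)))

  ≤±⇒∣∣< : ∀ {a b c} → a ≤± b → b < c → ∣ a ∣ < c
  ≤±⇒∣∣< {a} {b} (p , q) b<c with total 0# a
  ... | inj₁ 0≤a = ≤-<-trans q b<c
  ... | inj₂ a≤0 = ≤-<-trans (≤-resp refl (solve 1 (λ b → :- (:- b) := b) refl b) (neg-mono-≤ p)) b<c

  ≤±-cancelʳ : ∀ {a c h} → 0# < h → a * h ≤± c * h → a ≤± c
  ≤±-cancelʳ {a} {c} {h} 0<h (p , q) =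
    *-cancelʳ-≤ 0<h (≤-resp (solve 2 (λ c h → :- (c :* h) := (:- c) :* h) refl c h) refl p) ,
    *-cancelʳ-≤ 0<h q

  <-+ : ∀ {a b} → 0# < b → a < a + b
  <-+ {a} {b} 0<b = pos⇒< 0<b (solve 2 (λ a b → a :+ b :- a := b) refl a b)

  ≤-+ : ∀ {a b} → 0# ≤ b → a ≤ a + b
  ≤-+ {a} {b} 0≤b = nonneg⇒≤ 0≤b (solve 2 (λ a b → a :+ b :- a := b) refl a b)

  -‿< : ∀ {a b} → 0# < b → a - b < a
  -‿< {a} {b} 0<b = pos⇒< 0<b (solve 2 (λ a b → a :- (a :- b) := b) refl a b)

  +≤⇒≤- : ∀ {a b c} → a + b ≤ c → a ≤ c - b
  +≤⇒≤- {a} {b} {c} p = nonneg⇒≤ (≤⇒nonneg p) (solve 3 (λ a b c → c :- b :- a := c :- (a :+ b)) refl a b c)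

-- Induction over intervals and the Archimedean property

module Completeness (em : ExcludedMiddle 0ℓ) (ℝ : CompleteOrderedField) where
  open CompleteOrderedField ℝ
  open OrderedField em ℝ

  -- Cousin's lemma, phrased for interval predicates instead of tagged partitions.
  interval-induction : (P : Carrier → Carrier → Set) → ∀ {a b} → a ≤ b →
    (∀ s → a ≤ s → s ≤ b → ∃ λ δ → 0# < δ ×
       (∀ {c d} → a ≤ c → c ≤ s → s ≤ d → d ≤ b → s ≤ c + δ → d ≤ s + δ → P c d)) →
    (∀ {c d e} → c ≤ d → d ≤ e → P c d → P d e → P c e) →
    P a b
  interval-induction P {a} {b} a≤b local glue = from-sup (complete S (a , Sa) (b , λ (_ , s≤b , _) → s≤b))
    where
    S : Pred Carrier 0ℓ
    S s = a ≤ s × s ≤ b × P a s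

    Sa : S a
    Sa = let (δ , 0<δ , near) = local a ≤-refl a≤b in
      ≤-refl , a≤b , near ≤-refl ≤-refl ≤-refl a≤b (≤-+ (proj₁ 0<δ)) (≤-+ (proj₁ 0<δ))

    -- The supremum `c` is not yet known to belong to `S`. A point of `S` within δ below it is
    -- enough, since `near` covers intervals that straddle `c`; if `b` were out of reach, c + δ
    -- would belong to `S`.
    finish : ∀ {c δ} → a ≤ c → c ≤ b → 0# < δ → UpperBound S c →
      (∀ {d e} → a ≤ d → d ≤ c → c ≤ e → e ≤ b → c ≤ d + δ → e ≤ c + δ → P d e) →
      (∃ λ s → S s × c ≤ s + δ) → P a b
    finish {c} {δ} a≤c c≤b 0<δ S≤c near (s , (a≤s , s≤b , Ps) , c≤s+δ) with ≤-or-> b (c + δ)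
    ... | inj₁ b≤c+δ = glue a≤s s≤b Ps (near a≤s (S≤c (a≤s , s≤b , Ps)) c≤b ≤-refl c≤s+δ b≤c+δ)
    ... | inj₂ (c+δ≤b , _) = contradiction
            (S≤c (≤-trans a≤c (≤-+ (proj₁ 0<δ)) , c+δ≤b ,
              glue a≤s (≤-trans (S≤c (a≤s , s≤b , Ps)) (≤-+ (proj₁ 0<δ))) Ps
                (near a≤s (S≤c (a≤s , s≤b , Ps)) (≤-+ (proj₁ 0<δ)) c+δ≤b c≤s+δ ≤-refl)))
            (<⇒≱ (<-+ 0<δ))

    from-sup : (∃ λ c → UpperBound S c × (∀ {b} → UpperBound S b → c ≤ b)) → P a b
    from-sup (c , S≤c , least) with local c (S≤c Sa) (least λ (_ , s≤b , _) → s≤b)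
    ... | δ , 0<δ , near with em {∃ λ s → S s × c ≤ s + δ}
    ...   | yes found = finish (S≤c Sa) (least λ (_ , s≤b , _) → s≤b) 0<δ S≤c near found
    ...   | no ¬found = contradiction (least S≤c-δ) (<⇒≱ (-‿< 0<δ))
      where
      S≤c-δ : UpperBound S (c - δ)
      S≤c-δ {s} Ss with ≤-or-> c (s + δ)
      ... | inj₁ c≤s+δ = contradiction (s , Ss , c≤s+δ) ¬found
      ... | inj₂ s+δ<c = +≤⇒≤- (proj₁ s+δ<c)

  -- Finitely many halvings bring the length down to ε. An inductive predicate replaces a count of
  -- halvings, so that the search for a node near a given time can recurse on it.
  data Halvable (ε : Carrier) : Carrier → Set where
    small : ∀ {ℓ} → ℓ ≤ ε → Halvable ε ℓ
    halve : ∀ {ℓ} → Halvable ε (half ℓ) → Halvable ε ℓ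

  half-mono : ∀ {a b} → a ≤ b → half a ≤ half b
  half-mono {a} {b} a≤b = nonneg⇒≤ (half-nonneg (≤⇒nonneg a≤b))
    (solve 3 (λ a b h → b :* h :- a :* h := (b :- a) :* h) refl a b ((1# + 1#) ⁻¹))

  half-double : ∀ a → half (a + a) ≈ a
  half-double a = trans (solve 2 (λ a h → (a :+ a) :* h := a :* h :+ a :* h) refl a ((1# + 1#) ⁻¹)) (half+half a)

  halvable-≤ : ∀ {ε a b} → a ≤ b → Halvable ε b → Halvable ε a
  halvable-≤ a≤b (small b≤ε) = small (≤-trans a≤b b≤ε)
  halvable-≤ a≤b (halve h)   = halve (halvable-≤ (half-mono a≤b) h)

  -- The Archimedean property: otherwise the supremum c of the halvable lengths would satisfy 2c ≤ c.
  halvable : ∀ {ε} → 0# < ε → ∀ ℓ → Halvable ε ℓ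
  halvable {ε} 0<ε ℓ with em {Halvable ε ℓ}
  ... | yes h = h
  ... | no ¬h = from-sup (complete (Halvable ε) (ε , small ≤-refl) (ℓ , bound))
    where
    bound : UpperBound (Halvable ε) ℓ
    bound {e} h with ≤-or-> e ℓ
    ... | inj₁ e≤ℓ = e≤ℓ
    ... | inj₂ ℓ<e = contradiction (halvable-≤ (proj₁ ℓ<e) h) ¬h

    from-sup : (∃ λ c → UpperBound (Halvable ε) c × (∀ {b} → UpperBound (Halvable ε) b → c ≤ b)) → Halvable ε ℓ
    from-sup (c , upper , least) = contradiction
      (least λ {e} h → ≤-resp (half-double e) refl
        (half-mono (upper (halve (halvable-≤ (≤-reflexive (half-double e)) h)))))
      (<⇒≱ (half< (<-≤-trans 0<ε (upper (small ≤-refl)))))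

  ≤±-all⇒≈0 : ∀ {a} → (∀ {ε} → 0# < ε → a ≤± ε) → a ≈ 0#
  ≤±-all⇒≈0 {a} p = antisym (≤0 a λ 0<ε → proj₂ (p 0<ε))
    (nonneg⇒≤ (≤⇒nonneg (≤0 (- a) λ 0<ε → proj₂ (≤±-neg (p 0<ε))))
      (solve 1 (λ a → a :- con (+ 0) := con (+ 0) :- (:- a)) refl a))
    where
    ≤0 : ∀ b → (∀ {ε} → 0# < ε → b ≤ ε) → b ≤ 0#
    ≤0 b q with ≤-or-> b 0#
    ... | inj₁ b≤0 = b≤0
    ... | inj₂ 0<b = contradiction (q (half-pos 0<b)) (<⇒≱ (half< 0<b))

-- Limits, continuity and derivatives relative to a domain

module Limits (em : ExcludedMiddle 0ℓ) (ℝ : CompleteOrderedField) where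
  open CompleteOrderedField ℝ hiding (zero)
  open OrderedField em ℝ
  open Completeness em ℝ
  open SemiringSum semiring using (sum)

  -- The domain is not punctured here, so continuity is a special case; `Diff` removes the point
  -- itself, where the value of `_⁻¹` is unconstrained.
  Lim : Pred Carrier 0ℓ → Carrier → (Carrier → Carrier) → Carrier → Set
  Lim D s f l = ∀ {ε} → 0# < ε → ∃ λ δ → 0# < δ ×
    (∀ {s′} → D s′ → s′ - s ≤± δ → f s′ - l ≤± ε)

  Diff : Pred Carrier 0ℓ → Carrier → (Carrier → Carrier) → Carrier → Set
  Diff D s f f′ = Lim (λ s′ → D s′ × ¬ (s′ ≈ s)) s (λ s′ → (f s′ - f s) * (s′ - s) ⁻¹) f′

  Cont : Pred Carrier 0ℓ → Carrier → (Carrier → Carrier) → Set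
  Cont D s f = Lim D s f (f s)

  module _ {D : Pred Carrier 0ℓ} {s : Carrier} where

    lim-resp : ∀ {f g l m} → (∀ {s′} → D s′ → f s′ ≈ g s′) → l ≈ m → Lim D s f l → Lim D s g m
    lim-resp f≈g l≈m lim 0<ε = let (δ , 0<δ , near) = lim 0<ε in
      δ , 0<δ , λ Ds′ close → ≤±-resp (+-cong (f≈g Ds′) (-‿cong l≈m)) refl (near Ds′ close)

    lim-mono : ∀ {E : Pred Carrier 0ℓ} {f l} → (∀ {s′} → E s′ → D s′) → Lim D s f l → Lim E s f l
    lim-mono E⊆D lim 0<ε = let (δ , 0<δ , near) = lim 0<ε in
      δ , 0<δ , λ Es′ → near (E⊆D Es′)

    lim-const : ∀ c → Lim D s (const c) c
    lim-const c {ε} 0<ε = 1# , 0<1 , λ _ _ → ≈0⇒≤± (-‿inverseʳ c) (proj₁ 0<ε)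

    lim-id : Lim D s id s
    lim-id {ε} 0<ε = ε , 0<ε , λ _ close → close

    lim-neg : ∀ {f l} → Lim D s f l → Lim D s (λ r → - f r) (- l)
    lim-neg {f} {l} lim 0<ε = let (δ , 0<δ , near) = lim 0<ε in
      δ , 0<δ , λ {s′} Ds′ close →
        ≤±-resp (solve 2 (λ f l → :- (f :- l) := (:- f) :- (:- l)) refl (f s′) l) refl (≤±-neg (near Ds′ close))

    lim-+ : ∀ {f g l m} → Lim D s f l → Lim D s g m → Lim D s (λ r → f r + g r) (l + m)
    lim-+ {f} {g} {l} {m} limf limg {ε} 0<ε =
      let (δ₁ , 0<δ₁ , near₁) = limf (half-pos 0<ε)
          (δ₂ , 0<δ₂ , near₂) = limg (half-pos 0<ε)
          (δ , 0<δ , δ≤δ₁ , δ≤δ₂) = common-lower 0<δ₁ 0<δ₂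
      in δ , 0<δ , λ {s′} Ds′ close →
        ≤±-resp (solve 4 (λ f g l m → (f :- l) :+ (g :- m) := (f :+ g) :- (l :+ m)) refl (f s′) (g s′) l m)
          (half+half ε) (near₁ Ds′ (≤±-weaken δ≤δ₁ close) +± near₂ Ds′ (≤±-weaken δ≤δ₂ close))

    -- The constant comes from xy - lm = (x - l)(y - m) + l(y - m) + m(x - l), with η ≤ 1 applied to
    -- one factor of the first product.
    product-close : ∀ {x y l m η A B} → l ≤± A → m ≤± B → η ≤ 1# → x - l ≤± η → y - m ≤± η →
      x * y - l * m ≤± (1# + A + B) * η
    product-close {x} {y} {l} {m} {η} {A} {B} l≤A m≤B η≤1 dx dy = ≤±-resp
      (solve 4 (λ x y l m → (x :- l) :* (y :- m) :+ l :* (y :- m) :+ m :* (x :- l) := x :* y :- l :* m)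
        refl x y l m)
      (solve 3 (λ η A B → η :* con (+ 1) :+ A :* η :+ B :* η := (con (+ 1) :+ A :+ B) :* η) refl η A B)
      (dx *± ≤±-weaken η≤1 dy +± l≤A *± dy +± m≤B *± dx)

    lim-* : ∀ {f g l m} → Lim D s f l → Lim D s g m → Lim D s (λ r → f r * g r) (l * m)
    lim-* {f} {g} {l} {m} limf limg {ε} 0<ε =
      let (A , l≤A) = ≤±-bound l
          (B , m≤B) = ≤±-bound m
          (η , 0<η , η≤1 , bound) = scaled-lower 0<ε (0≤1 +≥0 ≤±-nonneg l≤A +≥0 ≤±-nonneg m≤B)
          (δ₁ , 0<δ₁ , near₁) = limf 0<η
          (δ₂ , 0<δ₂ , near₂) = limg 0<η
          (δ , 0<δ , δ≤δ₁ , δ≤δ₂) = common-lower 0<δ₁ 0<δ₂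
      in δ , 0<δ , λ Ds′ close → ≤±-weaken bound
           (product-close l≤A m≤B η≤1 (near₁ Ds′ (≤±-weaken δ≤δ₁ close)) (near₂ Ds′ (≤±-weaken δ≤δ₂ close)))

    lim-sum : ∀ {n} {f : Carrier → Vector Carrier n} {l : Vector Carrier n} →
      (∀ i → Lim D s (λ r → f r i) (l i)) → Lim D s (λ r → sum (f r)) (sum l)
    lim-sum {zero}  lims = lim-const 0#
    lim-sum {suc n} lims = lim-+ (lims zero) (lim-sum (λ i → lims (suc i)))

    -- Functions on the setoid of reals are not assumed to respect `_≈_`. At a point of continuity
    -- they do: equal arguments are δ-close for every δ, so the values are ε-close for every ε.
    cont-≈ : ∀ {f s′} → Cont D s f → D s′ → s′ ≈ s → f s′ ≈ f s
    cont-≈ {f} {s′} cont Ds′ s′≈s = trans (sym (solve 2 (λ x y → (x :- y) :+ y := x) refl (f s′) (f s)))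
      (trans (+-congʳ (≤±-all⇒≈0 λ 0<ε → let (δ , 0<δ , near) = cont 0<ε in
        near Ds′ (≈0⇒≤± (trans (+-congʳ s′≈s) (-‿inverseʳ s)) (proj₁ 0<δ)))) (+-identityˡ _))

  difference-inverse : ∀ {s s′} → ¬ (s′ ≈ s) → (s′ - s) * (s′ - s) ⁻¹ ≈ 1#
  difference-inverse {s} {s′} s′≉s = ⁻¹-inverseʳ (s′ - s) λ s′-s≈0 → s′≉s
    (trans (solve 2 (λ s s′ → s′ := (s′ :- s) :+ s) refl s s′) (trans (+-congʳ s′-s≈0) (+-identityˡ s)))

  quotient-* : ∀ {s s′} → ¬ (s′ ≈ s) → ∀ a → a * (s′ - s) ⁻¹ * (s′ - s) ≈ a
  quotient-* {s} {s′} s′≉s a =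
    trans (solve 3 (λ a d i → a :* i :* d := a :* (d :* i)) refl a (s′ - s) ((s′ - s) ⁻¹))
    (trans (*-congˡ (difference-inverse s′≉s)) (*-identityʳ a))

  module _ {D : Pred Carrier 0ℓ} {s : Carrier} where

    diff-resp : ∀ {f g f′ g′} → (∀ {r} → D r → f r ≈ g r) → f s ≈ g s → f′ ≈ g′ →
      Diff D s f f′ → Diff D s g g′
    diff-resp f≈g fs≈gs = lim-resp (λ (Dr , _) → *-congʳ (+-cong (f≈g Dr) (-‿cong fs≈gs)))

    diff-mono : ∀ {E : Pred Carrier 0ℓ} {f f′} → (∀ {r} → E r → D r) → Diff D s f f′ → Diff E s f f′
    diff-mono E⊆D = lim-mono (λ (Er , r≉s) → E⊆D Er , r≉s)

    diff-const : ∀ c → Diff D s (const c) 0#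
    diff-const c = lim-resp (λ _ → sym (trans (*-congʳ (-‿inverseʳ c)) (zeroˡ _))) refl (lim-const 0#)

    diff-id : Diff D s id 1#
    diff-id = lim-resp (λ (_ , r≉s) → sym (difference-inverse r≉s)) refl (lim-const 1#)

    diff-+ : ∀ {f g f′ g′} → Diff D s f f′ → Diff D s g g′ → Diff D s (λ r → f r + g r) (f′ + g′)
    diff-+ {f} {g} df dg = lim-resp (λ {r} _ →
      solve 5 (λ f f₀ g g₀ i → (f :- f₀) :* i :+ (g :- g₀) :* i := ((f :+ g) :- (f₀ :+ g₀)) :* i)
        refl (f r) (f s) (g r) (g s) ((r - s) ⁻¹)) refl (lim-+ df dg)

    diff-neg : ∀ {f f′} → Diff D s f f′ → Diff D s (λ r → - f r) (- f′)
    diff-neg {f} df = lim-resp (λ {r} _ →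
      solve 3 (λ f f₀ i → :- ((f :- f₀) :* i) := ((:- f) :- (:- f₀)) :* i) refl (f r) (f s) ((r - s) ⁻¹)) refl (lim-neg df)

    -- Continuity of `f` enters because the increment is split as (f - f₀)g₀ + f(g - g₀), with `f`
    -- left at the moving point.
    diff-* : ∀ {f g f′ g′} → Cont D s f → Diff D s f f′ → Diff D s g g′ →
      Diff D s (λ r → f r * g r) (f′ * g s + f s * g′)
    diff-* {f} {g} cf df dg = lim-resp (λ {r} _ →
      solve 5 (λ f f₀ g g₀ i → (f :- f₀) :* i :* g₀ :+ f :* ((g :- g₀) :* i) := (f :* g :- f₀ :* g₀) :* i)
        refl (f r) (f s) (g r) (g s) ((r - s) ⁻¹)) refl
      (lim-+ (lim-* df (lim-const (g s))) (lim-* (lim-mono proj₁ cf) dg))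

    diff-sum : ∀ {n} {f : Carrier → Vector Carrier n} {f′ : Vector Carrier n} →
      (∀ i → Diff D s (λ r → f r i) (f′ i)) → Diff D s (λ r → sum (f r)) (sum f′)
    diff-sum {zero}  dfs = diff-const 0#
    diff-sum {suc n} dfs = diff-+ (dfs zero) (diff-sum (λ i → dfs (suc i)))

    diff-scale : ∀ c {f f′} → Diff D s f f′ → Diff D s (λ r → c * f r) (c * f′)
    diff-scale c {f} {f′} df = lim-resp (λ {r} _ →
      solve 4 (λ c f f₀ i → c :* ((f :- f₀) :* i) := (c :* f :- c :* f₀) :* i) refl c (f r) (f s) ((r - s) ⁻¹)) refl
      (lim-* (lim-const c) df)

-- Boundedness and the mean value theorem on an interval

module Calculus (em : ExcludedMiddle 0ℓ) (ℝ : CompleteOrderedField) where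
  open CompleteOrderedField ℝ hiding (zero)
  open OrderedField em ℝ
  open Completeness em ℝ
  open Limits em ℝ

  ⟦_,_⟧ ⟨_,_⟩ : Carrier → Carrier → Pred Carrier 0ℓ
  ⟦ a , b ⟧ s = a ≤ s × s ≤ b
  ⟨ a , b ⟩ s = a < s × s < b

  near⇒≤± : ∀ {s r δ} → s ≤ r + δ → r ≤ s + δ → r - s ≤± δ
  near⇒≤± {s} {r} {δ} p q =
    nonneg⇒≤ (≤⇒nonneg p) (solve 3 (λ s r δ → (r :- s) :- (:- δ) := (r :+ δ) :- s) refl s r δ) ,
    nonneg⇒≤ (≤⇒nonneg q) (solve 3 (λ s r δ → δ :- (r :- s) := (s :+ δ) :- r) refl s r δ)

  ≤±⇒≤+ : ∀ {x y δ} → x - y ≤± δ → x ≤ y + δ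
  ≤±⇒≤+ {x} {y} {δ} (_ , p) = nonneg⇒≤ (≤⇒nonneg p) (solve 3 (λ x y δ → y :+ δ :- x := δ :- (x :- y)) refl x y δ)

  ≤±⇒-≤ : ∀ {x y δ} → x - y ≤± δ → y ≤ x + δ
  ≤±⇒-≤ {x} {y} {δ} (p , _) = nonneg⇒≤ (≤⇒nonneg p) (solve 3 (λ x y δ → x :+ δ :- y := (x :- y) :- (:- δ)) refl x y δ)

  between : ∀ {c d s r δ} → c ≤ s → s ≤ d → s ≤ c + δ → d ≤ s + δ → ⟦ c , d ⟧ r → r - s ≤± δ
  between c≤s s≤d s≤c+δ d≤s+δ (c≤r , r≤d) = near⇒≤±
    (≤-trans s≤c+δ (+-mono-≤ c≤r ≤-refl)) (≤-trans r≤d d≤s+δ)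

  -- Interval induction: f s + 1 is a bound near `s`, and adjacent intervals are merged by taking
  -- the larger of their bounds.
  continuous⇒bounded : ∀ {a b f} → a ≤ b → (∀ {s} → ⟦ a , b ⟧ s → Cont ⟦ a , b ⟧ s f) →
    ∃ λ B → ∀ {s} → ⟦ a , b ⟧ s → f s ≤ B
  continuous⇒bounded {a} {b} {f} a≤b cont =
    interval-induction (λ c d → ∃ λ B → ∀ {s} → ⟦ c , d ⟧ s → f s ≤ B) a≤b
      (λ s a≤s s≤b → let (δ , 0<δ , near) = cont (a≤s , s≤b) 0<1 in
        δ , 0<δ , λ a≤c c≤s s≤d d≤b s≤c+δ d≤s+δ → f s + 1# , λ (c≤r , r≤d) →
          ≤±⇒≤+ (near (≤-trans a≤c c≤r , ≤-trans r≤d d≤b) (between c≤s s≤d s≤c+δ d≤s+δ (c≤r , r≤d))))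
      λ {c} {d} _ _ (B , f≤B) (C , f≤C) → glue (total B C) (λ {r} → total r d) f≤B f≤C
    where
    glue : ∀ {c d e B C} → B ≤ C ⊎ C ≤ B → (∀ {r} → r ≤ d ⊎ d ≤ r) →
      (∀ {s} → ⟦ c , d ⟧ s → f s ≤ B) → (∀ {s} → ⟦ d , e ⟧ s → f s ≤ C) →
      ∃ λ B → ∀ {s} → ⟦ c , e ⟧ s → f s ≤ B
    glue {c} {d} {e} {B} {C} B-or-C side f≤B f≤C = pick B-or-C
      where
      bound : ∀ {s M} → B ≤ M → C ≤ M → s ≤ d ⊎ d ≤ s → ⟦ c , e ⟧ s → f s ≤ M
      bound B≤M _   (inj₁ s≤d) (c≤s , _) = ≤-trans (f≤B (c≤s , s≤d)) B≤M
      bound _   C≤M (inj₂ d≤s) (_ , s≤e) = ≤-trans (f≤C (d≤s , s≤e)) C≤M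
      pick : B ≤ C ⊎ C ≤ B → ∃ λ B → ∀ {s} → ⟦ c , e ⟧ s → f s ≤ B
      pick (inj₁ B≤C) = C , bound B≤C ≤-refl side
      pick (inj₂ C≤B) = B , bound ≤-refl C≤B side

  module _ {D : Pred Carrier 0ℓ} {s : Carrier} {f : Carrier → Carrier} {f′ : Carrier} where

    -- With tolerance -f′/2 the difference quotient stays at most f′/2.
    decreasing-near : Diff D s f f′ → f′ < 0# → ∃ λ δ → 0# < δ ×
      (∀ {r} → D r → s < r → r - s ≤± δ → f r < f s) ×
      (∀ {r} → D r → r < s → r - s ≤± δ → f s < f r)
    decreasing-near diff f′<0 = let (δ , 0<δ , near) = diff (half-pos 0<-f′) in δ , 0<δ ,
      (λ {r} Dr s<r close → right r s<r (near (Dr , λ r≈s → proj₂ s<r (sym r≈s)) close)) ,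
      (λ {r} Dr r<s close → left r r<s (near (Dr , proj₂ r<s) close))
      where
      0<-f′ : 0# < - f′
      0<-f′ = pos⇒< (<⇒pos f′<0) (solve 1 (λ x → (:- x) :- con (+ 0) := con (+ 0) :- x) refl f′)

      drop : ∀ {q h} → q - f′ ≤± half (- f′) → 0# < h → 0# < - (q * h)
      drop {q} {h} (_ , p) 0<h = pos⇒< (*-pos (<-≤-trans (half-pos 0<-f′) slope) 0<h)
        (solve 2 (λ q h → :- (q :* h) :- con (+ 0) := (:- q) :* h) refl q h)
        where
        slope : half (- f′) ≤ - q
        slope = nonneg⇒≤ (≤⇒nonneg p) (trans
          (solve 2 (λ q k → (:- q) :- k := (k :- (q :+ (k :+ k)))) refl q (half (- f′)))
          (+-congˡ (-‿cong (+-congˡ (half+half (- f′))))))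

      right : ∀ r → s < r → (f r - f s) * (r - s) ⁻¹ - f′ ≤± half (- f′) → f r < f s
      right r s<r p = pos⇒< (drop p (<⇒pos s<r))
        (trans (solve 2 (λ x y → y :- x := :- (x :- y)) refl (f r) (f s))
          (-‿cong (sym (quotient-* (λ r≈s → proj₂ s<r (sym r≈s)) (f r - f s)))))

      left : ∀ r → r < s → (f r - f s) * (r - s) ⁻¹ - f′ ≤± half (- f′) → f s < f r
      left r r<s p = pos⇒< (drop p (<⇒pos r<s))
        (trans (sym (quotient-* (proj₂ r<s) (f r - f s)))
          (solve 3 (λ q r s → q :* (r :- s) := :- (q :* (s :- r))) refl ((f r - f s) * (r - s) ⁻¹) r s))

  ≤⇒≈⊎< : ∀ {a b} → a ≤ b → b ≈ a ⊎ a < b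
  ≤⇒≈⊎< {a} {b} a≤b = case em
    where
    case : Dec (b ≈ a) → b ≈ a ⊎ a < b
    case (yes p) = inj₁ p
    case (no ¬p) = inj₂ (a≤b , λ a≈b → ¬p (sym a≈b))

  midpoint< : ∀ {x y} → x < y → x + half (y - x) < y
  midpoint< {x} {y} x<y = pos⇒< (<⇒pos (half< (<⇒pos x<y)))
    (solve 3 (λ x y h → y :- (x :+ h) := (y :- x) :- h) refl x y (half (y - x)))

  +-close : ∀ {x η δ} → 0# ≤ η → η ≤ δ → x + η - x ≤± δ
  +-close {x} {η} 0≤η η≤δ = ≤±-resp (solve 2 (λ x η → η := x :+ η :- x) refl x η) refl (nonneg⇒≤± 0≤η η≤δ)

  -‿close : ∀ {x η δ} → 0# ≤ η → η ≤ δ → x - η - x ≤± δ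
  -‿close {x} {η} 0≤η η≤δ = ≤±-resp (solve 2 (λ x η → :- η := x :- η :- x) refl x η) refl (≤±-neg (nonneg⇒≤± 0≤η η≤δ))

  -- An inequality is enough for the estimates, and it avoids locating an extremum. If f′ were
  -- negative at all interior points, the local decrease would spread by interval induction over
  -- every compact subinterval and by continuity to the end points, giving f b < f a.
  mean-value : ∀ {a b} (f f′ : Carrier → Carrier) → a < b →
    (∀ {s} → ⟦ a , b ⟧ s → Cont ⟦ a , b ⟧ s f) →
    (∀ {s} → ⟨ a , b ⟩ s → Diff ⟨ a , b ⟩ s f (f′ s)) →
    f a ≤ f b → ∃ λ ξ → ⟨ a , b ⟩ ξ × 0# ≤ f′ ξ
  mean-value {a} {b} f f′ a<b cont diff fa≤fb = by-cases em
    where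
    by-cases : Dec (∃ λ ξ → ⟨ a , b ⟩ ξ × 0# ≤ f′ ξ) → ∃ λ ξ → ⟨ a , b ⟩ ξ × 0# ≤ f′ ξ
    by-cases (yes found) = found
    by-cases (no ¬found) = contradiction fa≤fb (<⇒≱ fb<fa)
      where
      f′<0 : ∀ {s} → ⟨ a , b ⟩ s → f′ s < 0#
      f′<0 s∈ = ≰⇒> λ 0≤f′s → ¬found (_ , s∈ , 0≤f′s)

      closed : ∀ {s} → ⟨ a , b ⟩ s → ⟦ a , b ⟧ s
      closed (a<s , s<b) = proj₁ a<s , proj₁ s<b

      decreasing : ∀ {c d} → a < c → c ≤ d → d < b → f d ≤ f c
      decreasing {c} {d} a<c c≤d d<b = interval-induction (λ c d → f d ≤ f c) c≤d
        (λ s c≤s s≤d →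
          let s∈ = <-≤-trans a<c c≤s , ≤-<-trans s≤d d<b
              (δ , 0<δ , right , left) = decreasing-near (diff s∈) (f′<0 s∈)
          in δ , 0<δ , λ {c′} {d′} c≤c′ c′≤s s≤d′ d′≤d s≤c′+δ d′≤s+δ →
            let c′∈ = <-≤-trans a<c c≤c′ , ≤-<-trans (≤-trans c′≤s s≤d) d<b
                d′∈ = <-≤-trans a<c (≤-trans c≤s s≤d′) , ≤-<-trans d′≤d d<b
            in ≤-trans
              (step-right s∈ d′∈ (≤⇒≈⊎< s≤d′) λ s<d′ → right d′∈ s<d′ (between c′≤s s≤d′ s≤c′+δ d′≤s+δ (≤-trans c′≤s s≤d′ , ≤-refl)))
              (step-left s∈ c′∈ (≤⇒≈⊎< c′≤s) λ c′<s → left c′∈ c′<s (between c′≤s s≤d′ s≤c′+δ d′≤s+δ (≤-refl , ≤-trans c′≤s s≤d′))))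
        λ _ _ fd≤fc fe≤fd → ≤-trans fe≤fd fd≤fc
        where
        step-right : ∀ {s r} → ⟨ a , b ⟩ s → ⟨ a , b ⟩ r → r ≈ s ⊎ s < r → (s < r → f r < f s) → f r ≤ f s
        step-right s∈ r∈ (inj₁ r≈s) _ = ≤-reflexive (cont-≈ {f = f} (cont (closed s∈)) (closed r∈) r≈s)
        step-right s∈ r∈ (inj₂ s<r) p = proj₁ (p s<r)
        step-left : ∀ {s r} → ⟨ a , b ⟩ s → ⟨ a , b ⟩ r → s ≈ r ⊎ r < s → (r < s → f s < f r) → f s ≤ f r
        step-left s∈ r∈ (inj₁ s≈r) _ = ≤-reflexive (cont-≈ {f = f} (cont (closed r∈)) (closed s∈) s≈r)
        step-left s∈ r∈ (inj₂ r<s) p = proj₁ (p r<s)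

      -- Continuity carries the monotonicity to the end points.
      below-left : ∀ {s} → ⟨ a , b ⟩ s → f s ≤ f a
      below-left {s} (a<s , s<b) = [ id , (λ fa<fs →
        let (δ , 0<δ , near) = cont (≤-refl , proj₁ a<b) (half-pos (<⇒pos fa<fs))
            (η , 0<η , η≤δ , η≤s-a) = common-lower 0<δ (<⇒pos a<s)
            a+η≤s = ≤-resp refl (solve 2 (λ a s → a :+ (s :- a) := s) refl a s) (+-mono-≤ (≤-refl {a}) η≤s-a)
            close = near (≤-+ (proj₁ 0<η) , ≤-trans a+η≤s (proj₁ s<b))
              (+-close (proj₁ 0<η) η≤δ)
            fs≤ = ≤-trans (decreasing (<-+ 0<η) a+η≤s s<b) (≤±⇒≤+ close)
        in contradiction fs≤ (<⇒≱ (midpoint< fa<fs))) ]′ (≤-or-> (f s) (f a))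

      above-right : ∀ {s} → ⟨ a , b ⟩ s → f b ≤ f s
      above-right {s} (a<s , s<b) = [ id , (λ fs<fb →
        let (δ , 0<δ , near) = cont (proj₁ a<b , ≤-refl) (half-pos (<⇒pos fs<fb))
            (η , 0<η , η≤δ , η≤b-s) = common-lower 0<δ (<⇒pos s<b)
            s≤b-η = nonneg⇒≤ (≤⇒nonneg η≤b-s) (solve 3 (λ b s η → b :- η :- s := b :- s :- η) refl b s η)
            close = near (≤-trans (proj₁ a<s) s≤b-η , proj₁ (-‿< 0<η))
              (-‿close (proj₁ 0<η) η≤δ)
            fb≤ = ≤-trans (≤±⇒-≤ close) (+-mono-≤ (decreasing a<s s≤b-η (-‿< 0<η)) ≤-refl)
        in contradiction fb≤ (<⇒≱ (midpoint< fs<fb))) ]′ (≤-or-> (f b) (f s))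

      -- Monotonicity alone gives f b ≤ f a. Strictness is gained at an interior point `m`: just to
      -- its right the values are strictly smaller than f m.
      drop-after : ∀ {m δ η} → ⟨ a , b ⟩ m →
        (∀ {r} → ⟨ a , b ⟩ r → m < r → r - m ≤± δ → f r < f m) →
        0# < η → η ≤ δ → η ≤ half (b - m) → f b < f a
      drop-after {m} {δ} {η} (a<m , m<b) right 0<η η≤δ η≤ =
        <-≤-trans (≤-<-trans (above-right m+η∈) (right m+η∈ (<-+ 0<η) (+-close (proj₁ 0<η) η≤δ)))
          (below-left (a<m , m<b))
        where
        m+η∈ : ⟨ a , b ⟩ (m + η)
        m+η∈ = ≤-<-trans (proj₁ a<m) (<-+ 0<η) , ≤-<-trans (+-mono-≤ ≤-refl η≤) (midpoint< m<b)

      drop-from : ∀ {m} → ⟨ a , b ⟩ m → f b < f a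
      drop-from m∈ =
        let (δ , 0<δ , right , _) = decreasing-near (diff m∈) (f′<0 m∈)
            (η , 0<η , η≤δ , η≤)  = common-lower 0<δ (half-pos (<⇒pos (proj₂ m∈)))
        in drop-after m∈ right 0<η η≤δ η≤

      fb<fa : f b < f a
      fb<fa = drop-from (<-+ (half-pos (<⇒pos a<b)) , midpoint< a<b)

-- Composition, reversal and limits of tangent estimates

module TangentEstimates (em : ExcludedMiddle 0ℓ) (ℝ : CompleteOrderedField) where
  open CompleteOrderedField ℝ hiding (zero)
  open OrderedField em ℝ

  increment-trans : ∀ {q₀ q₁ q₂ s₀ s₁ s₂ L} →
    q₁ - q₀ ≤± L * (s₁ - s₀) → q₂ - q₁ ≤± L * (s₂ - s₁) → q₂ - q₀ ≤± L * (s₂ - s₀)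
  increment-trans {q₀} {q₁} {q₂} {s₀} {s₁} {s₂} {L} d₁ d₂ = ≤±-resp
    (solve 3 (λ x y z → (y :- x) :+ (z :- y) := z :- x) refl q₀ q₁ q₂)
    (solve 4 (λ L x y z → L :* (y :- x) :+ L :* (z :- y) := L :* (z :- x)) refl L s₀ s₁ s₂)
    (d₁ +± d₂)

  -- With h and k the two time steps, moving the second tangent to the first base point costs K L h
  -- k. Passing from (C + K L)(h² + k²) to (C + K L)(h + k)² provides 2(C + K L)hk, and (2C + K L)hk
  -- is left over.
  tangent-trans : ∀ {q₀ q₁ q₂ s₀ s₁ s₂ f₀ f₁ C L K} → s₀ ≤ s₁ → s₁ ≤ s₂ → 0# ≤ C → 0# ≤ K * L →
    q₁ - q₀ - (s₁ - s₀) * f₀ ≤± (C + K * L) * ((s₁ - s₀) * (s₁ - s₀)) →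
    q₂ - q₁ - (s₂ - s₁) * f₁ ≤± (C + K * L) * ((s₂ - s₁) * (s₂ - s₁)) →
    f₁ - f₀ ≤± K * (L * (s₁ - s₀)) →
    q₂ - q₀ - (s₂ - s₀) * f₀ ≤± (C + K * L) * ((s₂ - s₀) * (s₂ - s₀))
  tangent-trans {q₀} {q₁} {q₂} {s₀} {s₁} {s₂} {f₀} {f₁} {C} {L} {K} s₀≤s₁ s₁≤s₂ 0≤C 0≤KL t₁ t₂ df =
    ≤±-weaken (nonneg⇒≤ nonneg bound) (≤±-resp
      (trans (solve 7 (λ x y z h k f g → (y :- x :- h :* f) :+ (z :- y :- k :* g) :+ k :* (g :- f)
                := z :- x :- (h :+ k) :* f) refl q₀ q₁ q₂ (s₁ - s₀) (s₂ - s₁) f₀ f₁)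
             (+-congˡ (-‿cong (*-congʳ sum-of-steps))))
      refl (t₁ +± t₂ +± ≤±-refl (≤⇒nonneg s₁≤s₂) *± df))
    where
    sum-of-steps : (s₁ - s₀) + (s₂ - s₁) ≈ s₂ - s₀
    sum-of-steps = solve 3 (λ x y z → (y :- x) :+ (z :- y) := z :- x) refl s₀ s₁ s₂
    nonneg : 0# ≤ (C + C + K * L) * ((s₁ - s₀) * (s₂ - s₁))
    nonneg = (0≤C +≥0 0≤C +≥0 0≤KL) *≥0 (≤⇒nonneg s₀≤s₁ *≥0 ≤⇒nonneg s₁≤s₂)
    bound : (C + K * L) * ((s₂ - s₀) * (s₂ - s₀)) -
              ((C + K * L) * ((s₁ - s₀) * (s₁ - s₀)) + (C + K * L) * ((s₂ - s₁) * (s₂ - s₁)) + (s₂ - s₁) * (K * (L * (s₁ - s₀))))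
            ≈ (C + C + K * L) * ((s₁ - s₀) * (s₂ - s₁))
    bound = trans (+-congʳ (*-congˡ (*-cong (sym sum-of-steps) (sym sum-of-steps))))
      (solve 5 (λ C L K h k →
          (C :+ K :* L) :* ((h :+ k) :* (h :+ k)) :-
            ((C :+ K :* L) :* (h :* h) :+ (C :+ K :* L) :* (k :* k) :+ k :* (K :* (L :* h)))
          := (C :+ C :+ K :* L) :* (h :* k)) refl C L K (s₁ - s₀) (s₂ - s₁))

  -- Basing the tangent at the later end exchanges f for g over the whole step h, which adds K L h²
  -- to the error.
  tangent-reverse : ∀ {p q s r f g C L K} → s ≤ r →
    q - p - (r - s) * f ≤± C * ((r - s) * (r - s)) → g - f ≤± K * (L * (r - s)) →
    p - q - (s - r) * g ≤± (C + K * L) * ((r - s) * (r - s))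
  tangent-reverse {p} {q} {s} {r} {f} {g} {C} {L} {K} s≤r t df = ≤±-resp
    (solve 6 (λ p q s r f g → :- (q :- p :- (r :- s) :* f) :+ (r :- s) :* (g :- f) := p :- q :- (s :- r) :* g)
      refl p q s r f g)
    (solve 4 (λ C L K h → C :* (h :* h) :+ h :* (K :* (L :* h)) := (C :+ K :* L) :* (h :* h)) refl C L K (r - s))
    (≤±-neg t +± ≤±-refl (≤⇒nonneg s≤r) *± df)

  -- The nodes (a , p) and (a′ , p′) approximate (s , g) and (s′ , g′) to within η ≤ h².
  tangent-limit : ∀ {g g′ p p′ a a′ s s′ fp fg L K E h η} →
    0# ≤ L → 0# ≤ K → 0# ≤ E → 0# ≤ h → 0# ≤ η → η ≤ h → η ≤ h * h → s′ - s ≤± h → s - a ≤± η → s′ - a′ ≤± η →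
    g - p ≤± L * η → g′ - p′ ≤± L * η → fp ≤± L → fg - fp ≤± K * (L * η) →
    (∀ {d} → a′ - a ≤± d → p′ - p - (a′ - a) * fp ≤± E * (d * d)) →
    g′ - g - (s′ - s) * fg ≤± (L + L + E * ((1# + 1# + 1#) * (1# + 1# + 1#)) + (L + L) + K * L) * (h * h)
  tangent-limit {g} {g′} {p} {p′} {a} {a′} {s} {s′} {fp} {fg} {L} {K} {E} {h} {η}
                0≤L 0≤K 0≤E 0≤h 0≤η η≤h η≤hh ds da da′ dg dg′ bfp df tan =
    -- The error is split into the displacements of the two end points, the tangent error between
    -- the nodes, the change of the time step and the change of the slope. The displacements and the
    -- time step are absorbed by η ≤ h². In the other two terms η ≤ h suffices: the node distance is
    -- at most 3h, and the slope term already carries a factor h.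
    ≤±-weaken bound (≤±-resp
      (trans (+-congʳ (+-congˡ (*-congʳ times)))
        (solve 8 (λ g g′ p p′ α σ fp fg →
          (g′ :- p′) :+ (:- (g :- p)) :+ (p′ :- p :- α :* fp) :+ (α :- σ) :* fp :+ (:- (σ :* (fg :- fp)))
          := g′ :- g :- σ :* fg) refl g g′ p p′ (a′ - a) (s′ - s) fp fg))
      refl (dg′ +± ≤±-neg dg +± tan a-step +± (≤±-neg da′ +± da) *± bfp +± ≤±-neg (ds *± df)))
    where
    times : - (s′ - a′) + (s - a) ≈ (a′ - a) - (s′ - s)
    times = solve 4 (λ s s′ a a′ → (:- (s′ :- a′)) :+ (s :- a) := (a′ :- a) :- (s′ :- s)) refl s s′ a a′
    a-step : a′ - a ≤± h + η + η
    a-step = ≤±-resp (solve 4 (λ s s′ a a′ → (s′ :- s) :+ (:- (s′ :- a′)) :+ (s :- a) := a′ :- a) refl s s′ a a′)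
      refl (ds +± ≤±-neg da′ +± da)
    3h : h + η + η ≤ (1# + 1# + 1#) * h
    3h = ≤-resp refl (solve 1 (λ h → h :+ h :+ h := (con (+ 1) :+ con (+ 1) :+ con (+ 1)) :* h) refl h)
      (+-mono-≤ (+-mono-≤ ≤-refl η≤h) η≤h)
    bound : L * η + L * η + E * ((h + η + η) * (h + η + η)) + (η + η) * L + h * (K * (L * η)) ≤
      (L + L + E * ((1# + 1# + 1#) * (1# + 1# + 1#)) + (L + L) + K * L) * (h * h)
    bound = ≤-resp refl
      (solve 5 (λ L K E h t →
        L :* (h :* h) :+ L :* (h :* h) :+ E :* ((t :* h) :* (t :* h)) :+ ((h :* h) :+ (h :* h)) :* L :+ h :* (K :* (L :* h))
        := (L :+ L :+ E :* (t :* t) :+ (L :+ L) :+ K :* L) :* (h :* h)) refl L K E h (1# + 1# + 1#))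
      (+-mono-≤ (+-mono-≤ (+-mono-≤ (+-mono-≤ (*-monoˡ-≤ 0≤L η≤hh) (*-monoˡ-≤ 0≤L η≤hh))
        (*-monoˡ-≤ 0≤E (*-mono-≤ 0≤h+2η (≤-trans 0≤h+2η 3h) 3h 3h)))
        (*-mono-≤ (0≤η +≥0 0≤η) 0≤L (+-mono-≤ η≤hh η≤hh) ≤-refl))
        (*-monoˡ-≤ 0≤h (*-monoˡ-≤ 0≤K (*-monoˡ-≤ 0≤L η≤h))))
      where
      0≤h+2η : 0# ≤ h + η + η
      0≤h+2η = 0≤h +≥0 0≤η +≥0 0≤η

-- From an infinite bisection to a solution

module Bisection (em : ExcludedMiddle 0ℓ) (ℝ : CompleteOrderedField) where
  open CompleteOrderedField ℝ hiding (zero)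
  open OrderedField em ℝ
  open Completeness em ℝ
  open Limits em ℝ
  open Calculus em ℝ
  open TangentEstimates em ℝ

  Box : ∀ {N} → Carrier → Vector Carrier N → Set
  Box m r = ∀ i → r i ≤± m

  -- Polynomials are bounded and Lipschitz only on bounded sets, so both constants depend on the
  -- radius of the box. Boxes, that is the maximum norm, allow all later estimates to be made
  -- componentwise.
  record LocallyLipschitz {N} (F : Vector Carrier N → Vector Carrier N) : Set where
    field
      bound     : ∀ m → ∃ λ L → 0# ≤ L × (∀ {r} → Box m r → Box L (F r))
      lipschitz : ∀ m → ∃ λ K → 0# ≤ K ×
        (∀ {r r′ δ} → Box m r → Box m r′ → (∀ i → r i - r′ i ≤± δ) → ∀ i → F r i - F r′ i ≤± K * δ)

  -- Coalgebraic: nothing bounds the depth of the refinement, and time is only relative to a piece.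
  record BisectionSystem {N} (F : Vector Carrier N → Vector Carrier N) (m L C : Carrier) : Set₁ where
    field
      Piece      : Set
      len        : Piece → Carrier
      src tgt    : Piece → Vector Carrier N
      left right : Piece → Piece
      len-nonneg : ∀ p → 0# ≤ len p
      len-left   : ∀ p → len (left p) ≈ half (len p)
      len-right  : ∀ p → len (right p) ≈ half (len p)
      src-left   : ∀ p i → src (left p) i ≈ src p i
      src-right  : ∀ p i → src (right p) i ≈ tgt (left p) i
      tgt-right  : ∀ p i → tgt (right p) i ≈ tgt p i
      src-box    : ∀ p → Box m (src p)
      tgt-box    : ∀ p → Box m (tgt p)
      increment  : ∀ p i → tgt p i - src p i ≤± L * len p
      tangent    : ∀ p i → tgt p i - src p i - len p * F (src p) i ≤± C * (len p * len p)

  module Trajectory {N} {F : Vector Carrier N → Vector Carrier N} {m L C : Carrier}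
    (0≤L : 0# ≤ L) (0≤C : 0# ≤ C) (F-bound : ∀ {r} → Box m r → Box L (F r))
    (F-lipschitz : LocallyLipschitz F)
    (system : BisectionSystem F m L C) (root : BisectionSystem.Piece system) where
    open BisectionSystem system

    T : Carrier
    T = len root

    -- The nodes stay in the box of radius m, but their Lipschitz extension need not. Over a time of
    -- at most T it strays at most L T from the source, so the Lipschitz constant of F is taken on
    -- this larger box.
    R : Carrier
    R = m + L * T

    K : Carrier
    K = proj₁ (LocallyLipschitz.lipschitz F-lipschitz R)

    0≤K : 0# ≤ K
    0≤K = proj₁ (proj₂ (LocallyLipschitz.lipschitz F-lipschitz R))

    F-lip : ∀ {r r′ δ} → Box R r → Box R r′ → (∀ i → r i - r′ i ≤± δ) → ∀ i → F r i - F r′ i ≤± K * δ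
    F-lip = proj₂ (proj₂ (LocallyLipschitz.lipschitz F-lipschitz R))

    m≤R : m ≤ R
    m≤R = ≤-+ (0≤L *≥0 len-nonneg root)

    -- F is not assumed to respect pointwise equality; the Lipschitz bound with δ = 0 supplies this.
    F-cong : ∀ {q q′} → Box m q → (∀ i → q i ≈ q′ i) → ∀ i → F q i ≈ F q′ i
    F-cong {q} {q′} q∈ q≈q′ i = trans (solve 2 (λ x y → x := (x :- y) :+ y) refl (F q i) (F q′ i))
      (trans (+-congʳ (≤±0⇒≈0 (≤±-resp refl (zeroʳ K)
        (F-lip (λ i → ≤±-weaken m≤R (q∈ i)) (λ i → ≤±-weaken m≤R (≤±-resp (q≈q′ i) refl (q∈ i)))
          (λ i → ≈0⇒≤± (trans (+-congˡ (-‿cong (sym (q≈q′ i)))) (-‿inverseʳ (q i))) ≤-refl) i))))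
      (+-identityˡ _))

    -- Points reached by finitely many bisections, with absolute times: the index `a` is the time at
    -- which the piece starts. The family is inductive although the system has no bottom, so bounds
    -- can be proved by induction on the depth of a node.
    data Node : Piece → Carrier → Carrier → Vector Carrier N → Set where
      source   : ∀ {p a} → Node p a a (src p)
      target   : ∀ {p a} → Node p a (a + len p) (tgt p)
      in-left  : ∀ {p a s q} → Node (left p) a s q → Node p a s q
      in-right : ∀ {p a s q} → Node (right p) (a + len (left p)) s q → Node p a s q

    -- Collects what is preserved by concatenation. A single piece satisfies the tangent bound with
    -- C; the constant C + K L is the one that `step-trans` can reproduce.
    record Step (s : Carrier) (q : Vector Carrier N) (s′ : Carrier) (q′ : Vector Carrier N) : Set where
      constructor step
      field
        forward : s ≤ s′
        box     : Box m q
        box′    : Box m q′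
        incr    : ∀ i → q′ i - q i ≤± L * (s′ - s)
        tang    : ∀ i → q′ i - q i - (s′ - s) * F q i ≤± (C + K * L) * ((s′ - s) * (s′ - s))

    step-trans : ∀ {s q s′ q′ s″ q″} → Step s q s′ q′ → Step s′ q′ s″ q″ → Step s q s″ q″
    step-trans (step fw b b′ inc tan) (step fw′ _ b″ inc′ tan′) =
      step (≤-trans fw fw′) b b″ (λ i → increment-trans (inc i) (inc′ i))
        (λ i → tangent-trans fw fw′ 0≤C (0≤K *≥0 0≤L) (tan i) (tan′ i)
          (F-lip (λ i → ≤±-weaken m≤R (b′ i)) (λ i → ≤±-weaken m≤R (b i)) inc i))

    step-resp : ∀ {s q s′ q′ r p r′ p′} → s ≈ r → (∀ i → q i ≈ p i) → s′ ≈ r′ → (∀ i → q′ i ≈ p′ i) →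
      Step s q s′ q′ → Step r p r′ p′
    step-resp s≈r q≈p s′≈r′ q′≈p′ (step fw b b′ inc tan) =
      step (≤-resp s≈r s′≈r′ fw) (λ i → ≤±-resp (q≈p i) refl (b i)) (λ i → ≤±-resp (q′≈p′ i) refl (b′ i))
        (λ i → ≤±-resp (+-cong (q′≈p′ i) (-‿cong (q≈p i))) (*-congˡ ds) (inc i))
        (λ i → ≤±-resp (+-cong (+-cong (q′≈p′ i) (-‿cong (q≈p i))) (-‿cong (*-cong ds (F-cong b q≈p i))))
                 (*-congˡ (*-cong ds ds)) (tan i))
      where ds = +-cong s′≈r′ (-‿cong s≈r)

    piece-step : ∀ p a → Step a (src p) (a + len p) (tgt p)
    piece-step p a = step (≤-+ (len-nonneg p)) (src-box p) (tgt-box p)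
      (λ i → ≤±-resp refl (*-congˡ (sym cut)) (increment p i))
      (λ i → ≤±-resp (+-congˡ (-‿cong (*-congʳ (sym cut)))) (*-congˡ (*-cong (sym cut) (sym cut)))
        (≤±-weaken (nonneg⇒≤ (0≤K *≥0 0≤L *≥0 (len-nonneg p *≥0 len-nonneg p))
          (solve 4 (λ C K L h → (C :+ K :* L) :* (h :* h) :- C :* (h :* h) := K :* L :* (h :* h)) refl C K L (len p)))
        (tangent p i)))
      where
      cut : a + len p - a ≈ len p
      cut = solve 2 (λ a h → a :+ h :- a := h) refl a (len p)

    step-refl : ∀ {s q} → Box m q → Step s q s q
    step-refl {s} {q} b = step ≤-refl b b
      (λ i → ≈0⇒≤± (-‿inverseʳ (q i)) (0≤L *≥0 ≤⇒nonneg ≤-refl))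
      (λ i → ≈0⇒≤± (solve 3 (λ x s f → x :- x :- (s :- s) :* f := con (+ 0)) refl (q i) s (F q i))
        ((0≤C +≥0 0≤K *≥0 0≤L) *≥0 (≤⇒nonneg ≤-refl *≥0 ≤⇒nonneg ≤-refl)))

    len-halves : ∀ p → len (left p) + len (right p) ≈ len p
    len-halves p = trans (+-cong (len-left p) (len-right p)) (half+half (len p))

    end-right : ∀ p a → a + len (left p) + len (right p) ≈ a + len p
    end-right p a = trans (+-assoc _ _ _) (+-congˡ (len-halves p))

    step-left : ∀ p a → Step a (src p) (a + len (left p)) (tgt (left p))
    step-left p a = step-resp refl (src-left p) refl (λ _ → refl) (piece-step (left p) a)

    step-right : ∀ p a → Step (a + len (left p)) (tgt (left p)) (a + len p) (tgt p)
    step-right p a = step-resp refl (src-right p) (end-right p a) (tgt-right p) (piece-step (right p) (a + len (left p)))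

    from-source : ∀ {p a s q} → Node p a s q → Step a (src p) s q
    from-source {p}     source       = step-refl (src-box p)
    from-source {p} {a} target       = piece-step p a
    from-source {p}     (in-left n)  = step-resp refl (src-left p) refl (λ _ → refl) (from-source n)
    from-source {p} {a} (in-right n) = step-trans (step-left p a)
      (step-resp refl (src-right p) refl (λ _ → refl) (from-source n))

    to-target : ∀ {p a s q} → Node p a s q → Step s q (a + len p) (tgt p)
    to-target {p} {a} source       = piece-step p a
    to-target {p}     target       = step-refl (tgt-box p)
    to-target {p} {a} (in-left n)  = step-trans (to-target n) (step-right p a)
    to-target {p} {a} (in-right n) = step-resp refl (λ _ → refl) (end-right p a) (tgt-right p) (to-target n)

    -- Nodes in the same half are compared recursively. Nodes in different halves are joined through
    -- the midpoint, the target of the left half and the source of the right one.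
    comparable : ∀ {p a s q s′ q′} → Node p a s q → Node p a s′ q′ → Step s q s′ q′ ⊎ Step s′ q′ s q
    comparable     source       n            = inj₁ (from-source n)
    comparable     target       n            = inj₂ (to-target n)
    comparable     (in-left n)  source       = inj₂ (from-source (in-left n))
    comparable     (in-left n)  target       = inj₁ (to-target (in-left n))
    comparable     (in-left n)  (in-left n′) = comparable n n′
    comparable {p} (in-left n)  (in-right n′) = inj₁ (step-trans (to-target n)
      (step-resp refl (src-right p) refl (λ _ → refl) (from-source n′)))
    comparable     (in-right n) source        = inj₂ (from-source (in-right n))
    comparable     (in-right n) target        = inj₁ (to-target (in-right n))
    comparable {p} (in-right n) (in-left n′)  = inj₂ (step-trans (to-target n′)
      (step-resp refl (src-right p) refl (λ _ → refl) (from-source n)))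
    comparable     (in-right n) (in-right n′) = comparable n n′

    -- The second K L pays for estimates whose base point is the later of the two nodes, by
    -- `tangent-reverse`.
    E : Carrier
    E = C + K * L + K * L

    0≤E : 0# ≤ E
    0≤E = 0≤C +≥0 0≤K *≥0 0≤L +≥0 0≤K *≥0 0≤L

    node-box : ∀ {p a s q} → Node p a s q → Box m q
    node-box n = Step.box′ (from-source n)

    node-increment : ∀ {p a s q s′ q′ d} → Node p a s q → Node p a s′ q′ → s′ - s ≤± d →
      ∀ i → q′ i - q i ≤± L * d
    node-increment {s = s} {q} {s′} {q′} n n′ close i = [ forth , back ]′ (comparable n n′)
      where
      forth : Step s q s′ q′ → q′ i - q i ≤± L * _
      forth st = ≤±-weaken (*-monoˡ-≤ 0≤L (proj₂ close)) (Step.incr st i)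
      back : Step s′ q′ s q → q′ i - q i ≤± L * _
      back st = ≤±-weaken (*-monoˡ-≤ 0≤L (proj₂ (≤±-resp (solve 2 (λ x y → :- (x :- y) := y :- x) refl s′ s) refl (≤±-neg close))))
        (≤±-resp (solve 2 (λ x y → :- (x :- y) := y :- x) refl (q i) (q′ i)) refl (≤±-neg (Step.incr st i)))

    node-tangent : ∀ {p a s q s′ q′ d} → Node p a s q → Node p a s′ q′ → s′ - s ≤± d →
      ∀ i → q′ i - q i - (s′ - s) * F q i ≤± E * (d * d)
    node-tangent {s = s} {q} {s′} {q′} {d} n n′ close i = [ forth , back ]′ (comparable n n′)
      where
      square-≤ : ∀ {h} → 0# ≤ h → h ≤ d → E * (h * h) ≤ E * (d * d)
      square-≤ 0≤h h≤d = *-monoˡ-≤ 0≤E (*-mono-≤ 0≤h (≤-trans 0≤h h≤d) h≤d h≤d)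
      forth : Step s q s′ q′ → q′ i - q i - (s′ - s) * F q i ≤± E * (d * d)
      forth (step fw _ _ _ tan) = ≤±-weaken (≤-trans
        (nonneg⇒≤ (0≤K *≥0 0≤L *≥0 (≤⇒nonneg fw *≥0 ≤⇒nonneg fw))
          (solve 4 (λ C K L h → (C :+ K :* L :+ K :* L) :* (h :* h) :- (C :+ K :* L) :* (h :* h) := K :* L :* (h :* h))
            refl C K L (s′ - s)))
        (square-≤ (≤⇒nonneg fw) (proj₂ close))) (tan i)
      back : Step s′ q′ s q → q′ i - q i - (s′ - s) * F q i ≤± E * (d * d)
      back (step fw b′ b inc tan) = ≤±-weaken
        (square-≤ (≤⇒nonneg fw) (proj₂ (≤±-resp (solve 2 (λ x y → :- (x :- y) := y :- x) refl s′ s) refl (≤±-neg close))))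
        (tangent-reverse fw (tan i) (F-lip (λ i → ≤±-weaken m≤R (b i)) (λ i → ≤±-weaken m≤R (b′ i)) inc i))

    OnTrajectory : Carrier → Vector Carrier N → Set
    OnTrajectory = Node root 0#

    ⟦0,T⟧ : Pred Carrier 0ℓ
    ⟦0,T⟧ = ⟦ 0# , T ⟧

    -- The search descends into the half that contains `s` until the piece is no longer than η; the
    -- source of that piece is the node.
    node-near : ∀ {η} → 0# < η → ∀ {s} → ⟦0,T⟧ s → ∃₂ λ a q → OnTrajectory a q × s - a ≤± η
    node-near {η} 0<η {s} (0≤s , s≤T) = search (halvable 0<η T) root ≤-refl 0≤s
      (≤-resp refl (sym (+-identityˡ T)) s≤T)
      where
      search : ∀ {ℓ} → Halvable η ℓ → ∀ p {a} → len p ≤ ℓ → a ≤ s → s ≤ a + len p →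
        ∃₂ λ b q → Node p a b q × s - b ≤± η
      search (small ℓ≤η) p {a} len≤ a≤s s≤a+len = a , src p , source ,
        nonneg⇒≤± (≤⇒nonneg a≤s) (≤-trans (nonneg⇒≤ (≤⇒nonneg s≤a+len)
          (solve 3 (λ l s a → l :- (s :- a) := a :+ l :- s) refl (len p) s a)) (≤-trans len≤ ℓ≤η))
      search (halve h) p {a} len≤ a≤s s≤a+len = [ go-left , go-right ]′ (total s (a + len (left p)))
        where
        go-left : s ≤ a + len (left p) → ∃₂ λ b q → Node p a b q × s - b ≤± η
        go-left s≤ = let (b , q , n , close) = search h (left p) (≤-trans (≤-reflexive (len-left p)) (half-mono len≤)) a≤s s≤
                     in b , q , in-left n , close
        go-right : a + len (left p) ≤ s → ∃₂ λ b q → Node p a b q × s - b ≤± η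
        go-right ≤s = let (b , q , n , close) = search h (right p) (≤-trans (≤-reflexive (len-right p)) (half-mono len≤)) ≤s
                                                  (≤-trans s≤a+len (≤-reflexive (sym (end-right p a))))
                      in b , q , in-right n , close

    -- McShane's extension of a Lipschitz function is the supremum of these lower bounds.
    LowerBound : Carrier → Fin N → Pred Carrier 0ℓ
    LowerBound s i r = ∃₂ λ a q → OnTrajectory a q × ∃ λ d → s - a ≤± d × r ≈ q i - L * d

    -- If the times of two nodes lie within D and d of `s`, they differ by at most D + d, so the
    -- lower bound from one node stays below the upper bound from the other. Letting d be any bound
    -- of |s - a| in `LowerBound` keeps absolute values out of the supremum.
    lowerBound-≤ : ∀ {s a q D} → OnTrajectory a q → s - a ≤± D → ∀ i → UpperBound (LowerBound s i) (q i + L * D)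
    lowerBound-≤ {s} {a} {q} {D} n close i {r} (b , p , n′ , d , close′ , r≈) =
      ≤-resp (sym r≈) refl (nonneg⇒≤ (≤⇒nonneg (proj₂ (node-increment n n′ b-a i)))
        (solve 5 (λ L D d q p → q :+ L :* D :- (p :- L :* d) := L :* (D :+ d) :- (p :- q)) refl L D d (q i) (p i)))
      where
      b-a : b - a ≤± D + d
      b-a = ≤±-resp (solve 3 (λ s a b → (s :- a) :+ (:- (s :- b)) := b :- a) refl s a b) refl (close +± ≤±-neg close′)

    abstract
      supremum : ∀ s i → ∃ λ g → UpperBound (LowerBound s i) g ×
        (∀ {b} → UpperBound (LowerBound s i) b → g ≤ b)
      supremum s i = let (d , close) = ≤±-bound (s - 0#) in
        complete (LowerBound s i)
          (src root i - L * d , 0# , src root , source , d , close , refl)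
          (src root i + L * d , lowerBound-≤ source close i)

    γ : Carrier → Vector Carrier N
    γ s i = proj₁ (supremum s i)

    -- For d = 0 this says that γ passes through the nodes; for small d it transfers their estimates
    -- to γ.
    γ-node : ∀ {s a q d} → OnTrajectory a q → s - a ≤± d → ∀ i → γ s i - q i ≤± L * d
    γ-node {s} {a} {q} {d} n close i =
      nonneg⇒≤ (≤⇒nonneg (proj₁ (proj₂ (supremum s i)) (a , q , n , d , close , refl)))
        (solve 4 (λ g q L d → g :- q :- (:- (L :* d)) := g :- (q :- L :* d)) refl (γ s i) (q i) L d) ,
      nonneg⇒≤ (≤⇒nonneg (proj₂ (proj₂ (supremum s i)) (lowerBound-≤ n close i)))
        (solve 4 (λ g q L d → L :* d :- (g :- q) := q :+ L :* d :- g) refl (γ s i) (q i) L d)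

    -- A lower bound at `s` becomes one at `s′` when its distance is enlarged by d, at a loss of L
    -- d.
    γ-lipschitz : ∀ {s s′ d} → s′ - s ≤± d → ∀ i → γ s′ i - γ s i ≤± L * d
    γ-lipschitz {s} {s′} {d} close i =
      nonneg⇒≤ (≤⇒nonneg (below close))
        (solve 4 (λ g g′ L d → g′ :- g :- (:- (L :* d)) := g′ :+ L :* d :- g) refl (γ s i) (γ s′ i) L d) ,
      nonneg⇒≤ (≤⇒nonneg (below (≤±-resp (solve 2 (λ x y → :- (x :- y) := y :- x) refl s′ s) refl (≤±-neg close))))
        (solve 4 (λ g g′ L d → L :* d :- (g′ :- g) := g :+ L :* d :- g′) refl (γ s i) (γ s′ i) L d)
      where
      below : ∀ {s s′} → s′ - s ≤± d → γ s i ≤ γ s′ i + L * d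
      below {s} {s′} close = proj₂ (proj₂ (supremum s i)) λ {r} (a , q , n , e , close′ , r≈) →
        ≤-resp (sym r≈) refl (nonneg⇒≤
          (≤⇒nonneg (proj₁ (proj₂ (supremum s′ i)) (a , q , n , d + e ,
            ≤±-resp (solve 3 (λ s s′ a → (s′ :- s) :+ (s :- a) := s′ :- a) refl s s′ a) refl (close +± close′) , refl)))
          (solve 5 (λ g L d e q → g :+ L :* d :- (q :- L :* e) := g :- (q :- L :* (d :+ e))) refl (γ s′ i) L d e (q i)))

    γ-box : ∀ {s} → ⟦0,T⟧ s → Box R (γ s)
    γ-box {s} (0≤s , s≤T) i = ≤±-resp (solve 2 (λ x y → x :+ (y :- x) := y) refl (src root i) (γ s i)) refl
      (src-box root i +± γ-node source (≤±-resp (solve 1 (λ s → s := s :- con (+ 0)) refl s) refl (nonneg⇒≤± 0≤s s≤T)) i)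

    Q : Carrier
    Q = L + L + E * ((1# + 1# + 1#) * (1# + 1# + 1#)) + (L + L) + K * L

    0≤Q : 0# ≤ Q
    0≤Q = 0≤L +≥0 0≤L +≥0 0≤E *≥0 (0≤3 *≥0 0≤3) +≥0 (0≤L +≥0 0≤L) +≥0 0≤K *≥0 0≤L
      where
      0≤3 : 0# ≤ 1# + 1# + 1#
      0≤3 = 0≤1 +≥0 0≤1 +≥0 0≤1

    γ-tangent : ∀ {s s′ h} → ⟦0,T⟧ s → ⟦0,T⟧ s′ → 0# < h → s′ - s ≤± h →
      ∀ i → γ s′ i - γ s i - (s′ - s) * F (γ s) i ≤± Q * (h * h)
    γ-tangent {s} {s′} {h} s∈ s′∈ 0<h close i =
      -- The nodes are chosen within min(h, h²) of the two times, so that replacing γ by them costs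
      -- no more than the quadratic error itself.
      let (η , 0<η , η≤h , η≤hh) = common-lower 0<h (*-pos 0<h 0<h)
          (a , p , n , s-a)       = node-near 0<η s∈
          (a′ , p′ , n′ , s′-a′)  = node-near 0<η s′∈
      in tangent-limit 0≤L 0≤K 0≤E (proj₁ 0<h) (proj₁ 0<η) η≤h η≤hh close s-a s′-a′
           (γ-node n s-a i) (γ-node n′ s′-a′ i) (F-bound (node-box n) i)
           (F-lip (γ-box s∈) (λ j → ≤±-weaken m≤R (node-box n j)) (γ-node n s-a) i)
           (λ a′-a → node-tangent n n′ a′-a i)

    -- Here h is |s′ - s|, given by the properties that the quotient estimate uses. Its minimality
    -- lets the δ of the limit bound it, and the last component gives the sign with which to divide.
    Distance : Carrier → Carrier → Carrier → Set
    Distance s s′ h = 0# < h × s′ - s ≤± h × (∀ {δ} → s′ - s ≤± δ → h ≤ δ) × (s′ - s ≈ h ⊎ s - s′ ≈ h)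

    distance : ∀ {s s′} → ¬ (s′ ≈ s) → ∃ (Distance s s′)
    distance {s} {s′} s′≉s = [ after , before ]′ (total s s′)
      where
      flip : - (s′ - s) ≈ s - s′
      flip = solve 2 (λ x y → :- (x :- y) := y :- x) refl s′ s
      after : s ≤ s′ → ∃ (Distance s s′)
      after s≤s′ = s′ - s , <⇒pos (s≤s′ , λ s≈s′ → s′≉s (sym s≈s′)) , ≤±-refl (≤⇒nonneg s≤s′) , proj₂ , inj₁ refl
      before : s′ ≤ s → ∃ (Distance s s′)
      before s′≤s = s - s′ , <⇒pos (s′≤s , s′≉s) ,
        ≤±-resp (solve 2 (λ x y → :- (x :- y) := y :- x) refl s s′) refl (≤±-neg (≤±-refl (≤⇒nonneg s′≤s))) ,
        (λ close → proj₂ (≤±-resp flip refl (≤±-neg close))) , inj₂ refl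

    quotient-close : ∀ {s s′ h} → ⟦0,T⟧ s → ⟦0,T⟧ s′ → ¬ (s′ ≈ s) → 0# < h → s′ - s ≤± h →
      s′ - s ≈ h ⊎ s - s′ ≈ h → ∀ i → (γ s′ i - γ s i) * (s′ - s) ⁻¹ - F (γ s) i ≤± Q * h
    quotient-close {s} {s′} {h} s∈ s′∈ s′≉s 0<h close side i = [ forth , back ]′ side
      where
      X : Carrier
      X = (γ s′ i - γ s i) * (s′ - s) ⁻¹ - F (γ s) i
      X* : γ s′ i - γ s i - (s′ - s) * F (γ s) i ≈ X * (s′ - s)
      X* = trans (+-congʳ (sym (quotient-* s′≉s (γ s′ i - γ s i))))
        (solve 3 (λ q d f → q :* d :- d :* f := (q :- f) :* d) refl ((γ s′ i - γ s i) * (s′ - s) ⁻¹) (s′ - s) (F (γ s) i))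
      Xd : X * (s′ - s) ≤± Q * h * h
      Xd = ≤±-resp X* (sym (*-assoc Q h h)) (γ-tangent s∈ s′∈ 0<h close i)
      negate : ∀ x → - (x * (s′ - s)) ≈ x * (s - s′)
      negate x = solve 3 (λ x s s′ → :- (x :* (s′ :- s)) := x :* (s :- s′)) refl x s s′
      forth : s′ - s ≈ h → X ≤± Q * h
      forth p = ≤±-cancelʳ 0<h (≤±-resp (*-congˡ p) refl Xd)
      back : s - s′ ≈ h → X ≤± Q * h
      back p = ≤±-cancelʳ 0<h (≤±-resp (trans (negate X) (*-congˡ p)) refl (≤±-neg Xd))

    γ-continuous : ∀ i {s} → ⟦0,T⟧ s → Cont ⟦0,T⟧ s (λ s → γ s i)
    γ-continuous i s∈ 0<ε = let (δ , 0<δ , _ , bound) = scaled-lower 0<ε 0≤L in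
      δ , 0<δ , λ _ close → ≤±-weaken bound (γ-lipschitz close i)

    γ-differentiable : ∀ i {s} → ⟦0,T⟧ s → Diff ⟦0,T⟧ s (λ s → γ s i) (F (γ s) i)
    γ-differentiable i {s} s∈ 0<ε = let (δ , 0<δ , _ , bound) = scaled-lower 0<ε 0≤Q in
      δ , 0<δ , λ {s′} (s′∈ , s′≉s) close →
        let (h , 0<h , close-h , h≤ , side) = distance s′≉s
        in ≤±-weaken (≤-trans (*-monoˡ-≤ 0≤Q (h≤ close)) bound) (quotient-close s∈ s′∈ s′≉s 0<h close-h side i)

-- Mean value and Taylor estimates for curves

module VectorMeanValue (em : ExcludedMiddle 0ℓ) (ℝ : CompleteOrderedField) where
  open CompleteOrderedField ℝ hiding (zero)
  open OrderedField em ℝ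
  open Limits em ℝ
  open Calculus em ℝ
  open SemiringSum semiring using (sum)

  dot : ∀ {N} → Vector Carrier N → Vector Carrier N → Carrier
  dot x y = sum (λ i → x i * y i)

  sum-nonneg : ∀ {N} {x : Vector Carrier N} → (∀ i → 0# ≤ x i) → 0# ≤ sum x
  sum-nonneg {zero}  p = ≤-refl
  sum-nonneg {suc N} p = p zero +≥0 sum-nonneg (λ i → p (suc i))

  dot-nonneg : ∀ {N} (x : Vector Carrier N) → 0# ≤ dot x x
  dot-nonneg x = sum-nonneg (λ i → square-nonneg (x i))

  dot-sub : ∀ {N} (d x y : Vector Carrier N) → dot d (λ i → x i - y i) ≈ dot d x - dot d y
  dot-sub {zero}  d x y = sym (-‿inverseʳ 0#)
  dot-sub {suc N} d x y = trans (+-congˡ (dot-sub (λ i → d (suc i)) (λ i → x (suc i)) (λ i → y (suc i))))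
    (solve 5 (λ d x y p q → d :* (x :- y) :+ (p :- q) := (d :* x :+ p) :- (d :* y :+ q)) refl
      (d zero) (x zero) (y zero) (dot (λ i → d (suc i)) (λ i → x (suc i))) (dot (λ i → d (suc i)) (λ i → y (suc i))))

  dot-scale : ∀ {N} c (d x : Vector Carrier N) → dot d (λ i → c * x i) ≈ c * dot d x
  dot-scale {zero}  c d x = sym (zeroʳ c)
  dot-scale {suc N} c d x = trans (+-congˡ (dot-scale c (λ i → d (suc i)) (λ i → x (suc i))))
    (solve 4 (λ c d x p → d :* (c :* x) :+ c :* p := c :* (d :* x :+ p)) refl
      c (d zero) (x zero) (dot (λ i → d (suc i)) (λ i → x (suc i))))

  normSq-combination : ∀ {N} α β (x y : Vector Carrier N) →
    dot (λ i → α * x i - β * y i) (λ i → α * x i - β * y i) ≈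
    α * α * dot x x - (1# + 1#) * (α * β * dot x y) + β * β * dot y y
  normSq-combination {zero}  α β x y =
    solve 2 (λ α β → con (+ 0) := α :* α :* con (+ 0) :- con (+ 2) :* (α :* β :* con (+ 0)) :+ β :* β :* con (+ 0)) refl α β
  normSq-combination {suc N} α β x y = trans (+-congˡ (normSq-combination α β (λ i → x (suc i)) (λ i → y (suc i))))
    (solve 7 (λ α β x y p q r →
        (α :* x :- β :* y) :* (α :* x :- β :* y) :+ (α :* α :* p :- con (+ 2) :* (α :* β :* q) :+ β :* β :* r)
        := α :* α :* (x :* x :+ p) :- con (+ 2) :* (α :* β :* (x :* y :+ q)) :+ β :* β :* (y :* y :+ r)) refl
      α β (x zero) (y zero) (dot (λ i → x (suc i)) (λ i → x (suc i)))
      (dot (λ i → x (suc i)) (λ i → y (suc i))) (dot (λ i → y (suc i)) (λ i → y (suc i))))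

  -- k|d|² ≤ c⟨d,v⟩ implies k²|d|² ≤ c²|v|²: expand |kd − cv|² ≥ 0, avoiding Cauchy–Schwarz.
  normSq-≤ : ∀ {N} {k c} (d v : Vector Carrier N) → 0# ≤ k → k * dot d d ≤ c * dot d v →
    k * k * dot d d ≤ c * c * dot v v
  normSq-≤ {k = k} {c} d v 0≤k kdd≤cdv = nonneg⇒≤
    (≤-resp refl (normSq-combination k c d v) (dot-nonneg (λ i → k * d i - c * v i)) +≥0 (0≤2 *≥0 (0≤k *≥0 ≤⇒nonneg kdd≤cdv)))
    (solve 5 (λ k c dd dv vv → c :* c :* vv :- k :* k :* dd
      := (k :* k :* dd :- con (+ 2) :* (k :* c :* dv) :+ c :* c :* vv) :+ con (+ 2) :* (k :* (c :* dv :- k :* dd)))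
      refl k c (dot d d) (dot d v) (dot v v))
    where
    0≤2 : 0# ≤ 1# + 1#
    0≤2 = 0≤1 +≥0 0≤1

  module _ {N a b} (a<b : a < b) (u v : Carrier → Vector Carrier N)
    (u-cont : ∀ i {s} → ⟦ a , b ⟧ s → Cont ⟦ a , b ⟧ s (λ s → u s i))
    (u-diff : ∀ i {s} → ⟨ a , b ⟩ s → Diff ⟨ a , b ⟩ s (λ s → u s i) (v s i)) where

    dot-cont : ∀ d {s} → ⟦ a , b ⟧ s → Cont ⟦ a , b ⟧ s (λ s → dot d (u s))
    dot-cont d s∈ = lim-sum (λ i → lim-* (lim-const (d i)) (u-cont i s∈))

    dot-diff : ∀ d {s} → ⟨ a , b ⟩ s → Diff ⟨ a , b ⟩ s (λ s → dot d (u s)) (dot d (v s))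
    dot-diff d s∈ = diff-sum (λ i → diff-scale (d i) (u-diff i s∈))

    chord-mean-value : ∃ λ ξ → ⟨ a , b ⟩ ξ ×
      dot (λ i → u b i - u a i) (λ i → u b i - u a i) ≤ (b - a) * (b - a) * dot (v ξ) (v ξ)
    chord-mean-value =
      let (ξ , ξ∈ , 0≤f′ξ) = mean-value f f′ a<b
            (λ s∈ → lim-+ (lim-* (lim-const T) (dot-cont d s∈)) (lim-* (lim-const (- dot d d)) lim-id))
            (λ s∈ → diff-+ (diff-scale T (dot-diff d s∈)) (diff-scale (- dot d d) diff-id))
            (≤-reflexive fa≈fb)
      in ξ , ξ∈ , finish ξ 0≤f′ξ
      where
      T = b - a
      d : Vector Carrier N
      d i = u b i - u a i
      f f′ : Carrier → Carrier
      -- The linear term is chosen so that the end values agree. Multiplying through by T avoids a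
      -- division, and nonnegativity of `f′` at ξ then reads |d|² ≤ T⟨d , v ξ⟩.
      f  s = T * dot d (u s) + - dot d d * s
      f′ s = T * dot d (v s) + - dot d d * 1#
      fa≈fb : f a ≈ f b
      fa≈fb = end-points (dot-sub d (u b) (u a))
        where
        end-points : ∀ {n p q} → n ≈ q - p → (b - a) * p + - n * a ≈ (b - a) * q + - n * b
        end-points {n} {p} {q} n≈ = trans (+-congˡ (*-congʳ (-‿cong n≈)))
          (trans (solve 4 (λ a b p q → (b :- a) :* p :+ (:- (q :- p)) :* a := (b :- a) :* q :+ (:- (q :- p)) :* b) refl a b p q)
          (+-congˡ (*-congʳ (-‿cong (sym n≈)))))
      finish : ∀ ξ → 0# ≤ f′ ξ → dot d d ≤ T * T * dot (v ξ) (v ξ)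
      finish ξ 0≤f′ξ = ≤-resp (solve 1 (λ x → con (+ 1) :* con (+ 1) :* x := x) refl (dot d d)) refl
        (normSq-≤ d (v ξ) 0≤1 (nonneg⇒≤ 0≤f′ξ
          (solve 3 (λ T p n → T :* p :- con (+ 1) :* n := T :* p :+ (:- n) :* con (+ 1)) refl T (dot d (v ξ)) (dot d d))))

  module _ {N a b} (a<b : a < b) (u v w : Carrier → Vector Carrier N)
    (u-cont : ∀ i {s} → ⟦ a , b ⟧ s → Cont ⟦ a , b ⟧ s (λ s → u s i))
    (u-diff : ∀ i {s} → ⟨ a , b ⟩ s → Diff ⟨ a , b ⟩ s (λ s → u s i) (v s i))
    (v-cont : ∀ i {s} → ⟦ a , b ⟧ s → Cont ⟦ a , b ⟧ s (λ s → v s i))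
    (v-diff : ∀ i {s} → ⟨ a , b ⟩ s → Diff ⟨ a , b ⟩ s (λ s → v s i) (w s i)) where

    taylor-remainder : (let d = λ i → u b i - u a i - (b - a) * v a i) → ∃ λ ξ → ⟨ a , b ⟩ ξ ×
      (1# + 1#) * (1# + 1#) * dot d d ≤ (b - a) * (b - a) * ((b - a) * (b - a)) * dot (w ξ) (w ξ)
    taylor-remainder = first (mean-value f g a<b f-cont f-diff (≤-reflexive fa≈fb))
      where
      T = b - a
      d : Vector Carrier N
      d i = u b i - u a i - (b - a) * v a i
      n = dot d d
      f g h : Carrier → Carrier
      -- The multiple of (s - a)² is chosen so that f a = f b, which works because |d|² = ⟨d , u b -
      -- u a - T v a⟩. The two derivatives of that square produce the factor 2 of conjunct (3).
      f s = T * T * (dot d (u s) + - dot d (v a) * s) + - n * ((s + - a) * (s + - a))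
      g s = T * T * (dot d (v s) + - dot d (v a)) + - n * ((s + - a) + (s + - a))
      h s = T * T * dot d (w s) + - n * (1# + 1#)

      shift-cont : ∀ {D s} → Cont D s (λ s → s + - a)
      shift-cont = lim-+ lim-id (lim-const (- a))
      shift-diff : ∀ {D s} → Diff D s (λ s → s + - a) 1#
      shift-diff = lim-resp (λ _ → refl) (+-identityʳ 1#) (diff-+ diff-id (diff-const (- a)))

      f-cont : ∀ {s} → ⟦ a , b ⟧ s → Cont ⟦ a , b ⟧ s f
      f-cont s∈ = lim-+
        (lim-* (lim-const (T * T)) (lim-+ (dot-cont a<b u v u-cont u-diff d s∈) (lim-* (lim-const (- dot d (v a))) lim-id)))
        (lim-* (lim-const (- n)) (lim-* shift-cont shift-cont))
      f-diff : ∀ {s} → ⟨ a , b ⟩ s → Diff ⟨ a , b ⟩ s f (g s)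
      f-diff {s} s∈ = lim-resp (λ _ → refl)
        (+-cong (*-congˡ (+-congˡ (*-identityʳ _))) (*-congˡ (+-cong (*-identityˡ _) (*-identityʳ _))))
        (diff-+ (diff-scale (T * T) (diff-+ (dot-diff a<b u v u-cont u-diff d s∈) (diff-scale (- dot d (v a)) diff-id)))
          (diff-scale (- n) (diff-* shift-cont shift-diff shift-diff)))

      n≈ : n ≈ dot d (u b) - dot d (u a) - T * dot d (v a)
      n≈ = trans (dot-sub d (λ i → u b i - u a i) (λ i → T * v a i))
        (+-cong (dot-sub d (u b) (u a)) (-‿cong (dot-scale T d (v a))))

      fa≈fb : f a ≈ f b
      fa≈fb = end-points n≈
        where
        end-points : ∀ {n p q r} → n ≈ q - p - (b - a) * r →
          (b - a) * (b - a) * (p + - r * a) + - n * ((a + - a) * (a + - a)) ≈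
          (b - a) * (b - a) * (q + - r * b) + - n * ((b + - a) * (b + - a))
        end-points {n} {p} {q} {r} n≈ = trans
          (solve 5 (λ a b p r n → (b :- a) :* (b :- a) :* (p :+ (:- r) :* a) :+ (:- n) :* ((a :+ :- a) :* (a :+ :- a))
            := (b :- a) :* (b :- a) :* (p :+ (:- r) :* a)) refl a b p r n)
          (trans (solve 5 (λ a b p q r → (b :- a) :* (b :- a) :* (p :+ (:- r) :* a)
            := (b :- a) :* (b :- a) :* (q :+ (:- r) :* b) :+ (:- (q :- p :- (b :- a) :* r)) :* ((b :+ :- a) :* (b :+ :- a)))
              refl a b p q r)
          (+-congˡ (*-congʳ (-‿cong (sym n≈)))))

      second : ∀ {ξ} → ⟨ a , b ⟩ ξ → (∃ λ ζ → ⟨ a , ξ ⟩ ζ × 0# ≤ h ζ) →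
        ∃ λ ζ → ⟨ a , b ⟩ ζ × (1# + 1#) * (1# + 1#) * n ≤ T * T * (T * T) * dot (w ζ) (w ζ)
      second (_ , ξ<b) (ζ , (a<ζ , ζ<ξ) , 0≤hζ) = ζ , (a<ζ , ≤-<-trans (proj₁ ζ<ξ) ξ<b) ,
        normSq-≤ d (w ζ) (0≤1 +≥0 0≤1) (nonneg⇒≤ 0≤hζ
          (solve 3 (λ c p n → c :* p :- con (+ 2) :* n := c :* p :+ (:- n) :* con (+ 2)) refl (T * T) (dot d (w ζ)) n))

      first : (∃ λ ξ → ⟨ a , b ⟩ ξ × 0# ≤ g ξ) →
        ∃ λ ζ → ⟨ a , b ⟩ ζ × (1# + 1#) * (1# + 1#) * n ≤ T * T * (T * T) * dot (w ζ) (w ζ)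
      first (ξ , (a<ξ , ξ<b) , 0≤gξ) = second (a<ξ , ξ<b)
        -- The derivative `g` vanishes at a and is nonnegative at ξ, so the mean value theorem
        -- applies once more on the shorter interval.
        (mean-value g h a<ξ g-cont g-diff (≤-resp (sym ga≈0) refl 0≤gξ))
        where
        closed : ∀ {s} → ⟦ a , ξ ⟧ s → ⟦ a , b ⟧ s
        closed (a≤s , s≤ξ) = a≤s , ≤-trans s≤ξ (proj₁ ξ<b)
        open′ : ∀ {s} → ⟨ a , ξ ⟩ s → ⟨ a , b ⟩ s
        open′ (a<s , s<ξ) = a<s , ≤-<-trans (proj₁ s<ξ) ξ<b
        v-cont′ : ∀ i {s} → ⟦ a , ξ ⟧ s → Cont ⟦ a , ξ ⟧ s (λ s → v s i)
        v-cont′ i s∈ = lim-mono closed (v-cont i (closed s∈))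
        v-diff′ : ∀ i {s} → ⟨ a , ξ ⟩ s → Diff ⟨ a , ξ ⟩ s (λ s → v s i) (w s i)
        v-diff′ i s∈ = diff-mono {f = λ s → v s i} open′ (v-diff i (open′ s∈))
        g-cont : ∀ {s} → ⟦ a , ξ ⟧ s → Cont ⟦ a , ξ ⟧ s g
        g-cont s∈ = lim-+
          (lim-* (lim-const (T * T)) (lim-+ (dot-cont a<ξ v w v-cont′ v-diff′ d s∈) (lim-const (- dot d (v a)))))
          (lim-* (lim-const (- n)) (lim-+ shift-cont shift-cont))
        g-diff : ∀ {s} → ⟨ a , ξ ⟩ s → Diff ⟨ a , ξ ⟩ s g (h s)
        g-diff s∈ = lim-resp (λ _ → refl) (+-congʳ (*-congˡ (+-identityʳ _)))
          (diff-+ (diff-scale (T * T) (diff-+ (dot-diff a<ξ v w v-cont′ v-diff′ d s∈) (diff-const (- dot d (v a)))))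
            (diff-scale (- n) (diff-+ shift-diff shift-diff)))
        ga≈0 : g a ≈ 0#
        ga≈0 = solve 4 (λ c p n a → c :* (p :+ (:- p)) :+ (:- n) :* ((a :+ :- a) :+ (a :+ :- a)) := con (+ 0)) refl (T * T) (dot d (v a)) n a

lower-em : ExcludedMiddle (lsuc 0ℓ) → ExcludedMiddle 0ℓ
lower-em em = map′ lower lift em

-- Fixpoints of monotone operators and their duality

module Fixpoints (em : ExcludedMiddle (lsuc 0ℓ)) (ℝ : CompleteOrderedField) (Vars : Variables) where
  open Variables Vars
  open Semantics ℝ Vars
  open StateSet

  ¬¬-elim : ∀ {P : Set₁} → ¬ ¬ P → P
  ¬¬-elim {P} ¬¬p = from-dec em
    where
    from-dec : Dec P → P
    from-dec (yes p) = p
    from-dec (no ¬p) = contradiction ¬p ¬¬p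

  ¬¬-elim₀ : ∀ {P : Set} → ¬ ¬ P → P
  ¬¬-elim₀ ¬¬p = lower (¬¬-elim λ ¬p → ¬¬p λ p → ¬p (lift p))

  -- Excluded middle replaces a predicate in Set₁ by an equivalent one in Set.
  shrink : (P : Pred State (lsuc 0ℓ)) → (∀ {ω ν} → ω ≈ˢ ν → P ω → P ν) → StateSet
  shrink P resp = stateSet (λ ω → True (em {P ω})) (λ ω≈ν p → fromWitness (resp ω≈ν (toWitness p)))

  -- Besides monotonicity, `shrink` requires that a value of the operator respect equality of states
  -- before it can be treated as a state set.
  record Regular (G : Operator) : Set₁ where
    field
      monotone : ∀ {D E} → holds D ⊆ holds E → G D ⊆ G E
      resp     : ∀ {D ω ν} → ω ≈ˢ ν → G D ω → G D ν

  module KnasterTarski {G : Operator} (regular : Regular G) where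
    open Regular regular

    image : StateSet → StateSet
    image D = shrink (G D) resp

    -- The Knaster-Tarski fixpoints, as the intersection of all prefixed sets and the union of all
    -- postfixed sets. Quantifying over state sets raises the universe, and `shrink` lowers it
    -- again.
    lfp gfp : StateSet
    lfp = shrink (λ ω → ∀ E → G E ⊆ holds E → holds E ω)
                 (λ ω≈ν p E GE⊆E → respects E ω≈ν (p E GE⊆E))
    gfp = shrink (λ ω → ∃ λ E → holds E ⊆ G E × holds E ω)
                 (λ { ω≈ν (E , E⊆GE , Eω) → E , (λ {x} → E⊆GE {x}) , respects E ω≈ν Eω })

    lfp-⊆ : ∀ {E} → G E ⊆ holds E → holds lfp ⊆ holds E
    lfp-⊆ {E} GE⊆E p = toWitness p E GE⊆E

    gfp-⊇ : ∀ {E} → holds E ⊆ G E → holds E ⊆ holds gfp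
    gfp-⊇ {E} E⊆GE Eω = fromWitness (E , (λ {x} → E⊆GE {x}) , Eω)

    lfp-closed : G lfp ⊆ holds lfp
    lfp-closed Gω = fromWitness λ E GE⊆E → GE⊆E (monotone (lfp-⊆ {E} GE⊆E) Gω)

    gfp-consistent : holds gfp ⊆ G gfp
    gfp-consistent p = let (E , E⊆GE , Eω) = toWitness p in monotone (gfp-⊇ {E} E⊆GE) (E⊆GE Eω)

    -- That `lfp` lies inside its image is the usual argument: by monotonicity the image of a
    -- prefixed set is again prefixed, so it contains `lfp`.
    lfp-least : IsLeastFixpoint G lfp
    lfp-least =
      ((λ p → toWitness (lfp-⊆ {image lfp} (λ q → fromWitness (monotone (λ r → lfp-closed (toWitness r)) q)) p)) , lfp-closed) ,
      λ E fix → lfp-⊆ {E} (proj₂ fix)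

    gfp-greatest : IsGreatestFixpoint G gfp
    gfp-greatest =
      (gfp-consistent , (λ p → gfp-⊇ {image gfp} (λ q → monotone (λ r → fromWitness (gfp-consistent r)) (toWitness q)) (fromWitness p))) ,
      λ E fix → gfp-⊇ {E} (proj₁ fix)

    -- `IsLeastFixpoint` compares D with fixpoints only. A set that is merely prefixed is reached
    -- through `lfp`, which is a fixpoint below it.
    induction : ∀ {D E} → IsLeastFixpoint G D → G E ⊆ holds E → holds D ⊆ holds E
    induction {D} {E} (_ , least) GE⊆E p = lfp-⊆ {E} GE⊆E (least lfp (proj₁ lfp-least) p)

    coinduction : ∀ {D E} → IsGreatestFixpoint G D → holds E ⊆ G E → holds E ⊆ holds D
    coinduction {D} {E} (_ , greatest) E⊆GE p = greatest gfp (proj₁ gfp-greatest) (gfp-⊇ {E} E⊆GE p)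

  -- H is the de Morgan dual of G. It is stated pointwise because `∁` acts on state sets, while the
  -- values of operators live one universe higher.
  Dual : Operator → Operator → Set₁
  Dual G H = ∀ D ω → (H D ω → ¬ G (∁ D) ω) × (¬ G (∁ D) ω → H D ω)

  ∁∁ : ∀ D → holds (∁ (∁ D)) ≐ holds D
  ∁∁ D = ¬¬-elim₀ , λ p ¬p → ¬p p

  dual-sym : ∀ {G H} → Regular G → Dual G H → Dual H G
  dual-sym {G} {H} regG dual D ω =
    (λ Gω Hω → proj₁ (dual (∁ D) ω) Hω (Regular.monotone regG {D} {∁ (∁ D)} (proj₂ (∁∁ D)) Gω)) ,
    (λ ¬Hω → ¬¬-elim λ ¬Gω → ¬Hω (proj₂ (dual (∁ D) ω) λ GDω →
      ¬Gω (Regular.monotone regG {∁ (∁ D)} {D} (proj₁ (∁∁ D)) GDω)))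

  dual-fixpoint : ∀ {G H} → Regular G → Dual G H → ∀ {D} → IsFixpoint G D → IsFixpoint H (∁ D)
  dual-fixpoint {G} {H} regG dual {D} (D⊆GD , GD⊆D) =
    (λ {ω} ¬Dω → proj₂ (dual (∁ D) ω) λ Gω → ¬Dω (GD⊆D (Regular.monotone regG {∁ (∁ D)} {D} (proj₁ (∁∁ D)) Gω))) ,
    (λ {ω} Hω Dω → proj₁ (dual (∁ D) ω) Hω (Regular.monotone regG {D} {∁ (∁ D)} (proj₂ (∁∁ D)) (D⊆GD Dω)))

  dual-least : ∀ {G H} → Regular G → Regular H → Dual G H → ∀ {D} → IsLeastFixpoint G D → IsGreatestFixpoint H (∁ D)
  dual-least regG regH dual (fix , least) = dual-fixpoint regG dual fix , λ E fixE Eω Dω →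
    least (∁ E) (dual-fixpoint regH (dual-sym regG dual) fixE) Dω Eω

  dual-greatest : ∀ {G H} → Regular G → Regular H → Dual G H → ∀ {D} → IsGreatestFixpoint G D → IsLeastFixpoint H (∁ D)
  dual-greatest regG regH dual (fix , greatest) = dual-fixpoint regG dual fix , λ E fixE ¬Dω →
    ¬¬-elim₀ λ ¬Eω → ¬Dω (greatest (∁ E) (dual-fixpoint regH (dual-sym regG dual) fixE) ¬Eω)

-- Dependence of terms, formulas and transitions on the state

module Coincidence (em : ExcludedMiddle (lsuc 0ℓ)) (ℝ : CompleteOrderedField) (Vars : Variables) where
  open CompleteOrderedField ℝ hiding (zero)
  open Variables Vars
  open Syntax Vars
  open Semantics ℝ Vars
  open OrderedField (lower-em em) ℝ hiding (_:=_; con)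
  open Limits (lower-em em) ℝ

  -- The semantics uses strict inequalities and `Lim` uses closed ones; halving ε in this direction,
  -- and δ in the other, passes between them.
  Lim⇒∣∣ : ∀ {D s f l} → Lim D s f l → ∀ {ε} → 0# < ε →
    ∃ λ δ → 0# < δ × (∀ {s′} → D s′ → ∣ s′ - s ∣ < δ → ∣ f s′ - l ∣ < ε)
  Lim⇒∣∣ lim 0<ε = let (δ , 0<δ , near) = lim (half-pos 0<ε) in
    δ , 0<δ , λ Ds′ close → ≤±⇒∣∣< (near Ds′ (∣∣<⇒≤± close)) (half< 0<ε)

  ∣∣⇒Lim : ∀ {D : Pred Carrier 0ℓ} {s f l} →
    (∀ {ε} → 0# < ε → ∃ λ δ → 0# < δ × (∀ {s′} → D s′ → ∣ s′ - s ∣ < δ → ∣ f s′ - l ∣ < ε)) → Lim D s f l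
  ∣∣⇒Lim lim 0<ε = let (δ , 0<δ , near) = lim 0<ε in
    half δ , half-pos 0<δ , λ Ds′ close → ∣∣<⇒≤± (near Ds′ (≤±⇒∣∣< close (half< 0<δ)))

  HasDerivative⇒Diff : ∀ {t f f′} → HasDerivativeOn⟨0, t ⟩ f f′ → ∀ {s} → s ∈⟨0, t ⟩ → Diff (_∈⟨0, t ⟩) s f (f′ s)
  HasDerivative⇒Diff diff s∈ = ∣∣⇒Lim λ 0<ε → let (δ , 0<δ , near) = diff s∈ 0<ε in
    δ , 0<δ , λ (s′∈ , s′≉s) → near s′∈ s′≉s

  Diff⇒HasDerivative : ∀ {t f f′} → (∀ {s} → s ∈⟨0, t ⟩ → Diff (_∈⟨0, t ⟩) s f (f′ s)) → HasDerivativeOn⟨0, t ⟩ f f′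
  Diff⇒HasDerivative diff s∈ 0<ε = let (δ , 0<δ , near) = Lim⇒∣∣ (diff s∈) 0<ε in
    δ , 0<δ , λ s′∈ s′≉s → near (s′∈ , s′≉s)

  Agree : Pred 𝒳 0ℓ → Rel State 0ℓ
  Agree S ω ν = ∀ {v} → S v → ω v ≈ ν v

  infix 4 _⊆ˡ_
  _⊆ˡ_ : List 𝒳 → Pred 𝒳 0ℓ → Set
  xs ⊆ˡ S = ∀ {v} → v ∈ˡ xs → S v

  Agree-sym : ∀ {S ω ν} → Agree S ω ν → Agree S ν ω
  Agree-sym p s = sym (p s)

  Agree-↦ : ∀ {S ω ν r r′} x → r ≈ r′ → Agree S ω ν → Agree S (ω [ x ↦ r ]) (ν [ x ↦ r′ ])
  Agree-↦ x r≈r′ p {v} s with x ≟ v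
  ... | yes _ = r≈r′
  ... | no  _ = p s

  Agree-↦* : ∀ {S ω ν N} (x : Vector 𝒳 N) (r : Vector Carrier N) → Agree S ω ν → Agree S (ω [ x ↦* r ]) (ν [ x ↦* r ])
  Agree-↦* x r p {v} s with any? (λ i → x i ≟ v)
  ... | yes _ = refl
  ... | no  _ = p s

  term-coincidence : ∀ {S ω ν} θ → varsᵗ θ ⊆ˡ S → Agree S ω ν → ⟦ θ ⟧ᵗ ω ≈ ⟦ θ ⟧ᵗ ν
  term-coincidence (var v) ⊆S p = p (⊆S (here ≡.refl))
  term-coincidence (con q) ⊆S p = refl
  term-coincidence (a ⊕ b) ⊆S p = +-cong (term-coincidence a (⊆S ∘ ∈-++⁺ˡ) p) (term-coincidence b (⊆S ∘ ∈-++⁺ʳ (varsᵗ a)) p)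
  term-coincidence (a ⊗ b) ⊆S p = *-cong (term-coincidence a (⊆S ∘ ∈-++⁺ˡ) p) (term-coincidence b (⊆S ∘ ∈-++⁺ʳ (varsᵗ a)) p)
  term-coincidence (⊝ a)   ⊆S p = -‿cong (term-coincidence a ⊆S p)

  varsᵗ*-⊆ : ∀ {N} (θ : Vector Term N) i {v} → v ∈ˡ varsᵗ (θ i) → v ∈ˡ varsᵗ* θ
  varsᵗ*-⊆ θ zero    v∈ = ∈-++⁺ˡ v∈
  varsᵗ*-⊆ θ (suc i) v∈ = ∈-++⁺ʳ (varsᵗ (θ zero)) (varsᵗ*-⊆ (θ ∘ suc) i v∈)

  atom-coincidence : ∀ {S ω ν} p → varsᵃ p ⊆ˡ S → Agree S ω ν → ω ⊨ᵃ p → ν ⊨ᵃ p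
  atom-coincidence (a ≐ᵗ b) ⊆S p a≈b = trans (sym (term-coincidence a (⊆S ∘ ∈-++⁺ˡ) p))
    (trans a≈b (term-coincidence b (⊆S ∘ ∈-++⁺ʳ (varsᵗ a)) p))
  atom-coincidence (a ≼ b)  ⊆S p a≤b = ≤-resp (term-coincidence a (⊆S ∘ ∈-++⁺ˡ) p)
    (term-coincidence b (⊆S ∘ ∈-++⁺ʳ (varsᵗ a)) p) a≤b

  FO-coincidence : ∀ {S ω ν} ψ → varsᶠ ψ ⊆ˡ S → Agree S ω ν → ω ⊨ᶠ ψ → ν ⊨ᶠ ψ
  FO-coincidence (atom p)  ⊆S ag h        = atom-coincidence p ⊆S ag h
  FO-coincidence {S} (¬ᶠ ψ) ⊆S ag h h′    = h (FO-coincidence ψ ⊆S (Agree-sym {S} ag) h′)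
  FO-coincidence (ψ ∧ᶠ χ)  ⊆S ag (h , h′) = FO-coincidence ψ (⊆S ∘ ∈-++⁺ˡ) ag h , FO-coincidence χ (⊆S ∘ ∈-++⁺ʳ (varsᶠ ψ)) ag h′
  FO-coincidence (ψ ∨ᶠ χ)  ⊆S ag (inj₁ h) = inj₁ (FO-coincidence ψ (⊆S ∘ ∈-++⁺ˡ) ag h)
  FO-coincidence (ψ ∨ᶠ χ)  ⊆S ag (inj₂ h) = inj₂ (FO-coincidence χ (⊆S ∘ ∈-++⁺ʳ (varsᶠ ψ)) ag h)
  FO-coincidence {S} (∃ᶠ x ψ) ⊆S ag (r , h) = r , FO-coincidence ψ (⊆S ∘ there) (Agree-↦ {S} x refl ag) h
  FO-coincidence {S} (∀ᶠ x ψ) ⊆S ag h r     = FO-coincidence ψ (⊆S ∘ there) (Agree-↦ {S} x refl ag) (h r)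

  patch : ∀ {N} → Vector 𝒳 N → State → State → State
  patch x μ ν v with any? (λ i → x i ≟ v)
  ... | yes _ = μ v
  ... | no  _ = ν v

  patch-on : ∀ {N} (x : Vector 𝒳 N) {μ ν} i → patch x μ ν (x i) ≈ μ (x i)
  patch-on x i with any? (λ j → x j ≟ x i)
  ... | yes _ = refl
  ... | no ∉x = contradiction (i , ≡.refl) ∉x

  patch-off : ∀ {N} (x : Vector 𝒳 N) {μ ν v} → (∀ i → x i ≢ v) → patch x μ ν v ≈ ν v
  patch-off x {v = v} ∉x with any? (λ j → x j ≟ v)
  ... | yes (j , xj≡v) = contradiction xj≡v (∉x j)
  ... | no _           = refl

  patch-cases : ∀ {N} (x : Vector 𝒳 N) {μ ν v c} → ((∃ λ i → x i ≡ v) → c ≈ μ v) → ((∀ i → x i ≢ v) → c ≈ ν v) →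
    c ≈ patch x μ ν v
  patch-cases x {v = v} on off with any? (λ j → x j ≟ v)
  ... | yes p = on p
  ... | no ∉x = off λ i xi≡v → ∉x (i , xi≡v)

  -- The forth condition that makes agreement on `S` a bisimulation; the back condition follows
  -- because agreement is symmetric.
  simulate : ∀ {S ω ν} a → varsᵐ a ⊆ˡ S → Agree S ω ν → ∀ {μ} → ⟦ a ⟧ᵐ ω μ → ∃ λ μ′ → ⟦ a ⟧ᵐ ν μ′ × Agree S μ μ′
  simulate {S} {ω} {ν} (x :=*) ⊆S ag (r , μ≈) = ν [ x ↦ r ] , (r , λ _ → refl) ,
    λ s → trans (μ≈ _) (Agree-↦ {S} x refl ag s)
  simulate {S} {ω} {ν} (x := θ) ⊆S ag μ≈ = ν [ x ↦ ⟦ θ ⟧ᵗ ν ] , (λ _ → refl) ,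
    λ s → trans (μ≈ _) (Agree-↦ {S} x (term-coincidence θ (⊆S ∘ there) ag) ag s)
  -- The curve is kept. The new final state takes the evolved variables from μ and all others from
  -- ν, as the frame condition demands.
  simulate {S} {ω} {ν} ((x , _) ′= θ & ψ) ⊆S ag {μ} ev = patch x μ ν , record
    { frame = λ v ∉x → patch-off x ∉x
    ; t = t
    ; t≥0 = t≥0
    ; γ = γ
    ; continuous = continuous
    ; differentiable = λ i → Diff⇒HasDerivative λ {s} s∈ → lim-resp (λ _ → refl) (same-F (γ s) i)
        (HasDerivative⇒Diff (differentiable i) s∈)
    ; start = λ i → trans (start i) (ag (⊆S (∈-++⁺ˡ (∈-tabulate⁺ i))))
    ; end = λ i → trans (end i) (sym (patch-on x i))
    ; inside = λ {s} s∈ → FO-coincidence ψ (⊆S ∘ ∈-++⁺ʳ (toList x) ∘ ∈-++⁺ʳ (varsᵗ* θ)) (Agree-↦* {S} x (γ s) ag) (inside s∈)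
    } , λ s → patch-cases x (λ _ → refl) (λ ∉x → trans (frame _ ∉x) (ag s))
    where
    open Evolution ev
    same-F : ∀ r i → F r i ≈ ⟦ θ i ⟧ᵗ (ν [ x ↦* r ])
    same-F r i = term-coincidence (θ i) (⊆S ∘ ∈-++⁺ʳ (toList x) ∘ ∈-++⁺ˡ ∘ varsᵗ*-⊆ θ i) (Agree-↦* {S} x r ag)

-- Monotonicity, negation and coincidence for fixpoint formulas

module Valuations (em : ExcludedMiddle (lsuc 0ℓ)) (ℝ : CompleteOrderedField) (Vars : Variables) where
  open CompleteOrderedField ℝ using (sym)
  open Variables Vars
  open Syntax Vars
  open Semantics ℝ Vars
  open StateSet
  open Fixpoints em ℝ Vars
  open Coincidence em ℝ Vars

  semantics-resp : ∀ φ {V ω ν} → ω ≈ˢ ν → ⟦ φ ⟧ V ω → ⟦ φ ⟧ V ν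
  semantics-resp (lit (pos p)) ω≈ν (lift h) = lift (atom-coincidence {U} p _ (λ _ → ω≈ν _) h)
  semantics-resp (lit (neg p)) ω≈ν (lift h) = lift λ h′ → h (atom-coincidence {U} p _ (λ _ → sym (ω≈ν _)) h′)
  semantics-resp (pvar L) {V} ω≈ν (lift h) = lift (respects (⟦ L ⟧ᵖ V) ω≈ν h)
  semantics-resp (φ ∨ ψ) ω≈ν (inj₁ h) = inj₁ (semantics-resp φ ω≈ν h)
  semantics-resp (φ ∨ ψ) ω≈ν (inj₂ h) = inj₂ (semantics-resp ψ ω≈ν h)
  semantics-resp (φ ∧ ψ) ω≈ν (h , h′) = semantics-resp φ ω≈ν h , semantics-resp ψ ω≈ν h′
  semantics-resp (⟨ a ⟩ φ) ω≈ν (μ , ωaμ , h) = let (μ′ , νaμ′ , μ≈μ′) = simulate {U} a _ (λ _ → ω≈ν _) ωaμ in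
    μ′ , νaμ′ , semantics-resp φ (λ v → μ≈μ′ _) h
  semantics-resp ([ a ] φ) ω≈ν h μ νaμ = let (μ′ , ωaμ′ , μ≈μ′) = simulate {U} a _ (λ _ → sym (ω≈ν _)) νaμ in
    semantics-resp φ (λ v → sym (μ≈μ′ _)) (h μ′ ωaμ′)
  semantics-resp (μ[ L ] φ) ω≈ν (D , least , h) = D , least , respects D ω≈ν h
  semantics-resp (ν[ L ] φ) ω≈ν (D , greatest , h) = D , greatest , respects D ω≈ν h

  ↦ᵖ-self : ∀ V X D → (V [ X ↦ᵖ D ]) X ≡ D
  ↦ᵖ-self V X D with X ≟ᵖ X
  ... | yes _  = ≡.refl
  ... | no X≢X = contradiction ≡.refl X≢X

  ↦ᵖ-other : ∀ V X D {Y} → X ≢ Y → (V [ X ↦ᵖ D ]) Y ≡ V Y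
  ↦ᵖ-other V X D {Y} X≢Y with X ≟ᵖ Y
  ... | yes X≡Y = contradiction X≡Y X≢Y
  ... | no _    = ≡.refl

  ↦ˡ-self : ∀ V L D → holds (⟦ L ⟧ᵖ (V [ L ↦ˡ D ])) ≐ holds D
  ↦ˡ-self V (prop X) D rewrite ↦ᵖ-self V X D     = id , id
  ↦ˡ-self V (comp X) D rewrite ↦ᵖ-self V X (∁ D) = ∁∁ D

  ↦ˡ-other : ∀ V L D {Y} → base L ≢ Y → (V [ L ↦ˡ D ]) Y ≡ V Y
  ↦ˡ-other V (prop X) D = ↦ᵖ-other V X D
  ↦ˡ-other V (comp X) D = ↦ᵖ-other V X (∁ D)

  ⟦⟧ᵖ-cong : ∀ {V W} L → V (base L) ≡ W (base L) → holds (⟦ L ⟧ᵖ V) ⊆ holds (⟦ L ⟧ᵖ W)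
  ⟦⟧ᵖ-cong (prop X) eq h rewrite eq = h
  ⟦⟧ᵖ-cong (comp X) eq h rewrite eq = h

  same-base : ∀ K L → base K ≡ base L → L ≡ K ⊎ L ≡ bar K
  same-base (prop X) (prop X) ≡.refl = inj₁ ≡.refl
  same-base (prop X) (comp X) ≡.refl = inj₂ ≡.refl
  same-base (comp X) (prop X) ≡.refl = inj₂ ≡.refl
  same-base (comp X) (comp X) ≡.refl = inj₁ ≡.refl

  -- Inclusion is asked for each literal separately, because a variable and its complement need
  -- opposite inclusions. Only mentioned literals whose variable is free are constrained, which
  -- leaves bound variables to the fixpoint cases.
  MonotoneOn : Formula → Valuation → Valuation → Set
  MonotoneOn φ V W = ∀ L → FreeIn (base L) φ → Mentions L φ → holds (⟦ L ⟧ᵖ V) ⊆ holds (⟦ L ⟧ᵖ W)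

  update-monotone : ∀ {φ V W} K {D E} → ¬ Mentions (bar K) φ →
    (∀ L → base L ≢ base K → FreeIn (base L) φ → Mentions L φ → holds (⟦ L ⟧ᵖ V) ⊆ holds (⟦ L ⟧ᵖ W)) →
    holds D ⊆ holds E → MonotoneOn φ (V [ K ↦ˡ D ]) (W [ K ↦ˡ E ])
  update-monotone {φ} {V} {W} K {D} {E} ¬bar V⊆W D⊆E L free ment h = by-cases (base K ≟ᵖ base L)
    where
    same : L ≡ K ⊎ L ≡ bar K → holds (⟦ L ⟧ᵖ (W [ K ↦ˡ E ])) _
    same (inj₁ ≡.refl) = proj₂ (↦ˡ-self W K E) (D⊆E (proj₁ (↦ˡ-self V K D) h))
    same (inj₂ ≡.refl) = contradiction ment ¬bar
    by-cases : Dec (base K ≡ base L) → holds (⟦ L ⟧ᵖ (W [ K ↦ˡ E ])) _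
    by-cases (yes K≡L) = same (same-base K L K≡L)
    by-cases (no K≢L)  = ⟦⟧ᵖ-cong L (≡.sym (↦ˡ-other W K E K≢L))
      (V⊆W L (K≢L ∘ ≡.sym) free ment (⟦⟧ᵖ-cong L (↦ˡ-other V K D K≢L) h))

  operator : 𝒱̄ → Formula → Valuation → Operator
  operator L φ V E = ⟦ φ ⟧ (V [ L ↦ˡ E ])

  mutual
    -- Proved together with `operator-regular`: a fixpoint formula holds only if the fixpoint
    -- exists, and existence by Knaster-Tarski needs the body to be monotone. At μ the least
    -- fixpoint under W is prefixed under V; at ν the greatest fixpoint under V is postfixed under
    -- W.
    semantics-monotone : ∀ φ {V W} → WellFormed φ → MonotoneOn φ V W → ⟦ φ ⟧ V ⊆ ⟦ φ ⟧ W
    semantics-monotone (lit (pos p)) wf V⊆W h = h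
    semantics-monotone (lit (neg p)) wf V⊆W h = h
    semantics-monotone (pvar L) wf V⊆W (lift h) = lift (V⊆W L ≡.refl ≡.refl h)
    semantics-monotone (φ ∨ ψ) (wf , wf′) V⊆W (inj₁ h) =
      inj₁ (semantics-monotone φ wf (λ L f m → V⊆W L (inj₁ f) (inj₁ m)) h)
    semantics-monotone (φ ∨ ψ) (wf , wf′) V⊆W (inj₂ h) =
      inj₂ (semantics-monotone ψ wf′ (λ L f m → V⊆W L (inj₂ f) (inj₂ m)) h)
    semantics-monotone (φ ∧ ψ) (wf , wf′) V⊆W (h , h′) =
      semantics-monotone φ wf (λ L f m → V⊆W L (inj₁ f) (inj₁ m)) h ,
      semantics-monotone ψ wf′ (λ L f m → V⊆W L (inj₂ f) (inj₂ m)) h′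
    semantics-monotone (⟨ a ⟩ φ) wf V⊆W (μ , ωaμ , h) = μ , ωaμ , semantics-monotone φ wf V⊆W h
    semantics-monotone ([ a ] φ) wf V⊆W h μ ωaμ = semantics-monotone φ wf V⊆W (h μ ωaμ)
    semantics-monotone (μ[ K ] φ) {V} {W} (¬bar , wf) V⊆W (D , least , h) =
      lfp , lfp-least , KnasterTarski.induction (operator-regular K φ ¬bar wf V) {D} {lfp} least
        (λ p → lfp-closed (semantics-monotone φ wf
          (update-monotone {φ} {V} {W} K {lfp} {lfp} ¬bar (λ L ≢K f m → V⊆W L (≢K , f) (inj₂ m)) id) p)) h
      where
      open KnasterTarski (operator-regular K φ ¬bar wf W)
    semantics-monotone (ν[ K ] φ) {V} {W} (¬bar , wf) V⊆W (D , greatest , h) =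
      gfp , gfp-greatest , gfp-⊇ {D} (λ p → semantics-monotone φ wf
          (update-monotone {φ} {V} {W} K {D} {D} ¬bar (λ L ≢K f m → V⊆W L (≢K , f) (inj₂ m)) id) (proj₁ (proj₁ greatest) p)) h
      where
      open KnasterTarski (operator-regular K φ ¬bar wf W)

    operator-regular : ∀ L φ → ¬ Mentions (bar L) φ → WellFormed φ → ∀ V → Regular (operator L φ V)
    operator-regular L φ ¬bar wf V = record
      { monotone = λ {D} {E} D⊆E → semantics-monotone φ wf
          (update-monotone {φ} {V} {V} L {D} {E} ¬bar (λ _ _ _ _ → id) D⊆E)
      ; resp = semantics-resp φ
      }

  bar-adjoint : ∀ K {L} → L ≡ bar K → bar L ≡ K
  bar-adjoint (prop X) ≡.refl = ≡.refl
  bar-adjoint (comp X) ≡.refl = ≡.refl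

  mentions-∼ : ∀ φ {L} → Mentions L (∼ φ) → Mentions (bar L) φ
  mentions-∼ (lit (pos p)) ()
  mentions-∼ (lit (neg p)) ()
  mentions-∼ (pvar K)   = bar-adjoint K
  mentions-∼ (φ ∨ ψ)    = [ inj₁ ∘ mentions-∼ φ , inj₂ ∘ mentions-∼ ψ ]′
  mentions-∼ (φ ∧ ψ)    = [ inj₁ ∘ mentions-∼ φ , inj₂ ∘ mentions-∼ ψ ]′
  mentions-∼ (⟨ a ⟩ φ)  = mentions-∼ φ
  mentions-∼ ([ a ] φ)  = mentions-∼ φ
  mentions-∼ (μ[ K ] φ) = [ inj₁ ∘ bar-adjoint K , inj₂ ∘ mentions-∼ φ ]′
  mentions-∼ (ν[ K ] φ) = [ inj₁ ∘ bar-adjoint K , inj₂ ∘ mentions-∼ φ ]′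

  ¬mentions-∼ : ∀ L φ → ¬ Mentions (bar L) φ → ¬ Mentions (bar (bar L)) (∼ φ)
  ¬mentions-∼ (prop X) φ ¬bar m = ¬bar (mentions-∼ φ m)
  ¬mentions-∼ (comp X) φ ¬bar m = ¬bar (mentions-∼ φ m)

  wellFormed-∼ : ∀ φ → WellFormed φ → WellFormed (∼ φ)
  wellFormed-∼ (lit (pos p)) wf = tt
  wellFormed-∼ (lit (neg p)) wf = tt
  wellFormed-∼ (pvar L) wf = tt
  wellFormed-∼ (φ ∨ ψ) (wf , wf′) = wellFormed-∼ φ wf , wellFormed-∼ ψ wf′
  wellFormed-∼ (φ ∧ ψ) (wf , wf′) = wellFormed-∼ φ wf , wellFormed-∼ ψ wf′
  wellFormed-∼ (⟨ a ⟩ φ) wf = wellFormed-∼ φ wf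
  wellFormed-∼ ([ a ] φ) wf = wellFormed-∼ φ wf
  wellFormed-∼ (μ[ L ] φ) (¬bar , wf) = ¬mentions-∼ L φ ¬bar , wellFormed-∼ φ wf
  wellFormed-∼ (ν[ L ] φ) (¬bar , wf) = ¬mentions-∼ L φ ¬bar , wellFormed-∼ φ wf

  ↦ˡ-bar-∁ : ∀ V L D K → holds (⟦ K ⟧ᵖ (V [ bar L ↦ˡ D ])) ≐ holds (⟦ K ⟧ᵖ (V [ L ↦ˡ ∁ D ]))
  ↦ˡ-bar-∁ V (prop X) D K = id , id
  ↦ˡ-bar-∁ V (comp X) D (prop Y) with X ≟ᵖ Y
  ... | yes _ = proj₂ (∁∁ D) , proj₁ (∁∁ D)
  ... | no  _ = id , id
  ↦ˡ-bar-∁ V (comp X) D (comp Y) with X ≟ᵖ Y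
  ... | yes _ = (λ ¬p q → ¬p (proj₁ (∁∁ D) q)) , (λ ¬p q → ¬p (proj₂ (∁∁ D) q))
  ... | no  _ = id , id

  mutual
    -- In the fixpoint cases the induction hypothesis says that the operator of ∼ φ is the dual of
    -- the operator of φ, so complements exchange their fixpoints and greatest becomes least.
    ∼⇒¬ : ∀ φ {V ω} → WellFormed φ → ⟦ ∼ φ ⟧ V ω → ¬ ⟦ φ ⟧ V ω
    ∼⇒¬ (lit (pos p)) wf (lift h) (lift h′) = h h′
    ∼⇒¬ (lit (neg p)) wf (lift h) (lift h′) = h′ h
    ∼⇒¬ (pvar (prop X)) wf (lift h) (lift h′) = h h′
    ∼⇒¬ (pvar (comp X)) wf (lift h) (lift h′) = h′ h
    ∼⇒¬ (φ ∨ ψ) (wf , wf′) (h , h′) = [ ∼⇒¬ φ wf h , ∼⇒¬ ψ wf′ h′ ]′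
    ∼⇒¬ (φ ∧ ψ) (wf , wf′) (inj₁ h) (g , g′) = ∼⇒¬ φ wf h g
    ∼⇒¬ (φ ∧ ψ) (wf , wf′) (inj₂ h) (g , g′) = ∼⇒¬ ψ wf′ h g′
    ∼⇒¬ (⟨ a ⟩ φ) wf h (μ , ωaμ , g) = ∼⇒¬ φ wf (h μ ωaμ) g
    ∼⇒¬ ([ a ] φ) wf (μ , ωaμ , h) g = ∼⇒¬ φ wf h (g μ ωaμ)
    ∼⇒¬ (μ[ L ] φ) {V} (¬bar , wf) (D , greatest , h) (E , least , g) =
      proj₂ least (∁ D) (proj₁ (dual-greatest (operator-regular (bar L) (∼ φ) (¬mentions-∼ L φ ¬bar) (wellFormed-∼ φ wf) V)
        (operator-regular L φ ¬bar wf V) (dual-sym (operator-regular L φ ¬bar wf V) (dual-operator L φ wf V)) greatest)) g h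
    ∼⇒¬ (ν[ L ] φ) {V} (¬bar , wf) (D , least , h) (E , greatest , g) =
      proj₂ least (∁ E) (proj₁ (dual-greatest (operator-regular L φ ¬bar wf V)
        (operator-regular (bar L) (∼ φ) (¬mentions-∼ L φ ¬bar) (wellFormed-∼ φ wf) V) (dual-operator L φ wf V) greatest)) h g

    ¬⇒∼ : ∀ φ {V ω} → WellFormed φ → ¬ ⟦ φ ⟧ V ω → ⟦ ∼ φ ⟧ V ω
    ¬⇒∼ (lit (pos p)) wf ¬h = lift λ h → ¬h (lift h)
    ¬⇒∼ (lit (neg p)) wf ¬h = lift (¬¬-elim₀ λ h → ¬h (lift h))
    ¬⇒∼ (pvar (prop X)) wf ¬h = lift λ h → ¬h (lift h)
    ¬⇒∼ (pvar (comp X)) wf ¬h = lift (¬¬-elim₀ λ h → ¬h (lift h))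
    ¬⇒∼ (φ ∨ ψ) (wf , wf′) ¬h = ¬⇒∼ φ wf (¬h ∘ inj₁) , ¬⇒∼ ψ wf′ (¬h ∘ inj₂)
    ¬⇒∼ (φ ∧ ψ) {V} {ω} (wf , wf′) ¬h = from-dec em
      where
      from-dec : Dec (⟦ φ ⟧ V ω) → ⟦ ∼ φ ⟧ V ω ⊎ ⟦ ∼ ψ ⟧ V ω
      from-dec (yes p) = inj₂ (¬⇒∼ ψ wf′ λ q → ¬h (p , q))
      from-dec (no ¬p) = inj₁ (¬⇒∼ φ wf ¬p)
    ¬⇒∼ (⟨ a ⟩ φ) wf ¬h μ ωaμ = ¬⇒∼ φ wf λ h → ¬h (μ , ωaμ , h)
    ¬⇒∼ ([ a ] φ) {V} {ω} wf ¬h = ¬¬-elim λ ¬p → ¬h λ μ ωaμ →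
      ¬¬-elim λ ¬q → ¬p (μ , ωaμ , ¬⇒∼ φ wf ¬q)
    ¬⇒∼ (μ[ L ] φ) {V} (¬bar , wf) ¬h = ∁ lfp ,
      dual-least (operator-regular L φ ¬bar wf V)
        (operator-regular (bar L) (∼ φ) (¬mentions-∼ L φ ¬bar) (wellFormed-∼ φ wf) V) (dual-operator L φ wf V) lfp-least ,
      λ p → ¬h (lfp , lfp-least , p)
      where
      open KnasterTarski (operator-regular L φ ¬bar wf V)
    ¬⇒∼ (ν[ L ] φ) {V} (¬bar , wf) ¬h = ∁ gfp ,
      dual-greatest (operator-regular L φ ¬bar wf V)
        (operator-regular (bar L) (∼ φ) (¬mentions-∼ L φ ¬bar) (wellFormed-∼ φ wf) V) (dual-operator L φ wf V) gfp-greatest ,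
      λ p → ¬h (gfp , gfp-greatest , p)
      where
      open KnasterTarski (operator-regular L φ ¬bar wf V)

    dual-operator : ∀ L φ → WellFormed φ → ∀ V → Dual (operator L φ V) (operator (bar L) (∼ φ) V)
    dual-operator L φ wf V D ω =
      (λ h g → ∼⇒¬ φ wf h (semantics-monotone φ wf (λ K _ _ → proj₂ (↦ˡ-bar-∁ V L D K)) g)) ,
      (λ ¬g → ¬⇒∼ φ wf λ g → ¬g (semantics-monotone φ wf (λ K _ _ → proj₁ (↦ˡ-bar-∁ V L D K)) g))

  ⇔-valid : ∀ {φ ψ V ω} → WellFormed φ → WellFormed ψ →
    (⟦ φ ⟧ V ω → ⟦ ψ ⟧ V ω) → (⟦ ψ ⟧ V ω → ⟦ φ ⟧ V ω) → ⟦ φ ⇔ ψ ⟧ V ω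
  ⇔-valid {φ} {ψ} {V} {ω} wfφ wfψ f g = implication φ ψ wfφ f em , implication ψ φ wfψ g em
    where
    implication : ∀ φ ψ → WellFormed φ → (⟦ φ ⟧ V ω → ⟦ ψ ⟧ V ω) → Dec (⟦ φ ⟧ V ω) → ⟦ φ ⇒ ψ ⟧ V ω
    implication φ ψ wf f (yes p) = inj₂ (f p)
    implication φ ψ wf f (no ¬p) = inj₁ (¬⇒∼ φ wf ¬p)

  Invariant : Pred 𝒳 0ℓ → StateSet → Set
  Invariant S D = ∀ {ω ν} → Agree S ω ν → holds D ω → holds D ν

  update-invariant : ∀ {S} L V D → Invariant S D → ∀ φ → (∀ X → X ≢ base L × FreeIn X φ → Invariant S (V X)) →
    ∀ X → FreeIn X φ → Invariant S ((V [ L ↦ˡ D ]) X)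
  update-invariant {S} L V D inv-D φ inv X free = by-cases (base L ≟ᵖ X)
    where
    updated : ∀ L → Invariant S ((V [ L ↦ˡ D ]) (base L))
    updated (prop X) rewrite ↦ᵖ-self V X D     = inv-D
    updated (comp X) rewrite ↦ᵖ-self V X (∁ D) = λ ag ¬p p → ¬p (inv-D (Agree-sym {S} ag) p)
    by-cases : Dec (base L ≡ X) → Invariant S ((V [ L ↦ˡ D ]) X)
    by-cases (yes ≡.refl) = updated L
    by-cases (no L≢X) rewrite ↦ˡ-other V L D L≢X = inv X ((L≢X ∘ ≡.sym) , free)

  -- The induction hypothesis for the body of a fixpoint needs an invariant value for the bound
  -- variable, and D is not known to be one beforehand. D is therefore approximated by an invariant
  -- set, from inside for μ and from outside for ν, and fixpoint induction or coinduction closes the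
  -- gap.
  semantics-coincidence : ∀ {S} φ → WellFormed φ → vars φ ⊆ˡ S → ∀ {V} → (∀ X → FreeIn X φ → Invariant S (V X)) →
    ∀ {ω ν} → Agree S ω ν → ⟦ φ ⟧ V ω → ⟦ φ ⟧ V ν
  semantics-coincidence (lit (pos p)) wf ⊆S inv ag (lift h) = lift (atom-coincidence p ⊆S ag h)
  semantics-coincidence {S} (lit (neg p)) wf ⊆S inv ag (lift h) = lift λ h′ → h (atom-coincidence p ⊆S (Agree-sym {S} ag) h′)
  semantics-coincidence (pvar (prop X)) wf ⊆S inv ag (lift h) = lift (inv X ≡.refl ag h)
  semantics-coincidence {S} (pvar (comp X)) wf ⊆S inv ag (lift h) = lift λ h′ → h (inv X ≡.refl (Agree-sym {S} ag) h′)
  semantics-coincidence (φ ∨ ψ) (wf , wf′) ⊆S inv ag (inj₁ h) =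
    inj₁ (semantics-coincidence φ wf (⊆S ∘ ∈-++⁺ˡ) (λ X → inv X ∘ inj₁) ag h)
  semantics-coincidence (φ ∨ ψ) (wf , wf′) ⊆S inv ag (inj₂ h) =
    inj₂ (semantics-coincidence ψ wf′ (⊆S ∘ ∈-++⁺ʳ (vars φ)) (λ X → inv X ∘ inj₂) ag h)
  semantics-coincidence (φ ∧ ψ) (wf , wf′) ⊆S inv ag (h , h′) =
    semantics-coincidence φ wf (⊆S ∘ ∈-++⁺ˡ) (λ X → inv X ∘ inj₁) ag h ,
    semantics-coincidence ψ wf′ (⊆S ∘ ∈-++⁺ʳ (vars φ)) (λ X → inv X ∘ inj₂) ag h′
  semantics-coincidence {S} (⟨ a ⟩ φ) wf ⊆S inv ag (μ , ωaμ , h) =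
    let (μ′ , νaμ′ , ag′) = simulate {S} a (⊆S ∘ ∈-++⁺ˡ) ag ωaμ in
    μ′ , νaμ′ , semantics-coincidence φ wf (⊆S ∘ ∈-++⁺ʳ (varsᵐ a)) inv ag′ h
  semantics-coincidence {S} ([ a ] φ) wf ⊆S inv ag h μ νaμ =
    let (μ′ , ωaμ′ , ag′) = simulate {S} a (⊆S ∘ ∈-++⁺ˡ) (Agree-sym {S} ag) νaμ in
    semantics-coincidence φ wf (⊆S ∘ ∈-++⁺ʳ (varsᵐ a)) inv (Agree-sym {S} ag′) (h μ′ ωaμ′)
  semantics-coincidence {S} (μ[ L ] φ) (¬bar , wf) ⊆S {V} inv {ω} {ν} ag (D , least , h) = D , least ,
    KnasterTarski.induction regular {D} {core} least core-closed h ν ag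
    where
    regular = operator-regular L φ ¬bar wf V
    -- The largest invariant subset of D is again closed under the operator.
    core : StateSet
    core = stateSet (λ ω → ∀ ν → Agree S ω ν → holds D ν)
      (λ ω≈ν c μ ag → c μ λ s → CompleteOrderedField.trans ℝ (ω≈ν _) (ag s))
    core⊆D : holds core ⊆ holds D
    core⊆D c = c _ λ _ → CompleteOrderedField.refl ℝ
    core-invariant : Invariant S core
    core-invariant ag c μ ag′ = c μ λ s → CompleteOrderedField.trans ℝ (ag s) (ag′ s)
    core-closed : operator L φ V core ⊆ holds core
    core-closed g μ ag′ = proj₂ (proj₁ least) (Regular.monotone regular {core} {D} core⊆D
      (semantics-coincidence φ wf ⊆S (update-invariant L V core core-invariant φ inv) ag′ g))
  semantics-coincidence {S} (ν[ L ] φ) (¬bar , wf) ⊆S {V} inv {ω} {ν} ag (D , greatest , h) = D , greatest ,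
    KnasterTarski.coinduction regular {D} {hull} greatest hull-consistent (ω , ag , h)
    where
    regular = operator-regular L φ ¬bar wf V
    -- The saturation of D under agreement is its smallest invariant superset; being postfixed, it
    -- is contained in D.
    hull : StateSet
    hull = stateSet (λ ν → ∃ λ ω → Agree S ω ν × holds D ω)
      (λ { ν≈μ (ω , ag , h) → ω , (λ s → CompleteOrderedField.trans ℝ (ag s) (ν≈μ _)) , h })
    D⊆hull : holds D ⊆ holds hull
    D⊆hull h = _ , (λ _ → CompleteOrderedField.refl ℝ) , h
    hull-invariant : Invariant S hull
    hull-invariant ag (ω , ag′ , h) = ω , (λ s → CompleteOrderedField.trans ℝ (ag′ s) (ag s)) , h
    hull-consistent : holds hull ⊆ operator L φ V hull
    hull-consistent (ω , ag′ , h) =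
      semantics-coincidence φ wf ⊆S (update-invariant L V hull hull-invariant φ inv) ag′
        (Regular.monotone regular {D} {hull} D⊆hull (proj₁ (proj₁ greatest) h))

-- Terms as locally Lipschitz, differentiable functions

module TermSemantics (em : ExcludedMiddle (lsuc 0ℓ)) (ℝ : CompleteOrderedField) (Vars : Variables) where
  open CompleteOrderedField ℝ hiding (zero)
  open Variables Vars
  open Syntax Vars
  open Semantics ℝ Vars
  open OrderedField (lower-em em) ℝ renaming (_:=_ to _:≡_; con to :con)
  open Limits (lower-em em) ℝ
  open Bisection (lower-em em) ℝ using (Box; LocallyLipschitz)
  open VectorMeanValue (lower-em em) ℝ using (dot)
  open Coincidence em ℝ Vars
  open SemiringSum semiring using (sum; sum-cong-≋; sum-replicate-zero; ∑-distrib-+; *-distribˡ-sum; *-distribʳ-sum)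

  0<1+0 : 0# < 1# + 0#
  0<1+0 = +-pos-nonneg 0<1 ≤-refl

  fromℚ-0 : fromℚ 0ℚ ≈ 0#
  fromℚ-0 = zeroˡ _

  fromℚ-1 : fromℚ 1ℚ ≈ 1#
  fromℚ-1 = inverse 0<1+0

  fromℚ-2 : fromℚ (+ 2 / 1) ≈ 1# + 1#
  fromℚ-2 = trans (solve 2 (λ o i → (o :+ (o :+ :con (+ 0))) :* i :≡ (o :+ :con (+ 0)) :* i :+ (o :+ :con (+ 0)) :* i) refl 1# ((1# + 0#) ⁻¹))
    (+-cong fromℚ-1 fromℚ-1)

  fromℚ-½ : ∀ r → r * fromℚ ½ ≈ half r
  fromℚ-½ r = trans (solve 2 (λ r i → r :* ((:con (+ 1) :+ :con (+ 0)) :* i) :≡ r :* i) refl r ((1# + (1# + 0#)) ⁻¹))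
    (*-congˡ (trans (sym (*-identityʳ _)) (trans (*-congˡ (sym (inverse 0<2)))
      (trans (solve 2 (λ i j → i :* (:con (+ 2) :* j) :≡ (:con (+ 1) :+ (:con (+ 1) :+ :con (+ 0))) :* i :* j) refl
        ((1# + (1# + 0#)) ⁻¹) ((1# + 1#) ⁻¹))
      (trans (*-congʳ (inverse (+-pos-nonneg 0<1 (proj₁ 0<1+0)))) (*-identityˡ _))))))

  sum-single : ∀ {N} (f : Vector Carrier N) i → (∀ j → j ≢ i → f j ≈ 0#) → sum f ≈ f i
  sum-single {suc N} f zero    others = trans (+-congˡ (trans (sum-cong-≋ λ j → others (suc j) λ ()) (sum-replicate-zero N))) (+-identityʳ _)
  sum-single {suc N} f (suc i) others = trans (+-cong (others zero λ ()) (sum-single (f ∘ suc) i λ j j≢i → others (suc j) (j≢i ∘ suc-injective)))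
    (+-identityˡ _)

  component-≤-sum : ∀ {N} {f : Vector Carrier N} → (∀ i → 0# ≤ f i) → ∀ i → f i ≤ sum f
  component-≤-sum {suc N} 0≤f zero    = ≤-+ (VectorMeanValue.sum-nonneg (lower-em em) ℝ (0≤f ∘ suc))
  component-≤-sum {suc N} {f} 0≤f (suc i) = ≤-trans (component-≤-sum (0≤f ∘ suc) i)
    (≤-resp refl (+-comm _ _) (≤-+ (0≤f zero)))

  sumᵗ-semantics : ∀ {N} (a : Vector Term N) ω → ⟦ sumᵗ a ⟧ᵗ ω ≈ sum (λ i → ⟦ a i ⟧ᵗ ω)
  sumᵗ-semantics {zero}  a ω = fromℚ-0
  sumᵗ-semantics {suc N} a ω = +-congˡ (sumᵗ-semantics (a ∘ suc) ω)

  normSq-semantics : ∀ {N} (a : Vector Term N) ω → ⟦ normSq a ⟧ᵗ ω ≈ dot (λ i → ⟦ a i ⟧ᵗ ω) (λ i → ⟦ a i ⟧ᵗ ω)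
  normSq-semantics a ω = sumᵗ-semantics (λ i → a i ⊗ a i) ω

  vars-∂ : ∀ x θ {v} → v ∈ˡ varsᵗ (∂ x θ) → v ∈ˡ varsᵗ θ
  vars-∂ x (var w) v∈ with x ≟ w
  vars-∂ x (var w) () | yes _
  vars-∂ x (var w) () | no  _
  vars-∂ x (con q) v∈ = v∈
  vars-∂ x (a ⊕ b) v∈ = [ ∈-++⁺ˡ ∘ vars-∂ x a , ∈-++⁺ʳ (varsᵗ a) ∘ vars-∂ x b ]′ (∈-++⁻ (varsᵗ (∂ x a)) v∈)
  vars-∂ x (a ⊗ b) v∈ = [
      [ ∈-++⁺ˡ ∘ vars-∂ x a , ∈-++⁺ʳ (varsᵗ a) ]′ ∘ ∈-++⁻ (varsᵗ (∂ x a)) ,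
      [ ∈-++⁺ˡ , ∈-++⁺ʳ (varsᵗ a) ∘ vars-∂ x b ]′ ∘ ∈-++⁻ (varsᵗ a) ]′ (∈-++⁻ (varsᵗ (∂ x a ⊗ b)) v∈)
  vars-∂ x (⊝ a) v∈ = vars-∂ x a v∈

  vars-sumᵗ : ∀ {N} (a : Vector Term N) {v} → v ∈ˡ varsᵗ (sumᵗ a) → ∃ λ i → v ∈ˡ varsᵗ (a i)
  vars-sumᵗ {suc N} a v∈ = [ (λ v∈ → zero , v∈) , (λ v∈ → let (i , v∈i) = vars-sumᵗ (a ∘ suc) v∈ in suc i , v∈i) ]′
    (∈-++⁻ (varsᵗ (a zero)) v∈)

  -- Freshness is postulated for θ; it carries over to the second-order term because formal
  -- differentiation introduces no variables.
  vars-hat : ∀ {N} (x : Vector 𝒳 N) (θ : Vector Term N) j {v} → v ∈ˡ varsᵗ (hat x θ j) → v ∈ˡ varsᵗ* θ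
  vars-hat x θ j v∈ = let (i , v∈i) = vars-sumᵗ _ v∈ in
    [ varsᵗ*-⊆ θ j ∘ vars-∂ (x i) (θ j) , varsᵗ*-⊆ θ i ]′ (∈-++⁻ (varsᵗ (∂ (x i) (θ j))) v∈i)

  module Substitution {N} (ω : State) (x : Vector 𝒳 N) where

    -- A single decision whether v occurs in x settles both the update of a state and the exchange
    -- of variables, and with the same index, even if x has repetitions.
    data Lookup (v : 𝒳) : Set where
      on  : ∀ i → x i ≡ v → (∀ ω r → (ω [ x ↦* r ]) v ≡ r i) → (∀ z → exchange x z v ≡ z i) → Lookup v
      off : (∀ i → x i ≢ v) → (∀ ω r → (ω [ x ↦* r ]) v ≡ ω v) → (∀ z → (∀ i → z i ≢ v) → exchange x z v ≡ v) → Lookup v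

    look : ∀ v → Lookup v
    look v with any? (λ i → x i ≟ v) in eq
    ... | yes (i , xi≡v) = on i xi≡v on-update on-exchange
      where
      on-update : ∀ ω r → (ω [ x ↦* r ]) v ≡ r i
      on-update ω r rewrite eq = ≡.refl
      on-exchange : ∀ z → exchange x z v ≡ z i
      on-exchange z rewrite eq = ≡.refl
    ... | no ∉x = off (λ i xi≡v → ∉x (i , xi≡v)) off-update off-exchange
      where
      off-update : ∀ ω r → (ω [ x ↦* r ]) v ≡ ω v
      off-update ω r rewrite eq = ≡.refl
      off-exchange : ∀ z → (∀ i → z i ≢ v) → exchange x z v ≡ v
      off-exchange z ∉z rewrite eq with any? (λ i → z i ≟ v)
      ... | yes (i , zi≡v) = contradiction zi≡v (∉z i)
      ... | no _           = ≡.refl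

    evalAt : Term → Vector Carrier N → Carrier
    evalAt e r = ⟦ e ⟧ᵗ (ω [ x ↦* r ])

    eval-bound : ∀ e m → ∃ λ L → 0# ≤ L × (∀ {r} → Box m r → evalAt e r ≤± L)
    eval-bound (var v) m = from (look v)
      where
      from : Lookup v → ∃ λ L → 0# ≤ L × (∀ {r} → Box m r → evalAt (var v) r ≤± L)
      from (on i _ upd _) = let (L , m≤L) = ≤±-bound m in
        L , ≤±-nonneg m≤L , λ {r} r∈ → ≤±-resp (reflexive (≡.sym (upd ω r))) refl (≤±-weaken (proj₂ m≤L) (r∈ i))
      from (off _ upd _) = let (L , ωv≤L) = ≤±-bound (ω v) in
        L , ≤±-nonneg ωv≤L , λ {r} _ → ≤±-resp (reflexive (≡.sym (upd ω r))) refl ωv≤L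
    eval-bound (con q) m = let (L , q≤L) = ≤±-bound (fromℚ q) in L , ≤±-nonneg q≤L , λ _ → q≤L
    eval-bound (a ⊕ b) m = let (L , 0≤L , la) = eval-bound a m ; (L′ , 0≤L′ , lb) = eval-bound b m in
      L + L′ , 0≤L +≥0 0≤L′ , λ r∈ → la r∈ +± lb r∈
    eval-bound (a ⊗ b) m = let (L , 0≤L , la) = eval-bound a m ; (L′ , 0≤L′ , lb) = eval-bound b m in
      L * L′ , 0≤L *≥0 0≤L′ , λ r∈ → la r∈ *± lb r∈
    eval-bound (⊝ a) m = let (L , 0≤L , la) = eval-bound a m in L , 0≤L , λ r∈ → ≤±-neg (la r∈)

    eval-lipschitz : ∀ e m → ∃ λ K → 0# ≤ K ×
      (∀ {r r′ δ} → Box m r → Box m r′ → (∀ i → r i - r′ i ≤± δ) → evalAt e r - evalAt e r′ ≤± K * δ)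
    eval-lipschitz (var v) m = from (look v)
      where
      from : Lookup v → ∃ λ K → 0# ≤ K ×
        (∀ {r r′ δ} → Box m r → Box m r′ → (∀ i → r i - r′ i ≤± δ) → evalAt (var v) r - evalAt (var v) r′ ≤± K * δ)
      from (on i _ upd _) = 1# , 0≤1 , λ {r} {r′} _ _ close →
        ≤±-resp (+-cong (reflexive (≡.sym (upd ω r))) (-‿cong (reflexive (≡.sym (upd ω r′))))) (sym (*-identityˡ _)) (close i)
      from (off _ upd _) = 0# , ≤-refl , λ {r} {r′} _ _ _ →
        ≈0⇒≤± (trans (+-cong (reflexive (upd ω r)) (-‿cong (reflexive (upd ω r′)))) (-‿inverseʳ _)) (≤-reflexive (sym (zeroˡ _)))
    eval-lipschitz (con q) m = 0# , ≤-refl , λ _ _ _ → ≈0⇒≤± (-‿inverseʳ _) (≤-reflexive (sym (zeroˡ _)))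
    eval-lipschitz (a ⊕ b) m = let (K , 0≤K , ka) = eval-lipschitz a m ; (K′ , 0≤K′ , kb) = eval-lipschitz b m in
      K + K′ , 0≤K +≥0 0≤K′ , λ {r} {r′} {δ} r∈ r′∈ close → ≤±-resp
        (solve 4 (λ a a′ b b′ → (a :- a′) :+ (b :- b′) :≡ (a :+ b) :- (a′ :+ b′)) refl (evalAt a r) (evalAt a r′) (evalAt b r) (evalAt b r′))
        (sym (distribʳ δ K K′)) (ka r∈ r′∈ close +± kb r∈ r′∈ close)
    eval-lipschitz (a ⊗ b) m =
      let (K , 0≤K , ka) = eval-lipschitz a m ; (K′ , 0≤K′ , kb) = eval-lipschitz b m
          (L , 0≤L , la) = eval-bound a m ; (L′ , 0≤L′ , lb) = eval-bound b m in
      -- From pq - p′q′ = p(q - q′) + (p - p′)q′, which is why bounds accompany the Lipschitz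
      -- constants.
      L * K′ + K * L′ , 0≤L *≥0 0≤K′ +≥0 0≤K *≥0 0≤L′ , λ {r} {r′} {δ} r∈ r′∈ close →
        product (la r∈) (lb r′∈) (ka r∈ r′∈ close) (kb r∈ r′∈ close)
      where
      product : ∀ {p p′ q q′ L L′ K K′ δ} → p ≤± L → q′ ≤± L′ → p - p′ ≤± K * δ → q - q′ ≤± K′ * δ →
        p * q - p′ * q′ ≤± (L * K′ + K * L′) * δ
      product {p} {p′} {q} {q′} {L} {L′} {K} {K′} {δ} bp bq dp dq = ≤±-resp
        (solve 4 (λ p p′ q q′ → p :* (q :- q′) :+ (p :- p′) :* q′ :≡ p :* q :- p′ :* q′) refl p p′ q q′)
        (solve 5 (λ L L′ K K′ δ → L :* (K′ :* δ) :+ K :* δ :* L′ :≡ (L :* K′ :+ K :* L′) :* δ) refl L L′ K K′ δ)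
        (bp *± dq +± dp *± bq)
    eval-lipschitz (⊝ a) m = let (K , 0≤K , ka) = eval-lipschitz a m in
      K , 0≤K , λ {r} {r′} r∈ r′∈ close → ≤±-resp
        (solve 2 (λ a a′ → :- (a :- a′) :≡ (:- a) :- (:- a′)) refl (evalAt a r) (evalAt a r′)) refl (≤±-neg (ka r∈ r′∈ close))

    field-lipschitz : ∀ (e : Vector Term N) → LocallyLipschitz (λ r i → evalAt (e i) r)
    field-lipschitz e = record
      { bound = λ m → let b = λ i → eval-bound (e i) m
                          0≤ = λ i → proj₁ (proj₂ (b i)) in
          -- The sum of the componentwise constants serves as a common bound in place of their
          -- maximum.
          sum (λ i → proj₁ (b i)) , VectorMeanValue.sum-nonneg (lower-em em) ℝ 0≤ ,
          λ r∈ i → ≤±-weaken (component-≤-sum 0≤ i) (proj₂ (proj₂ (b i)) r∈)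
      ; lipschitz = λ m → let k = λ i → eval-lipschitz (e i) m
                              0≤ = λ i → proj₁ (proj₂ (k i)) in
          sum (λ i → proj₁ (k i)) , VectorMeanValue.sum-nonneg (lower-em em) ℝ 0≤ ,
          λ {r} {r′} {δ} r∈ r′∈ close i → ≤±-weaken
            (≤-resp (*-comm _ _) (*-comm _ _) (*-monoˡ-≤ (≤±-nonneg (close i)) (component-≤-sum 0≤ i)))
            (proj₂ (proj₂ (k i)) r∈ r′∈ close)
      }

    rename-semantics : ∀ (τ : 𝒳 → 𝒳) e σ → ⟦ rename τ e ⟧ᵗ σ ≈ ⟦ e ⟧ᵗ (σ ∘ τ)
    rename-semantics τ (var v) σ = refl
    rename-semantics τ (con q) σ = refl
    rename-semantics τ (a ⊕ b) σ = +-cong (rename-semantics τ a σ) (rename-semantics τ b σ)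
    rename-semantics τ (a ⊗ b) σ = *-cong (rename-semantics τ a σ) (rename-semantics τ b σ)
    rename-semantics τ (⊝ a)   σ = -‿cong (rename-semantics τ a σ)

    AgreeOffx : Term → State → Set
    AgreeOffx e σ = ∀ {v} → v ∈ˡ varsᵗ e → (∀ i → x i ≢ v) → σ v ≈ ω v

    eval-coincidence : ∀ e {σ} → AgreeOffx e σ → ⟦ e ⟧ᵗ σ ≈ evalAt e (σ ∘ x)
    eval-coincidence e {σ} ag = term-coincidence e id λ {v} v∈ → at v v∈ (look v)
      where
      at : ∀ v → v ∈ˡ varsᵗ e → Lookup v → σ v ≈ (ω [ x ↦* σ ∘ x ]) v
      at v v∈ (on i xi≡v upd _) = trans (reflexive (≡.cong σ (≡.sym xi≡v))) (reflexive (≡.sym (upd ω (σ ∘ x))))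
      at v v∈ (off ∉x upd _)    = trans (ag v∈ ∉x) (reflexive (≡.sym (upd ω (σ ∘ x))))

    -- As z does not occur in e, the exchange moves no variable of e outside x and so acts as the
    -- substitution of z for x.
    eval-exchange : ∀ e (z : Vector 𝒳 N) {σ} → (∀ i → z i ∉ˡ varsᵗ e) → AgreeOffx e σ →
      ⟦ rename (exchange x z) e ⟧ᵗ σ ≈ evalAt e (σ ∘ z)
    eval-exchange e z {σ} fresh ag = trans (rename-semantics (exchange x z) e σ)
      (term-coincidence e id λ {v} v∈ → at v v∈ (look v))
      where
      at : ∀ v → v ∈ˡ varsᵗ e → Lookup v → σ (exchange x z v) ≈ (ω [ x ↦* σ ∘ z ]) v
      at v v∈ (on i _ upd exch)  = trans (reflexive (≡.cong σ (exch z))) (reflexive (≡.sym (upd ω (σ ∘ z))))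
      at v v∈ (off ∉x upd exch)  = trans (reflexive (≡.cong σ (exch z λ { i ≡.refl → fresh i v∈ })))
        (trans (ag v∈ ∉x) (reflexive (≡.sym (upd ω (σ ∘ z)))))

    eval-cong : ∀ e {r r′} → (∀ i → r i ≈ r′ i) → evalAt e r ≈ evalAt e r′
    eval-cong e {r} {r′} r≈r′ = term-coincidence {U} e _ λ {v} _ → at v (look v)
      where
      at : ∀ v → Lookup v → (ω [ x ↦* r ]) v ≈ (ω [ x ↦* r′ ]) v
      at v (on i _ upd _)  = trans (reflexive (upd ω r)) (trans (r≈r′ i) (reflexive (≡.sym (upd ω r′))))
      at v (off _ upd _)   = reflexive (≡.trans (upd ω r) (≡.sym (upd ω r′)))

    module _ {D : Pred Carrier 0ℓ} {s : Carrier} {γ : Carrier → Vector Carrier N}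
      (γ-cont : ∀ i → Cont D s (λ s → γ s i)) where

      eval-cont : ∀ e → Cont D s (λ s → evalAt e (γ s))
      eval-cont (var v) = from (look v)
        where
        from : Lookup v → Cont D s (λ s → evalAt (var v) (γ s))
        from (on i _ upd _) = lim-resp (λ {s} _ → reflexive (≡.sym (upd ω (γ s)))) (reflexive (≡.sym (upd ω (γ s)))) (γ-cont i)
        from (off _ upd _)  = lim-resp (λ {s} _ → reflexive (≡.sym (upd ω (γ s)))) (reflexive (≡.sym (upd ω (γ s)))) (lim-const (ω v))
      eval-cont (con q) = lim-const (fromℚ q)
      eval-cont (a ⊕ b) = lim-+ (eval-cont a) (eval-cont b)
      eval-cont (a ⊗ b) = lim-* (eval-cont a) (eval-cont b)
      eval-cont (⊝ a)   = lim-neg (eval-cont a)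

      -- The derivative of e in the direction f. When e is a component of θ and f is the field along
      -- the curve, it is the value of the corresponding component of `hat`.
      gradient : Term → Vector Carrier N → Carrier
      gradient e f = sum (λ i → evalAt (∂ (x i) e) (γ s) * f i)

      module _ (distinct : Distinct x) (f : Vector Carrier N) (γ-diff : ∀ i → Diff D s (λ s → γ s i) (f i)) where

        ∂-var-same : ∀ {w v} → w ≡ v → ∀ σ → ⟦ ∂ w (var v) ⟧ᵗ σ ≈ 1#
        ∂-var-same {w} {v} w≡v σ with w ≟ v
        ... | yes _  = fromℚ-1
        ... | no w≢v = contradiction w≡v w≢v

        ∂-var-other : ∀ {w v} → w ≢ v → ∀ σ → ⟦ ∂ w (var v) ⟧ᵗ σ ≈ 0#
        ∂-var-other {w} {v} w≢v σ with w ≟ v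
        ... | yes w≡v = contradiction w≡v w≢v
        ... | no _    = fromℚ-0

        gradient-0 : ∀ e → (∀ i → evalAt (∂ (x i) e) (γ s) ≈ 0#) → 0# ≈ gradient e f
        gradient-0 e ∂≈0 = sym (trans (sum-cong-≋ λ i → trans (*-congʳ (∂≈0 i)) (zeroˡ _)) (sum-replicate-zero N))

        chain-rule : ∀ e → Diff D s (λ s → evalAt e (γ s)) (gradient e f)
        chain-rule (var v) = from (look v)
          where
          from : Lookup v → Diff D s (λ s → evalAt (var v) (γ s)) (gradient (var v) f)
          -- Distinctness of x ensures that exactly one partial derivative of the variable is 1, so
          -- the sum reduces to the component i.
          from (on i xi≡v upd _) = diff-resp {f = λ s → γ s i} (λ {s} _ → reflexive (≡.sym (upd ω (γ s)))) (reflexive (≡.sym (upd ω (γ s))))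
            (sym (trans (sum-single _ i λ j j≢i → trans (*-congʳ (∂-var-other (λ xj≡v → j≢i (distinct (≡.trans xj≡v (≡.sym xi≡v)))) _)) (zeroˡ _))
              (trans (*-congʳ (∂-var-same xi≡v _)) (*-identityˡ _))))
            (γ-diff i)
          from (off ∉x upd _) = diff-resp {f = const (ω v)} (λ {s} _ → reflexive (≡.sym (upd ω (γ s)))) (reflexive (≡.sym (upd ω (γ s))))
            (gradient-0 (var v) λ i → ∂-var-other (∉x i) _) (diff-const (ω v))
        chain-rule (con q) = lim-resp (λ _ → refl) (gradient-0 (con q) λ _ → fromℚ-0) (diff-const (fromℚ q))
        chain-rule (a ⊕ b) = lim-resp (λ _ → refl)
          (sym (trans (sum-cong-≋ λ i → distribʳ (f i) _ _) (∑-distrib-+ (λ i → evalAt (∂ (x i) a) (γ s) * f i) (λ i → evalAt (∂ (x i) b) (γ s) * f i))))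
          (diff-+ (chain-rule a) (chain-rule b))
        chain-rule (a ⊗ b) = lim-resp (λ _ → refl)
          (sym (trans (sum-cong-≋ λ i → solve 5 (λ p b a q f → (p :* b :+ a :* q) :* f :≡ p :* f :* b :+ a :* (q :* f)) refl
              (evalAt (∂ (x i) a) (γ s)) (evalAt b (γ s)) (evalAt a (γ s)) (evalAt (∂ (x i) b) (γ s)) (f i))
            (trans (∑-distrib-+ (λ i → evalAt (∂ (x i) a) (γ s) * f i * evalAt b (γ s)) (λ i → evalAt a (γ s) * (evalAt (∂ (x i) b) (γ s) * f i)))
              (+-cong (sym (*-distribʳ-sum (evalAt b (γ s)) (λ i → evalAt (∂ (x i) a) (γ s) * f i)))
                      (sym (*-distribˡ-sum (evalAt a (γ s)) (λ i → evalAt (∂ (x i) b) (γ s) * f i)))))))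
          (diff-* (eval-cont a) (chain-rule a) (chain-rule b))
        chain-rule (⊝ a) = lim-resp (λ _ → refl)
          (trans (trans (solve 1 (λ g → :- g :≡ (:- :con (+ 1)) :* g) refl (gradient a f))
              (*-distribˡ-sum (- 1#) (λ i → evalAt (∂ (x i) a) (γ s) * f i)))
            (sum-cong-≋ λ i → solve 2 (λ p f → (:- :con (+ 1)) :* (p :* f) :≡ (:- p) :* f) refl (evalAt (∂ (x i) a) (γ s)) (f i)))
          (diff-neg (chain-rule a))

-- Quantifier blocks, norm formulas and freshness

unique-++⁻ : ∀ {A : Set} (xs : List A) {ys} → Unique (xs ++ ys) → Unique xs × Unique ys × Disjoint xs ys
unique-++⁻ []       u       = [] , u , λ ()
unique-++⁻ (x ∷ xs) (p ∷ u) = let (uxs , uys , disjoint) = unique-++⁻ xs u in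
  All.++⁻ˡ xs p ∷ uxs , uys , λ
    { (here ≡.refl , v∈ys) → All.lookup (All.++⁻ʳ xs p) v∈ys ≡.refl
    ; (there v∈xs , v∈ys)  → disjoint (v∈xs , v∈ys) }

unique-tabulate⁻ : ∀ {A : Set} {n} (f : Fin n → A) → Unique (tabulate f) → Injective _≡_ _≡_ f
unique-tabulate⁻ f (p ∷ u) {zero}  {zero}  eq = ≡.refl
unique-tabulate⁻ f (p ∷ u) {zero}  {suc j} eq = contradiction eq (All.lookup p (∈-tabulate⁺ j))
unique-tabulate⁻ f (p ∷ u) {suc i} {zero}  eq = contradiction (≡.sym eq) (All.lookup p (∈-tabulate⁺ i))
unique-tabulate⁻ f (p ∷ u) {suc i} {suc j} eq = ≡.cong suc (unique-tabulate⁻ (f ∘ suc) u eq)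

module FormulaSemantics (em : ExcludedMiddle (lsuc 0ℓ)) (ℝ : CompleteOrderedField) (Vars : Variables) where
  open CompleteOrderedField ℝ hiding (zero)
  open Variables Vars
  open Syntax Vars
  open Semantics ℝ Vars
  open OrderedField (lower-em em) ℝ renaming (_:=_ to _:≡_; con to :con)
  open VectorMeanValue (lower-em em) ℝ using (dot; sum-nonneg)
  open Bisection (lower-em em) ℝ using (Box)
  open Valuations em ℝ Vars
  open TermSemantics em ℝ Vars
  open SemiringSum semiring using (sum; sum-cong-≋)

  SameOff : ∀ {n} → Vector 𝒳 n → State → State → Set
  SameOff x ν ω = ∀ v → (∀ i → x i ≢ v) → ν v ≈ ω v

  ↦-same : ∀ {ω r} x → (ω [ x ↦ r ]) x ≈ r
  ↦-same x with x ≟ x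
  ... | yes _  = refl
  ... | no x≢x = contradiction ≡.refl x≢x

  ↦-other : ∀ {ω r x v} → x ≢ v → (ω [ x ↦ r ]) v ≈ ω v
  ↦-other {x = x} {v} x≢v with x ≟ v
  ... | yes x≡v = contradiction x≡v x≢v
  ... | no _    = refl

  ↦*-on : ∀ {n ω} {x : Vector 𝒳 n} (r : Vector Carrier n) → Distinct x → ∀ i → (ω [ x ↦* r ]) (x i) ≈ r i
  ↦*-on {x = x} r distinct i with any? (λ j → x j ≟ x i)
  ... | yes (j , xj≡xi) = reflexive (≡.cong r (distinct xj≡xi))
  ... | no ∉x           = contradiction (i , ≡.refl) ∉x

  ↦*-off : ∀ {n ω} (x : Vector 𝒳 n) {r : Vector Carrier n} → SameOff x (ω [ x ↦* r ]) ω
  ↦*-off x v ∉x with any? (λ j → x j ≟ v)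
  ... | yes (j , xj≡v) = contradiction xj≡v (∉x j)
  ... | no _           = refl

  ∃*-elim : ∀ {n} (z : Vector 𝒳 n) {φ V ω} → ⟦ ∃* z φ ⟧ V ω → ∃ λ ν → SameOff z ν ω × ⟦ φ ⟧ V ν
  ∃*-elim {zero}  z h = _ , (λ _ _ → refl) , h
  ∃*-elim {suc n} z {φ} (μ , (r , μ≈) , h) = let (ν , same , h′) = ∃*-elim (z ∘ suc) {φ} h in
    ν , (λ v ∉z → trans (same v (∉z ∘ suc)) (trans (μ≈ v) (↦-other (∉z zero)))) , h′

  ∃*-intro : ∀ {n} (z : Vector 𝒳 n) φ {V ω ν} → SameOff z ν ω → ⟦ φ ⟧ V ν → ⟦ ∃* z φ ⟧ V ω
  ∃*-intro {zero}  z φ same h = semantics-resp φ (λ v → same v λ ()) h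
  ∃*-intro {suc n} z φ {V} {ω} {ν} same h = ω [ z zero ↦ ν (z zero) ] , (ν (z zero) , λ _ → refl) ,
    ∃*-intro (z ∘ suc) φ same′ h
    where
    same′ : SameOff (z ∘ suc) ν (ω [ z zero ↦ ν (z zero) ])
    same′ v ∉z with z zero ≟ v
    ... | yes ≡.refl = refl
    ... | no z₀≢v    = same v λ { zero → z₀≢v ; (suc i) → ∉z i }

  module Assignment {N} (x y : Vector 𝒳 N) (x≢y : ∀ i j → x i ≢ y j) where

    -- For `id` this is the assignment of whole tuples. Letting the indices vary makes the remaining
    -- assignments an instance of the same notion, as induction requires.
    assign : ∀ {n} → Vector (Fin N) n → Formula → Formula
    assign e φ = foldr (λ i ψ → ⟨ x i := var (y i) ⟩ ψ) φ e

    wellFormed-assign : ∀ {n} (e : Vector (Fin N) n) {φ} → WellFormed φ → WellFormed (assign e φ)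
    wellFormed-assign {zero}  e wf = wf
    wellFormed-assign {suc n} e wf = wellFormed-assign (e ∘ suc) wf

    mentions-assign : ∀ {n L} (e : Vector (Fin N) n) {φ} → Mentions L (assign e φ) → Mentions L φ
    mentions-assign {zero}  e m = m
    mentions-assign {suc n} e m = mentions-assign (e ∘ suc) m

    Assigned : ∀ {n} → Vector (Fin N) n → State → State → Set
    Assigned e ω ν = (∀ k → ν (x (e k)) ≈ ω (y (e k))) × SameOff (x ∘ e) ν ω

    -- The assignments are executed one by one but act simultaneously: no target occurs among the
    -- sources, and injectivity prevents a value from being overwritten.
    assign-elim : ∀ {n} (e : Vector (Fin N) n) → Injective _≡_ _≡_ (x ∘ e) → ∀ {φ V ω} →
      ⟦ assign e φ ⟧ V ω → ∃ λ ν → Assigned e ω ν × ⟦ φ ⟧ V ν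
    assign-elim {zero}  e inj h = _ , ((λ ()) , λ _ _ → refl) , h
    assign-elim {suc n} e inj {φ} {V} {ω} (μ , μ≈ , h) =
      let (ν , (on , off) , h′) = assign-elim (e ∘ suc) (λ eq → suc-injective (inj eq)) {φ} h in
      ν , ((λ { zero    → trans (off (x (e zero)) (λ k eq → contradiction (inj eq) λ ())) (trans (μ≈ _) (↦-same (x (e zero))))
              ; (suc k) → trans (on k) (trans (μ≈ _) (↦-other (x≢y _ _))) }) ,
           λ v ∉x → trans (off v (∉x ∘ suc)) (trans (μ≈ v) (↦-other (∉x zero)))) , h′

    assign-intro : ∀ {n} (e : Vector (Fin N) n) φ {V ω ν} → Assigned e ω ν → ⟦ φ ⟧ V ν → ⟦ assign e φ ⟧ V ω
    assign-intro {zero}  e φ (_ , off) h = semantics-resp φ (λ v → off v λ ()) h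
    assign-intro {suc n} e φ {V} {ω} {ν} (on , off) h = ω [ x (e zero) ↦ ω (y (e zero)) ] , (λ _ → refl) ,
      assign-intro (e ∘ suc) φ ((λ k → trans (on (suc k)) (sym (↦-other (x≢y _ _)))) , off′) h
      where
      off′ : SameOff (x ∘ e ∘ suc) ν (ω [ x (e zero) ↦ ω (y (e zero)) ])
      off′ v ∉x with x (e zero) ≟ v
      ... | yes ≡.refl = on zero
      ... | no x₀≢v    = off v λ { zero → x₀≢v ; (suc i) → ∉x i }

  dot-cong : ∀ {n} {a b c d : Vector Carrier n} → (∀ i → a i ≈ b i) → (∀ i → c i ≈ d i) → dot a c ≈ dot b d
  dot-cong a≈b c≈d = sum-cong-≋ λ i → *-cong (a≈b i) (c≈d i)

  square-≤⇒≤± : ∀ {a m} → 0# ≤ m → a * a ≤ m * m → a ≤± m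
  square-≤⇒≤± {a} {m} 0≤m aa≤mm = nonneg⇒≤ (≤⇒nonneg (upper (- a) (≤-resp (solve 1 (λ a → a :* a :≡ (:- a) :* (:- a)) refl a) refl aa≤mm)))
      (solve 2 (λ a m → a :- (:- m) :≡ m :- (:- a)) refl a m) , upper a aa≤mm
    where
    upper : ∀ a → a * a ≤ m * m → a ≤ m
    upper a aa≤mm = [ id , (λ m<a → contradiction aa≤mm (<⇒≱ (pos⇒<
        (*-pos (<⇒pos m<a) (<-≤-trans (≤-<-trans 0≤m m<a) (≤-+ 0≤m)))
        (solve 2 (λ a m → a :* a :- m :* m :≡ (a :- m) :* (a :+ m)) refl a m)))) ]′ (≤-or-> a m)

  component-≤-norm : ∀ {n} (a : Vector Carrier n) i → a i * a i ≤ dot a a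
  component-≤-norm a i = component-≤-sum (λ i → square-nonneg (a i)) i

  norm≤⇒Box : ∀ {n m} {a : Vector Carrier n} → 0# ≤ m → dot a a ≤ m * m → Box m a
  norm≤⇒Box {a = a} 0≤m aa≤mm i = square-≤⇒≤± 0≤m (≤-trans (component-≤-norm a i) aa≤mm)

  -- Avoids a square root: for s = n B² one has s ≤ (1 + s)², so 1 + s bounds the norm.
  Box⇒norm≤ : ∀ {n} B → ∃ λ S → 0# ≤ S × (∀ {b : Vector Carrier n} → Box B b → dot b b ≤ S * S)
  Box⇒norm≤ {n} B = 1# + s , 0≤1 +≥0 0≤s , λ {b} b∈ → ≤-trans (sum-mono (λ i → proj₂ (b∈ i *± b∈ i)))
    (nonneg⇒≤ (0≤1 +≥0 0≤s +≥0 0≤s *≥0 0≤s)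
      (solve 1 (λ s → (:con (+ 1) :+ s) :* (:con (+ 1) :+ s) :- s :≡ :con (+ 1) :+ s :+ s :* s) refl s))
    where
    s : Carrier
    s = sum {n} (λ _ → B * B)
    0≤s : 0# ≤ s
    0≤s = sum-nonneg {n} (λ _ → square-nonneg B)
    sum-mono : ∀ {n} {f g : Vector Carrier n} → (∀ i → f i ≤ g i) → sum f ≤ sum g
    sum-mono {zero}  f≤g = ≤-refl
    sum-mono {suc n} f≤g = +-mono-≤ (f≤g zero) (sum-mono (f≤g ∘ suc))

  ∥∥≤-elim : ∀ {n} (a : Vector Term n) m {V σ} → ⟦ ∥ a ∥≤ m ⟧ V σ →
    0# ≤ ⟦ m ⟧ᵗ σ × dot (λ i → ⟦ a i ⟧ᵗ σ) (λ i → ⟦ a i ⟧ᵗ σ) ≤ ⟦ m ⟧ᵗ σ * ⟦ m ⟧ᵗ σ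
  ∥∥≤-elim a m {σ = σ} (lift 0≤m , lift aa≤mm) = ≤-resp fromℚ-0 refl 0≤m , ≤-resp (normSq-semantics a σ) refl aa≤mm

  ∥∥≤-intro : ∀ {n} (a : Vector Term n) m {V σ} {A : Vector Carrier n} → (∀ i → ⟦ a i ⟧ᵗ σ ≈ A i) →
    0# ≤ ⟦ m ⟧ᵗ σ → dot A A ≤ ⟦ m ⟧ᵗ σ * ⟦ m ⟧ᵗ σ → ⟦ ∥ a ∥≤ m ⟧ V σ
  ∥∥≤-intro a m {σ = σ} a≈A 0≤m AA≤mm = lift (≤-resp (sym fromℚ-0) refl 0≤m) ,
    lift (≤-resp (sym (trans (normSq-semantics a σ) (dot-cong a≈A a≈A))) refl AA≤mm)

  weighted-intro : ∀ {n} k (a : Vector Term n) c (b : Vector Term n) {V σ K C} {A B : Vector Carrier n} →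
    fromℚ k ≈ K → (∀ i → ⟦ a i ⟧ᵗ σ ≈ A i) → ⟦ c ⟧ᵗ σ ≈ C → (∀ i → ⟦ b i ⟧ᵗ σ ≈ B i) →
    0# ≤ C → K * K * dot A A ≤ C * C * dot B B → ⟦ k ·∥ a ∥≤ c ·∥ b ∥ ⟧ V σ
  weighted-intro k a c b {σ = σ} k≈K a≈A c≈C b≈B 0≤C KA≤CB = inj₁
    (lift (≤-resp (sym fromℚ-0) (sym c≈C) 0≤C) ,
     lift (≤-resp (sym (*-cong (*-cong k≈K k≈K) (trans (normSq-semantics a σ) (dot-cong a≈A a≈A))))
                  (sym (*-cong (*-cong c≈C c≈C) (trans (normSq-semantics b σ) (dot-cong b≈B b≈B)))) KA≤CB))

  -- Passes from the Euclidean norm to components, by (k aᵢ)² ≤ k²|a|² ≤ c²|b|² ≤ (c S)². In the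
  -- second disjunct the vector a vanishes.
  weighted-elim : ∀ {n} k (a : Vector Term n) c (b : Vector Term n) {V σ S} {B : Vector Carrier n} →
    (∀ i → ⟦ b i ⟧ᵗ σ ≈ B i) → 0# ≤ ⟦ c ⟧ᵗ σ → 0# ≤ S → dot B B ≤ S * S →
    ⟦ k ·∥ a ∥≤ c ·∥ b ∥ ⟧ V σ → ∀ i → fromℚ k * ⟦ a i ⟧ᵗ σ ≤± ⟦ c ⟧ᵗ σ * S
  weighted-elim k a c b {σ = σ} {S} {B} b≈B 0≤c 0≤S BB≤SS (inj₁ (_ , lift kA≤cB)) i =
    square-≤⇒≤± (0≤c *≥0 0≤S) (≤-trans
      (≤-resp (solve 2 (λ k a → k :* k :* (a :* a) :≡ k :* a :* (k :* a)) refl (fromℚ k) (⟦ a i ⟧ᵗ σ)) refl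
        (*-monoˡ-≤ (square-nonneg (fromℚ k)) (component-≤-norm (λ i → ⟦ a i ⟧ᵗ σ) i)))
      (≤-trans (≤-resp (*-congˡ (normSq-semantics a σ))
                       (*-congˡ (trans (normSq-semantics b σ) (dot-cong b≈B b≈B))) kA≤cB)
        (≤-resp refl (solve 2 (λ c s → c :* c :* (s :* s) :≡ c :* s :* (c :* s)) refl (⟦ c ⟧ᵗ σ) S)
          (*-monoˡ-≤ (square-nonneg (⟦ c ⟧ᵗ σ)) BB≤SS))))
  weighted-elim k a c b {σ = σ} b≈B 0≤c 0≤S BB≤SS (inj₂ (lift aa≤0 , _)) i =
    ≈0⇒≤± (trans (*-congˡ (≤±0⇒≈0 (square-≤⇒≤± ≤-refl (≤-trans (component-≤-norm (λ i → ⟦ a i ⟧ᵗ σ) i)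
      (≤-resp (normSq-semantics a σ) (trans fromℚ-0 (sym (zeroˡ 0#))) aa≤0))))) (zeroʳ _)) (0≤c *≥0 0≤S)

  wellFormed-∃* : ∀ {n} (z : Vector 𝒳 n) {φ} → WellFormed φ → WellFormed (∃* z φ)
  wellFormed-∃* {zero}  z wf = wf
  wellFormed-∃* {suc n} z wf = wellFormed-∃* (z ∘ suc) wf

  mentions-∃* : ∀ {n L} (z : Vector 𝒳 n) {φ} → Mentions L (∃* z φ) → Mentions L φ
  mentions-∃* {zero}  z m = m
  mentions-∃* {suc n} z m = mentions-∃* (z ∘ suc) m

  record Apart {N} (x : Vector 𝒳 N) (θ : Vector Term N) (φ : Formula)
               (y z u : Vector 𝒳 N) (t M : 𝒳) : Set where
    field
      y-distinct : Distinct y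
      z-distinct : Distinct z
      u-distinct : Distinct u
      x≢y        : ∀ i j → x i ≢ y j
      x≢z        : ∀ i j → x i ≢ z j
      x≢u        : ∀ i j → x i ≢ u j
      y≢z        : ∀ i j → y i ≢ z j
      y≢u        : ∀ i j → y i ≢ u j
      x≢t        : ∀ i → x i ≢ t
      y≢t        : ∀ i → y i ≢ t
      z≢t        : ∀ i → z i ≢ t
      u≢t        : ∀ i → u i ≢ t
      x≢M        : ∀ i → x i ≢ M
      y≢M        : ∀ i → y i ≢ M
      z≢M        : ∀ i → z i ≢ M
      u≢M        : ∀ i → u i ≢ M
      t≢M        : t ≢ M
      y∉θ        : ∀ i → y i ∉ˡ varsᵗ* θ
      z∉θ        : ∀ i → z i ∉ˡ varsᵗ* θ
      u∉θ        : ∀ i → u i ∉ˡ varsᵗ* θ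
      t∉θ        : t ∉ˡ varsᵗ* θ
      M∉θ        : M ∉ˡ varsᵗ* θ
      y∉φ        : ∀ i → y i ∉ˡ vars φ

  fresh⇒apart : ∀ {N} {x : Vector 𝒳 N} {θ φ y z u t M} → Fresh x θ φ y z u t M → Apart x θ φ y z u t M
  fresh⇒apart {x = x} {θ} {φ} {y} {z} {u} {t} {M} fresh = separate
    (unique-++⁻ (toList y) unique)
    where
    open Fresh fresh
    y∈ : ∀ i → y i ∈ˡ new
    y∈ i = ∈-++⁺ˡ (∈-tabulate⁺ i)
    z∈ : ∀ i → z i ∈ˡ new
    z∈ i = ∈-++⁺ʳ (toList y) (∈-++⁺ˡ (∈-tabulate⁺ i))
    u∈ : ∀ i → u i ∈ˡ new
    u∈ i = ∈-++⁺ʳ (toList y) (∈-++⁺ʳ (toList z) (∈-++⁺ˡ (∈-tabulate⁺ i)))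
    t∈ : t ∈ˡ new
    t∈ = ∈-++⁺ʳ (toList y) (∈-++⁺ʳ (toList z) (∈-++⁺ʳ (toList u) (here ≡.refl)))
    M∈ : M ∈ˡ new
    M∈ = ∈-++⁺ʳ (toList y) (∈-++⁺ʳ (toList z) (∈-++⁺ʳ (toList u) (there (here ≡.refl))))
    x≢ : ∀ {v} → v ∈ˡ new → ∀ i → x i ≢ v
    x≢ v∈ i ≡.refl = disjoint (v∈ , ∈-++⁺ˡ (∈-tabulate⁺ i))
    ∉θ : ∀ {v} → v ∈ˡ new → v ∉ˡ varsᵗ* θ
    ∉θ v∈ v∈θ = disjoint (v∈ , ∈-++⁺ʳ (toList x) (∈-++⁺ˡ v∈θ))
    ∉φ : ∀ {v} → v ∈ˡ new → v ∉ˡ vars φ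
    ∉φ v∈ v∈φ = disjoint (v∈ , ∈-++⁺ʳ (toList x) (∈-++⁺ʳ (varsᵗ* θ) v∈φ))

    separate : Unique (toList y) × Unique (toList z ++ toList u ++ t ∷ M ∷ []) ×
      Disjoint (toList y) (toList z ++ toList u ++ t ∷ M ∷ []) → Apart x θ φ y z u t M
    separate (uy , rest , y#) = separate-z (unique-++⁻ (toList z) rest)
      where
      separate-z : Unique (toList z) × Unique (toList u ++ t ∷ M ∷ []) ×
        Disjoint (toList z) (toList u ++ t ∷ M ∷ []) → Apart x θ φ y z u t M
      separate-z (uz , rest , z#) = separate-u (unique-++⁻ (toList u) rest)
        where
        separate-u : Unique (toList u) × Unique (t ∷ M ∷ []) × Disjoint (toList u) (t ∷ M ∷ []) → Apart x θ φ y z u t M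
        separate-u (uu , (t≢M All.∷ _) ∷ _ , u#) = record
          { y-distinct = unique-tabulate⁻ y uy
          ; z-distinct = unique-tabulate⁻ z uz
          ; u-distinct = unique-tabulate⁻ u uu
          ; x≢y = λ i j → x≢ (y∈ j) i
          ; x≢z = λ i j → x≢ (z∈ j) i
          ; x≢u = λ i j → x≢ (u∈ j) i
          ; y≢z = λ i j eq → y# (∈-tabulate⁺ i , ≡.subst (_∈ˡ _) (≡.sym eq) (∈-++⁺ˡ (∈-tabulate⁺ j)))
          ; y≢u = λ i j eq → y# (∈-tabulate⁺ i , ≡.subst (_∈ˡ _) (≡.sym eq) (∈-++⁺ʳ (toList z) (∈-++⁺ˡ (∈-tabulate⁺ j))))
          ; x≢t = x≢ t∈
          ; y≢t = λ i eq → y# (∈-tabulate⁺ i , ≡.subst (_∈ˡ _) (≡.sym eq) (∈-++⁺ʳ (toList z) (∈-++⁺ʳ (toList u) (here ≡.refl))))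
          ; z≢t = λ i eq → z# (∈-tabulate⁺ i , ≡.subst (_∈ˡ _) (≡.sym eq) (∈-++⁺ʳ (toList u) (here ≡.refl)))
          ; u≢t = λ i eq → u# (∈-tabulate⁺ i , ≡.subst (_∈ˡ _) (≡.sym eq) (here ≡.refl))
          ; x≢M = x≢ M∈
          ; y≢M = λ i eq → y# (∈-tabulate⁺ i , ≡.subst (_∈ˡ _) (≡.sym eq) (∈-++⁺ʳ (toList z) (∈-++⁺ʳ (toList u) (there (here ≡.refl)))))
          ; z≢M = λ i eq → z# (∈-tabulate⁺ i , ≡.subst (_∈ˡ _) (≡.sym eq) (∈-++⁺ʳ (toList u) (there (here ≡.refl))))
          ; u≢M = λ i eq → u# (∈-tabulate⁺ i , ≡.subst (_∈ˡ _) (≡.sym eq) (there (here ≡.refl)))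
          ; t≢M = t≢M
          ; y∉θ = λ i → ∉θ (y∈ i)
          ; z∉θ = λ i → ∉θ (z∈ i)
          ; u∉θ = λ i → ∉θ (u∈ i)
          ; t∉θ = ∉θ t∈
          ; M∉θ = ∉θ M∈
          ; y∉φ = λ i → ∉φ (y∈ i)
          }

-- The two implications of the axiom

module Soundness (em : ExcludedMiddle (lsuc 0ℓ)) (ℝ : CompleteOrderedField) (Vars : Variables) where
  open CompleteOrderedField ℝ hiding (zero)
  open Variables Vars
  open Syntax Vars
  open Semantics ℝ Vars
  open StateSet
  open OrderedField (lower-em em) ℝ renaming (_:=_ to _:≡_; con to :con)
  open Limits (lower-em em) ℝ
  open Calculus (lower-em em) ℝ renaming (⟦_,_⟧ to Closed; ⟨_,_⟩ to Open)
  open Bisection (lower-em em) ℝ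
  open VectorMeanValue (lower-em em) ℝ
  open Fixpoints em ℝ Vars
  open Coincidence em ℝ Vars
  open Valuations em ℝ Vars
  open TermSemantics em ℝ Vars
  open FormulaSemantics em ℝ Vars
  open SemiringSum semiring using (sum-cong-≋; sum-replicate-zero)

  module _ (φ : Formula) (dlμ : IsDLμ φ) {N} (x : Vector 𝒳 N) (distinct : Distinct x) (θ : Vector Term N)
           (y z u : Vector 𝒳 N) (t M : 𝒳) (X : 𝒱) (apart : Apart x θ φ y z u t M) where
    open Apart apart
    open Axiom x θ y z u t M X
    open Substitution using (evalAt; field-lipschitz; eval-coincidence; eval-exchange; eval-cong; eval-cont; chain-rule)

    region : Formula
    region = ∃* y (⟨ x :=⃗ y ⟩ φ ∧ ∃ᵘ t (con 0ℚ ≤ᶠ var t ∧ ∃ᵘ M (var M >0ᶠ ∧ (ν[ prop X ] ρ))))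

    evolves : Formula
    evolves = ⟨ (x , distinct) ′= θ & trueᶠ ⟩ φ

    -- Variables of θ outside x are constants of the field. Keeping their values from ω lets one
    -- field F describe every state met in the unfolding.
    SameParameters : State → State → Set
    SameParameters σ ω = ∀ {v} → v ∈ˡ varsᵗ* θ → (∀ i → x i ≢ v) → σ v ≈ ω v

    y≢θ : ∀ {v} → v ∈ˡ varsᵗ* θ → ∀ i → y i ≢ v
    y≢θ v∈ i ≡.refl = y∉θ i v∈
    z≢θ : ∀ {v} → v ∈ˡ varsᵗ* θ → ∀ i → z i ≢ v
    z≢θ v∈ i ≡.refl = z∉θ i v∈
    u≢θ : ∀ {v} → v ∈ˡ varsᵗ* θ → ∀ i → u i ≢ v
    u≢θ v∈ i ≡.refl = u∉θ i v∈
    t≢θ : ∀ {v} → v ∈ˡ varsᵗ* θ → t ≢ v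
    t≢θ v∈ ≡.refl = t∉θ v∈
    M≢θ : ∀ {v} → v ∈ˡ varsᵗ* θ → M ≢ v
    M≢θ v∈ ≡.refl = M∉θ v∈
    y≢φ : ∀ {v} → v ∈ˡ vars φ → ∀ i → y i ≢ v
    y≢φ v∈ i ≡.refl = y∉φ i v∈

    module Region⇒Evolves (V : Valuation) (ω : State) (m : Carrier) (0≤m : 0# ≤ m) (D : StateSet)
      (unfold : ∀ {σ} → holds D σ → ⟦ ρ ⟧ (V [ X ↦ᵖ D ]) σ) where

      F H : Vector Carrier N → Vector Carrier N
      F r i = evalAt ω x (θ i) r
      H r i = evalAt ω x (hat x θ i) r

      F-bound = LocallyLipschitz.bound (field-lipschitz ω x θ) m
      H-bound = LocallyLipschitz.bound (field-lipschitz ω x (hat x θ)) m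

      F-norm : ∃ λ S → 0# ≤ S × (∀ {b : Vector Carrier N} → Box (proj₁ F-bound) b → dot b b ≤ S * S)
      F-norm = Box⇒norm≤ (proj₁ F-bound)

      H-norm : ∃ λ S → 0# ≤ S × (∀ {b : Vector Carrier N} → Box (proj₁ H-bound) b → dot b b ≤ S * S)
      H-norm = Box⇒norm≤ (proj₁ H-bound)

      L C : Carrier
      L = proj₁ F-norm
      C = proj₁ H-norm

      0≤L : 0# ≤ L
      0≤L = proj₁ (proj₂ F-norm)
      0≤C : 0# ≤ C
      0≤C = proj₁ (proj₂ H-norm)

      F-dot : ∀ {r} → Box m r → dot (F r) (F r) ≤ L * L
      F-dot r∈ = proj₂ (proj₂ F-norm) (proj₂ (proj₂ F-bound) r∈)
      H-dot : ∀ {r} → Box m r → dot (H r) (H r) ≤ C * C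
      H-dot r∈ = proj₂ (proj₂ H-norm) (proj₂ (proj₂ H-bound) r∈)

      -- Membership in D fixes neither the radius nor the parameters nor the sign of the duration.
      -- They are inherited from the root, since unfolding leaves M and the parameters alone and
      -- halves t.
      record IsPiece (σ : State) : Set where
        field
          in-D       : holds D σ
          parameters : SameParameters σ ω
          radius     : σ M ≈ m
          duration   : 0# ≤ σ t

      record Halves (σ : State) : Set where
        field
          σˡ σʳ     : State
          pieceˡ    : IsPiece σˡ
          pieceʳ    : IsPiece σʳ
          length-σˡ : σˡ t ≈ half (σ t)
          length-σʳ : σʳ t ≈ half (σ t)
          start-σˡ  : ∀ i → σˡ (x i) ≈ σ (x i)
          start-σʳ  : ∀ i → σʳ (x i) ≈ σˡ (y i)
          end-σʳ    : ∀ i → σʳ (y i) ≈ σ (y i)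

      module _ {σ : State} (piece : IsPiece σ) where
        open IsPiece piece

        exchange-value : ∀ e {ν} → (∀ {v} → v ∈ˡ varsᵗ e → v ∈ˡ varsᵗ* θ) → SameOff z ν σ →
          ⟦ rename (exchange x z) e ⟧ᵗ ν ≈ evalAt ω x e (ν ∘ z)
        exchange-value e ⊆θ off = eval-exchange ω x e z (λ i zi∈ → z∉θ i (⊆θ zi∈))
          λ v∈ ∉x → trans (off _ (z≢θ (⊆θ v∈))) (parameters (⊆θ v∈) ∉x)

        ball⇒Box : ∀ {ν} {w : Vector 𝒳 N} → ν M ≈ σ M → ⟦ ∥ vars* w ∥≤ var M ⟧ (V [ X ↦ᵖ D ]) ν → Box m (ν ∘ w)
        ball⇒Box {ν} {w} νM≈σM h = let (_ , ≤MM) = ∥∥≤-elim (vars* w) (var M) {V} {ν} h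
                                       νM≈m = trans νM≈σM radius in
          norm≤⇒Box 0≤m (≤-resp refl (*-cong νM≈m νM≈m) ≤MM)

        x-box : Box m (σ ∘ x)
        x-box = ball⇒Box {w = x} refl (proj₁ (proj₁ (unfold in-D)))

        y-box : Box m (σ ∘ y)
        y-box = ball⇒Box {w = y} refl (proj₂ (proj₁ (unfold in-D)))

        chord : ∀ i → σ (y i) - σ (x i) ≤± L * σ t
        chord i =
          let (ν , off , ball , h) = ∃*-elim z (proj₁ (proj₂ (unfold in-D)))
              t≈ = off t z≢t
              z∈ = ball⇒Box {w = z} (off M z≢M) ball
          in ≤±-resp
               (trans (*-congʳ fromℚ-1) (trans (*-identityˡ _) (+-cong (off _ (λ j eq → y≢z i j (≡.sym eq))) (-‿cong (off _ (λ j eq → x≢z i j (≡.sym eq)))))))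
               (trans (*-congʳ t≈) (*-comm _ _))
               (weighted-elim 1ℚ (λ i → var (y i) ⊖ var (x i)) (var t) (θ [ x ⇄ z ]) {V} {ν}
                 (λ j → exchange-value (θ j) (varsᵗ*-⊆ θ j) off)
                 (≤-resp refl (sym t≈) duration) 0≤L (F-dot z∈) h i)

        tangency : ∀ i → σ (y i) - σ (x i) - σ t * F (σ ∘ x) i ≤± C * (σ t * σ t)
        tangency i =
          let (ν , off , ball , h) = ∃*-elim z (proj₁ (proj₂ (proj₂ (unfold in-D))))
              t≈ = off t z≢t
              z∈ = ball⇒Box {w = z} (off M z≢M) ball
              θ≈ = trans (term-coincidence (θ i) (varsᵗ*-⊆ θ i) (λ v∈ → off _ (z≢θ v∈)))
                         (eval-coincidence ω x (θ i) (λ v∈ → parameters (varsᵗ*-⊆ θ i v∈)))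
          in halve-≤± (0≤C *≥0 (duration *≥0 duration)) (≤±-resp
               (*-cong fromℚ-2 (+-cong
                 (+-cong (off _ (λ j eq → y≢z i j (≡.sym eq))) (-‿cong (off _ (λ j eq → x≢z i j (≡.sym eq)))))
                 (-‿cong (*-cong t≈ θ≈))))
               (trans (*-congʳ (*-cong t≈ t≈)) (*-comm _ _))
               (weighted-elim (+ 2 / 1) (λ i → var (y i) ⊖ var (x i) ⊖ var t ⊗ θ i) (var t ⊗ var t) (hat x θ [ x ⇄ z ]) {V} {ν}
                 (λ j → exchange-value (hat x θ j) (vars-hat x θ j) off)
                 (square-nonneg _) 0≤C (H-dot z∈) h i))
          where
          halve-≤± : ∀ {a b} → 0# ≤ b → (1# + 1#) * a ≤± b → a ≤± b
          halve-≤± {a} {b} 0≤b p = ≤±-cancelʳ 0<2 (≤±-resp (*-comm _ _) refl (≤±-weaken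
            (nonneg⇒≤ 0≤b (solve 1 (λ b → b :* :con (+ 2) :- b :≡ b) refl b)) p))

        halves : Halves σ
        halves =
          -- Both halves are obtained from one state μ in which u holds the midpoint and t is
          -- already halved; hence the right half starts where the left one ends.
          let (ν , off , μ , μ≈ , hˡ , hʳ) = ∃*-elim u (proj₂ (proj₂ (proj₂ (unfold in-D))))
              (σˡ , (onˡ , offˡ) , lift inˡ) = Assignment.assign-elim y u y≢u id y-distinct hˡ
              (σʳ , (onʳ , offʳ) , lift inʳ) = Assignment.assign-elim x u x≢u id distinct hʳ
              kept : ∀ {v} → t ≢ v → (∀ i → u i ≢ v) → μ v ≈ σ v
              kept t≢v u≢v = trans (μ≈ _) (trans (↦-other t≢v) (off _ u≢v))
              t-half : μ t ≈ half (σ t)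
              t-half = trans (μ≈ t) (trans (↦-same t) (trans (fromℚ-½ _) (*-congʳ (off t u≢t))))
              x-kept = λ i → kept (λ eq → x≢t i (≡.sym eq)) (λ j eq → x≢u i j (≡.sym eq))
              y-kept = λ i → kept (λ eq → y≢t i (≡.sym eq)) (λ j eq → y≢u i j (≡.sym eq))
              M-kept = kept t≢M u≢M
              tˡ = trans (offˡ t y≢t) t-half
              tʳ = trans (offʳ t x≢t) t-half
          in record
            { σˡ = σˡ ; σʳ = σʳ
            ; pieceˡ = record
              { in-D = proj₁ (↦ˡ-self V (prop X) D) inˡ
              ; parameters = λ v∈ ∉x → trans (offˡ _ (y≢θ v∈)) (trans (kept (t≢θ v∈) (u≢θ v∈)) (parameters v∈ ∉x))
              ; radius = trans (offˡ M y≢M) (trans M-kept radius)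
              ; duration = ≤-resp refl (sym tˡ) (half-nonneg duration) }
            ; pieceʳ = record
              { in-D = proj₁ (↦ˡ-self V (prop X) D) inʳ
              ; parameters = λ v∈ ∉x → trans (offʳ _ ∉x) (trans (kept (t≢θ v∈) (u≢θ v∈)) (parameters v∈ ∉x))
              ; radius = trans (offʳ M x≢M) (trans M-kept radius)
              ; duration = ≤-resp refl (sym tʳ) (half-nonneg duration) }
            ; length-σˡ = tˡ
            ; length-σʳ = tʳ
            ; start-σˡ = λ i → trans (offˡ _ (λ j eq → x≢y i j (≡.sym eq))) (x-kept i)
            ; start-σʳ = λ i → trans (onʳ i) (sym (onˡ i))
            ; end-σʳ = λ i → trans (offʳ _ (λ j → x≢y j i)) (y-kept i)
            }

      system : BisectionSystem F m L C
      system = record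
        { Piece      = Σ State IsPiece
        ; len        = λ (σ , _) → σ t
        ; src        = λ (σ , _) → σ ∘ x
        ; tgt        = λ (σ , _) → σ ∘ y
        ; left       = λ (_ , p) → Halves.σˡ (halves p) , Halves.pieceˡ (halves p)
        ; right      = λ (_ , p) → Halves.σʳ (halves p) , Halves.pieceʳ (halves p)
        ; len-nonneg = λ (_ , p) → IsPiece.duration p
        ; len-left   = λ (_ , p) → Halves.length-σˡ (halves p)
        ; len-right  = λ (_ , p) → Halves.length-σʳ (halves p)
        ; src-left   = λ (_ , p) → Halves.start-σˡ (halves p)
        ; src-right  = λ (_ , p) → Halves.start-σʳ (halves p)
        ; tgt-right  = λ (_ , p) → Halves.end-σʳ (halves p)
        ; src-box    = λ (_ , p) → x-box p
        ; tgt-box    = λ (_ , p) → y-box p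
        ; increment  = λ (_ , p) → chord p
        ; tangent    = λ (_ , p) → tangency p
        }

      F-in-box : ∀ {r} → Box m r → Box L (F r)
      F-in-box r∈ = norm≤⇒Box 0≤L (F-dot r∈)

      evolution : ∀ {σ ν} → IsPiece σ → (∀ i → σ (x i) ≈ ω (x i)) → (∀ i → ν (x i) ≈ σ (y i)) → SameOff x ν ω →
        Evolution x θ trueᶠ ω ν
      evolution {σ} {ν} piece start-x end-y off = record
        { frame = off
        ; t = T
        ; t≥0 = IsPiece.duration piece
        ; γ = γ
        ; continuous = λ i s∈ → Lim⇒∣∣ (γ-continuous i s∈)
        ; differentiable = λ i → Diff⇒HasDerivative λ {s} s∈ →
            diff-mono {f = λ s → γ s i} (λ (0<r , r<T) → proj₁ 0<r , proj₁ r<T) (γ-differentiable i (proj₁ (proj₁ s∈) , proj₁ (proj₂ s∈)))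
        ; start = λ i → trans (at-node source (-‿inverseʳ 0#) i) (start-x i)
        ; end = λ i → trans (at-node target (solve 1 (λ T → T :- (:con (+ 0) :+ T) :≡ :con (+ 0)) refl T) i) (sym (end-y i))
        ; inside = λ _ → refl
        }
        where
        open Trajectory 0≤L 0≤C F-in-box (field-lipschitz ω x θ) system (σ , piece)
        at-node : ∀ {s a q} → OnTrajectory a q → s - a ≈ 0# → ∀ i → γ s i ≈ q i
        at-node {s} {a} {q} n s-a≈0 i = trans (solve 2 (λ g q → g :≡ (g :- q) :+ q) refl (γ s i) (q i))
          (trans (+-congʳ (≤±0⇒≈0 (≤±-resp refl (zeroʳ L) (γ-node n (≈0⇒≤± s-a≈0 ≤-refl) i)))) (+-identityˡ _))

    region⇒evolves : ∀ {V ω} → ⟦ region ⟧ V ω → ⟦ evolves ⟧ V ω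
    region⇒evolves {V} {ω} h =
      let (ω₁ , off₁ , hφ , ω₂ , (τ , ω₂≈) , lift 0≤t , ω₃ , (m , ω₃≈) , lift M≰0 , D , (fix , _) , Dω₃) = ∃*-elim y h
          (ν , (on , offν) , φν) = Assignment.assign-elim x y x≢y id distinct {φ} hφ
          0≤M = ≤-resp fromℚ-0 refl (proj₁ (≰⇒> M≰0))
          ω₃-kept : ∀ {v} → t ≢ v → M ≢ v → ω₃ v ≈ ω₁ v
          ω₃-kept t≢v M≢v = trans (ω₃≈ _) (trans (↦-other M≢v) (trans (ω₂≈ _) (↦-other t≢v)))
          -- The state in which φ holds has altered values of y, whereas an evolution may change
          -- only x. The final state therefore keeps ω off x, and φ does not notice because y is
          -- fresh.
          μ = patch x ν ω
          off-x : ∀ {v} → (∀ i → y i ≢ v) → (∀ i → x i ≢ v) → ν v ≈ ω v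
          off-x y≢v x≢v = trans (offν _ x≢v) (off₁ _ y≢v)
          piece = record
            { in-D = Dω₃
            ; parameters = λ v∈ _ → trans (ω₃-kept (t≢θ v∈) (M≢θ v∈)) (off₁ _ (y≢θ v∈))
            ; radius = refl
            ; duration = ≤-resp fromℚ-0 (sym (trans (ω₃≈ t) (↦-other (λ eq → t≢M (≡.sym eq))))) 0≤t }
      in μ ,
         Region⇒Evolves.evolution V ω (ω₃ M) 0≤M D (proj₁ fix) piece
           (λ i → trans (ω₃-kept (λ eq → x≢t i (≡.sym eq)) (λ eq → x≢M i (≡.sym eq))) (off₁ _ (λ j eq → x≢y i j (≡.sym eq))))
           (λ i → trans (patch-on x i) (trans (on i) (sym (ω₃-kept (λ eq → y≢t i (≡.sym eq)) (λ eq → y≢M i (≡.sym eq))))))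
           (λ v → patch-off x) ,
         semantics-coincidence {S = _∈ˡ vars φ} φ (IsDLμ.wellFormed dlμ) id (λ X free → contradiction free (IsDLμ.closed dlμ X))
           (λ v∈ → patch-cases x (λ _ → refl) (off-x (y≢φ v∈))) φν

    module Evolves⇒Region (V : Valuation) {ω ν : State} (ev : Evolution x θ trueᶠ ω ν) where
      open Evolution ev using (F; γ; frame; start; end) renaming (t to T; t≥0 to 0≤T)

      H : Vector Carrier N → Vector Carrier N
      H r i = evalAt ω x (hat x θ i) r

      γ-cont : ∀ i {s} → Closed 0# T s → Cont (Closed 0# T) s (λ s → γ s i)
      γ-cont i s∈ = ∣∣⇒Lim (Evolution.continuous ev i s∈)

      γ-diff : ∀ i {s} → Open 0# T s → Diff (Open 0# T) s (λ s → γ s i) (F (γ s) i)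
      γ-diff i s∈ = HasDerivative⇒Diff (Evolution.differentiable ev i) s∈

      abstract
        bounded : ∃ λ m → 0# < m × (∀ {s} → Closed 0# T s → dot (γ s) (γ s) ≤ m * m)
        bounded =
          let (B , ≤B) = continuous⇒bounded {f = λ s → dot (γ s) (γ s)} 0≤T
                           (λ s∈ → lim-sum λ i → lim-* (γ-cont i s∈) (γ-cont i s∈))
              (b , B≤±b) = ≤±-bound B
              0≤b = ≤±-nonneg B≤±b
          -- 1 + b is positive even for a curve resting at the origin, and its square exceeds b, so
          -- no square root is taken.
          in 1# + b , +-pos-nonneg 0<1 0≤b , λ s∈ → ≤-trans (≤B s∈) (≤-trans (proj₂ B≤±b)
               (nonneg⇒≤ (0≤1 +≥0 0≤b +≥0 0≤b *≥0 0≤b)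
                 (solve 1 (λ b → (:con (+ 1) :+ b) :* (:con (+ 1) :+ b) :- b :≡ :con (+ 1) :+ b :+ b :* b) refl b)))

      m : Carrier
      m = proj₁ bounded
      0<m : 0# < m
      0<m = proj₁ (proj₂ bounded)
      γ-ball : ∀ {s} → Closed 0# T s → dot (γ s) (γ s) ≤ m * m
      γ-ball = proj₂ (proj₂ bounded)

      module Interval {a b} (0≤a : 0# ≤ a) (a≤b : a ≤ b) (b≤T : b ≤ T) where

        closed : ∀ {s} → Closed a b s → Closed 0# T s
        closed (a≤s , s≤b) = ≤-trans 0≤a a≤s , ≤-trans s≤b b≤T

        opened : ∀ {s} → Open a b s → Open 0# T s
        opened (a<s , s<b) = ≤-<-trans 0≤a a<s , <-≤-trans s<b b≤T

        open⊆closed : ∀ {s} → Open a b s → Closed a b s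
        open⊆closed (a<s , s<b) = proj₁ a<s , proj₁ s<b

        a∈ : Closed 0# T a
        a∈ = closed (≤-refl , a≤b)
        b∈ : Closed 0# T b
        b∈ = closed (a≤b , ≤-refl)

        u-cont : ∀ i {s} → Closed a b s → Cont (Closed a b) s (λ s → γ s i)
        u-cont i s∈ = lim-mono closed (γ-cont i (closed s∈))

        u-diff : ∀ i {s} → Open a b s → Diff (Open a b) s (λ s → γ s i) (F (γ s) i)
        u-diff i s∈ = diff-mono {f = λ s → γ s i} opened (γ-diff i (opened s∈))

        v-cont : ∀ i {s} → Closed a b s → Cont (Closed a b) s (λ s → F (γ s) i)
        v-cont i s∈ = eval-cont ω x (λ j → u-cont j s∈) (θ i)

        -- By the chain rule the derivative of the field along a solution is `hat` evaluated on it.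
        -- This is γ″, and the reason why this term governs the error of the tangent.
        v-diff : ∀ i {s} → Open a b s → Diff (Open a b) s (λ s → F (γ s) i) (H (γ s) i)
        v-diff i {s} s∈ = lim-resp (λ _ → refl) (sym (sumᵗ-semantics (λ j → ∂ (x j) (θ i) ⊗ θ j) (ω [ x ↦* γ s ])))
          (chain-rule ω x (λ j → lim-mono open⊆closed (u-cont j (open⊆closed s∈))) distinct (F (γ s)) (λ j → u-diff j s∈) (θ i))

        γ-≈ : b ≈ a → ∀ i → γ b i ≈ γ a i
        γ-≈ b≈a i = cont-≈ {f = λ s → γ s i} (γ-cont i a∈) b∈ b≈a

        dot-zero : ∀ {d : Vector Carrier N} → (∀ i → d i ≈ 0#) → dot d d ≈ 0#
        dot-zero {d} d≈0 = trans (dot-cong d≈0 (λ _ → refl)) (trans (sum-cong-≋ λ i → zeroˡ (d i)) (sum-replicate-zero N))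

        -- An evolution of duration zero has only degenerate intervals, to which the mean value
        -- theorem does not apply. Then d vanishes, because γ respects equality of times by
        -- continuity, and γ a is a witness.
        chord-point : (let d = λ i → γ b i - γ a i) → ∃ λ r → dot r r ≤ m * m ×
          1# * 1# * dot d d ≤ (b - a) * (b - a) * dot (F r) (F r)
        chord-point = [ degenerate , proper ]′ (≤⇒≈⊎< a≤b)
          where
          d : Vector Carrier N
          d i = γ b i - γ a i
          one : dot d d ≈ 1# * 1# * dot d d
          one = solve 1 (λ n → n :≡ :con (+ 1) :* :con (+ 1) :* n) refl (dot d d)
          degenerate : b ≈ a → ∃ λ r → dot r r ≤ m * m × 1# * 1# * dot d d ≤ (b - a) * (b - a) * dot (F r) (F r)
          degenerate b≈a = γ a , γ-ball a∈ , ≤-resp (trans (sym (dot-zero λ i → trans (+-congʳ (γ-≈ b≈a i)) (-‿inverseʳ _))) one) refl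
            (square-nonneg (b - a) *≥0 dot-nonneg (F (γ a)))
          proper : a < b → ∃ λ r → dot r r ≤ m * m × 1# * 1# * dot d d ≤ (b - a) * (b - a) * dot (F r) (F r)
          proper a<b = let (ξ , ξ∈ , h) = chord-mean-value a<b γ (λ s → F (γ s)) u-cont u-diff in
            γ ξ , γ-ball (closed (open⊆closed ξ∈)) , ≤-resp one refl h

        tangent-point : (let d = λ i → γ b i - γ a i - (b - a) * F (γ a) i) → ∃ λ r → dot r r ≤ m * m ×
          (1# + 1#) * (1# + 1#) * dot d d ≤ (b - a) * (b - a) * ((b - a) * (b - a)) * dot (H r) (H r)
        tangent-point = [ degenerate , proper ]′ (≤⇒≈⊎< a≤b)
          where
          d : Vector Carrier N
          d i = γ b i - γ a i - (b - a) * F (γ a) i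
          Goal : Set
          Goal = ∃ λ r → dot r r ≤ m * m ×
            (1# + 1#) * (1# + 1#) * dot d d ≤ (b - a) * (b - a) * ((b - a) * (b - a)) * dot (H r) (H r)
          degenerate : b ≈ a → Goal
          degenerate b≈a = γ a , γ-ball a∈ , ≤-resp
            (sym (trans (*-congˡ (dot-zero λ i → trans (+-cong (trans (+-congʳ (γ-≈ b≈a i)) (-‿inverseʳ _))
              (-‿cong (trans (*-congʳ (trans (+-congʳ b≈a) (-‿inverseʳ a))) (zeroˡ _)))) (-‿inverseʳ 0#))) (zeroʳ _))) refl
            (square-nonneg (b - a) *≥0 square-nonneg (b - a) *≥0 dot-nonneg (H (γ a)))
          proper : a < b → Goal
          proper a<b = let (ξ , ξ∈ , h) = taylor-remainder a<b γ (λ s → F (γ s)) (λ s → H (γ s)) u-cont u-diff v-cont v-diff in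
            γ ξ , γ-ball (closed (open⊆closed ξ∈)) , h

      -- A state records only the duration b - a. The absolute times are kept here because they
      -- locate the two points on γ.
      record OnFlow (σ : State) : Set where
        field
          parameters : SameParameters σ ω
          radius     : σ M ≈ m
          a b        : Carrier
          0≤a        : 0# ≤ a
          a≤b        : a ≤ b
          b≤T        : b ≤ T
          duration   : σ t ≈ b - a
          source     : ∀ i → σ (x i) ≈ γ a i
          target     : ∀ i → σ (y i) ≈ γ b i

      OnFlow-resp : ∀ {σ σ′} → σ ≈ˢ σ′ → OnFlow σ → OnFlow σ′
      OnFlow-resp σ≈σ′ on = record
        { parameters = λ v∈ ∉x → trans (sym (σ≈σ′ _)) (parameters v∈ ∉x)
        ; radius = trans (sym (σ≈σ′ M)) radius
        ; a = a ; b = b ; 0≤a = 0≤a ; a≤b = a≤b ; b≤T = b≤T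
        ; duration = trans (sym (σ≈σ′ t)) duration
        ; source = λ i → trans (sym (σ≈σ′ _)) (source i)
        ; target = λ i → trans (sym (σ≈σ′ _)) (target i)
        }
        where
        open OnFlow on

      E : StateSet
      E = stateSet OnFlow OnFlow-resp

      module _ {σ : State} (on : OnFlow σ) where
        open OnFlow on
        open Interval 0≤a a≤b b≤T

        W : Valuation
        W = V [ X ↦ᵖ E ]

        ball : ∀ {σ′} (w : Vector 𝒳 N) {r} → σ′ M ≈ σ M → (∀ i → σ′ (w i) ≈ r i) → dot r r ≤ m * m →
          ⟦ ∥ vars* w ∥≤ var M ⟧ W σ′
        ball {σ′} w σ′M≈σM w≈r rr≤mm = ∥∥≤-intro (vars* w) (var M) {W} {σ′} w≈r (≤-resp refl (sym σ′M≈m) (proj₁ 0<m))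
          (≤-resp refl (*-cong (sym σ′M≈m) (sym σ′M≈m)) rr≤mm)
          where σ′M≈m = trans σ′M≈σM radius

        module Witness (r : Vector Carrier N) where
          σᶻ : State
          σᶻ = σ [ z ↦* r ]
          kept : SameOff z σᶻ σ
          kept = ↦*-off z
          zᶻ : ∀ i → σᶻ (z i) ≈ r i
          zᶻ = ↦*-on r z-distinct
          xᶻ : ∀ i → σᶻ (x i) ≈ γ a i
          xᶻ i = trans (kept (x i) λ j eq → x≢z i j (≡.sym eq)) (source i)
          yᶻ : ∀ i → σᶻ (y i) ≈ γ b i
          yᶻ i = trans (kept (y i) λ j eq → y≢z i j (≡.sym eq)) (target i)
          tᶻ : σᶻ t ≈ b - a
          tᶻ = trans (kept t z≢t) duration
          exchanged : ∀ e → (∀ {v} → v ∈ˡ varsᵗ e → v ∈ˡ varsᵗ* θ) → ⟦ rename (exchange x z) e ⟧ᵗ σᶻ ≈ evalAt ω x e r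
          exchanged e ⊆θ = trans (eval-exchange ω x e z (λ i zi∈ → z∉θ i (⊆θ zi∈))
              (λ v∈ ∉x → trans (kept _ (z≢θ (⊆θ v∈))) (parameters (⊆θ v∈) ∉x)))
            (eval-cong ω x e zᶻ)
          θᶻ : ∀ i → ⟦ θ i ⟧ᵗ σᶻ ≈ F (γ a) i
          θᶻ i = trans (eval-coincidence ω x (θ i) (λ v∈ ∉x →
              trans (kept _ (z≢θ (varsᵗ*-⊆ θ i v∈))) (parameters (varsᵗ*-⊆ θ i v∈) ∉x)))
            (eval-cong ω x (θ i) xᶻ)

        0≤b-a : 0# ≤ b - a
        0≤b-a = ≤⇒nonneg a≤b

        ρ-chord : ⟦ ∃* z (∥ vars* z ∥≤ var M ∧ 1ℚ ·∥ (λ i → var (y i) ⊖ var (x i)) ∥≤ var t ·∥ θ [ x ⇄ z ] ∥) ⟧ W σ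
        ρ-chord =
          let (r , r∈ , h) = chord-point
              open Witness r
          in
          ∃*-intro z _ {W} {σ} {σᶻ} kept
            (ball {σᶻ} z (kept M z≢M) zᶻ r∈ ,
             weighted-intro 1ℚ (λ i → var (y i) ⊖ var (x i)) (var t) (θ [ x ⇄ z ]) {W} {σᶻ} fromℚ-1
               (λ i → +-cong (yᶻ i) (-‿cong (xᶻ i))) tᶻ (λ i → exchanged (θ i) (varsᵗ*-⊆ θ i)) 0≤b-a h)

        ρ-tangent : ⟦ ∃* z (∥ vars* z ∥≤ var M ∧ (+ 2 / 1) ·∥ (λ i → var (y i) ⊖ var (x i) ⊖ var t ⊗ θ i) ∥≤
                          var t ⊗ var t ·∥ hat x θ [ x ⇄ z ] ∥) ⟧ W σ
        ρ-tangent =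
          let (r , r∈ , h) = tangent-point
              open Witness r
          in
          ∃*-intro z _ {W} {σ} {σᶻ} kept
            (ball {σᶻ} z (kept M z≢M) zᶻ r∈ ,
             weighted-intro (+ 2 / 1) (λ i → var (y i) ⊖ var (x i) ⊖ var t ⊗ θ i) (var t ⊗ var t) (hat x θ [ x ⇄ z ]) {W} {σᶻ} fromℚ-2
               (λ i → +-cong (+-cong (yᶻ i) (-‿cong (xᶻ i))) (-‿cong (*-cong tᶻ (θᶻ i)))) (*-cong tᶻ tᶻ)
               (λ i → exchanged (hat x θ i) (vars-hat x θ i)) (square-nonneg (b - a)) h)

        c : Carrier
        c = a + half (b - a)
        a≤c : a ≤ c
        a≤c = ≤-+ (half-nonneg 0≤b-a)
        c-a : c - a ≈ half (b - a)
        c-a = shift a (half (b - a))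
          where
          shift : ∀ a h → a + h - a ≈ h
          shift = solve 2 (λ a h → a :+ h :- a :≡ h) refl
        b-c : b - c ≈ half (b - a)
        b-c = rest a b (half (b - a)) (half+half (b - a))
          where
          rest : ∀ a b h → h + h ≈ b - a → b - (a + h) ≈ h
          rest a b h hh = trans (solve 3 (λ a b h → b :- (a :+ h) :≡ (b :- a) :- h) refl a b h)
            (trans (+-congʳ (sym hh)) (solve 1 (λ h → h :+ h :- h :≡ h) refl h))
        c≤b : c ≤ b
        c≤b = nonneg⇒≤ (half-nonneg 0≤b-a) b-c

        σᵘ μ : State
        σᵘ = σ [ u ↦* γ c ]
        μ = σᵘ [ t ↦ ⟦ var t ⊗ con ½ ⟧ᵗ σᵘ ]

        μ-kept : ∀ {v} → t ≢ v → (∀ i → u i ≢ v) → μ v ≈ σ v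
        μ-kept t≢v u≢v = trans (↦-other t≢v) (↦*-off u _ u≢v)
        μ-t : μ t ≈ half (b - a)
        μ-t = trans (↦-same t) (trans (fromℚ-½ _) (*-congʳ (trans (↦*-off u t u≢t) duration)))
        μ-u : ∀ i → μ (u i) ≈ γ c i
        μ-u i = trans (↦-other (λ eq → u≢t i (≡.sym eq))) (↦*-on (γ c) u-distinct i)
        μ-x : ∀ i → μ (x i) ≈ γ a i
        μ-x i = trans (μ-kept (λ eq → x≢t i (≡.sym eq)) (λ j eq → x≢u i j (≡.sym eq))) (source i)
        μ-y : ∀ i → μ (y i) ≈ γ b i
        μ-y i = trans (μ-kept (λ eq → y≢t i (≡.sym eq)) (λ j eq → y≢u i j (≡.sym eq))) (target i)
        μ-parameters : SameParameters μ ω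
        μ-parameters v∈ ∉x = trans (μ-kept (t≢θ v∈) (u≢θ v∈)) (parameters v∈ ∉x)
        μ-M : μ M ≈ m
        μ-M = trans (μ-kept t≢M u≢M) radius

        first-half : OnFlow (μ [ y ↦* μ ∘ u ])
        first-half = record
          { parameters = λ v∈ ∉x → trans (↦*-off y _ (y≢θ v∈)) (μ-parameters v∈ ∉x)
          ; radius = trans (↦*-off y M y≢M) μ-M
          ; a = a ; b = c ; 0≤a = 0≤a ; a≤b = a≤c ; b≤T = ≤-trans c≤b b≤T
          ; duration = trans (↦*-off y t y≢t) (trans μ-t (sym c-a))
          ; source = λ i → trans (↦*-off y _ (λ j eq → x≢y i j (≡.sym eq))) (μ-x i)
          ; target = λ i → trans (↦*-on (μ ∘ u) y-distinct i) (μ-u i)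
          }

        second-half : OnFlow (μ [ x ↦* μ ∘ u ])
        second-half = record
          { parameters = λ v∈ ∉x → trans (↦*-off x _ ∉x) (μ-parameters v∈ ∉x)
          ; radius = trans (↦*-off x M x≢M) μ-M
          ; a = c ; b = b ; 0≤a = ≤-trans 0≤a a≤c ; a≤b = c≤b ; b≤T = b≤T
          ; duration = trans (↦*-off x t x≢t) (trans μ-t (sym b-c))
          ; source = λ i → trans (↦*-on (μ ∘ u) distinct i) (μ-u i)
          ; target = λ i → trans (↦*-off x _ (λ j → x≢y j i)) (μ-y i)
          }

        ρ-halves : ⟦ ∃* u (⟨ t := var t ⊗ con ½ ⟩ (⟨ y :=⃗ u ⟩ pvar (prop X) ∧ ⟨ x :=⃗ u ⟩ pvar (prop X))) ⟧ W σ
        ρ-halves = ∃*-intro u _ {W} {σ} {σᵘ} (↦*-off u) (μ , (λ _ → refl) ,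
          Assignment.assign-intro y u y≢u id (pvar (prop X)) {W} {μ} ((↦*-on (μ ∘ u) y-distinct) , ↦*-off y) (lift (proj₂ (↦ˡ-self V (prop X) E) first-half)) ,
          Assignment.assign-intro x u x≢u id (pvar (prop X)) {W} {μ} ((↦*-on (μ ∘ u) distinct) , ↦*-off x) (lift (proj₂ (↦ˡ-self V (prop X) E) second-half)))

        ρ-holds : ⟦ ρ ⟧ W σ
        ρ-holds = (ball {σ} x refl source (γ-ball a∈) , ball {σ} y refl target (γ-ball b∈)) , ρ-chord , ρ-tangent , ρ-halves

    ρ-wellFormed : WellFormed ρ
    ρ-wellFormed = ((tt , tt) , (tt , tt)) ,
      wellFormed-∃* z ((tt , tt) , (tt , tt) , (tt , tt)) , wellFormed-∃* z ((tt , tt) , (tt , tt) , (tt , tt)) ,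
      wellFormed-∃* u (Assignment.wellFormed-assign y u y≢u id tt , Assignment.wellFormed-assign x u x≢u id tt)

    -- The type is what `Mentions` computes to on the matrix of conjuncts (2) and (3), which
    -- consists of six literals.
    no-literal : ¬ ((⊥ ⊎ ⊥) ⊎ ((⊥ ⊎ ⊥) ⊎ (⊥ ⊎ ⊥)))
    no-literal (inj₁ (inj₁ ()))
    no-literal (inj₁ (inj₂ ()))
    no-literal (inj₂ (inj₁ (inj₁ ())))
    no-literal (inj₂ (inj₁ (inj₂ ())))
    no-literal (inj₂ (inj₂ (inj₁ ())))
    no-literal (inj₂ (inj₂ (inj₂ ())))

    ρ-monotone : ¬ Mentions (comp X) ρ
    ρ-monotone (inj₁ (inj₁ (inj₁ ())))
    ρ-monotone (inj₁ (inj₁ (inj₂ ())))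
    ρ-monotone (inj₁ (inj₂ (inj₁ ())))
    ρ-monotone (inj₁ (inj₂ (inj₂ ())))
    ρ-monotone (inj₂ (inj₁ m)) = no-literal (mentions-∃* z m)
    ρ-monotone (inj₂ (inj₂ (inj₁ m))) = no-literal (mentions-∃* z m)
    ρ-monotone (inj₂ (inj₂ (inj₂ m))) = [ no-comp ∘ Assignment.mentions-assign y u y≢u id , no-comp ∘ Assignment.mentions-assign x u x≢u id ]′
        (mentions-∃* u m)
      where
      no-comp : comp X ≢ prop X
      no-comp ()

    region-wellFormed : WellFormed region
    region-wellFormed = wellFormed-∃* y
      (Assignment.wellFormed-assign x y x≢y id (IsDLμ.wellFormed dlμ) , tt , tt , ρ-monotone , ρ-wellFormed)

    evolves⇒region : ∀ {V ω} → ⟦ evolves ⟧ V ω → ⟦ region ⟧ V ω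
    evolves⇒region {V} {ω} (ν , ev , φν) = ∃*-intro y _ {V} {ω} {ω₁} (↦*-off y)
      (Assignment.assign-intro x y x≢y id φ {V} {ω₁} {ω₁′} (on , λ v → patch-off x)
         (semantics-coincidence {S = _∈ˡ vars φ} φ (IsDLμ.wellFormed dlμ) id (λ X free → contradiction free (IsDLμ.closed dlμ X))
           (λ v∈ → patch-cases x (λ _ → refl) (λ ∉x → trans (frame _ ∉x) (sym (↦*-off y _ (y≢φ v∈))))) φν) ,
       ω₂ , (T , λ _ → refl) , lift (≤-resp (sym fromℚ-0) (sym (↦-same t)) 0≤T) ,
       ω₃ , (m , λ _ → refl) , lift (λ M≤0 → <⇒≱ 0<m (≤-resp (↦-same M) fromℚ-0 M≤0)) ,
       gfp , gfp-greatest , gfp-⊇ {E} ρ-holds initial)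
      where
      open Evolves⇒Region V ev
      open Evolution ev using (γ; frame; start; end) renaming (t to T; t≥0 to 0≤T)
      open KnasterTarski (operator-regular (prop X) ρ ρ-monotone ρ-wellFormed V)
      ω₁ ω₁′ ω₂ ω₃ : State
      ω₁  = ω [ y ↦* γ T ]
      -- The state after x := y. It agrees with ν on x and, by the frame condition, on everything
      -- else except y, which does not occur in φ.
      ω₁′ = patch x ν ω₁
      ω₂  = ω₁ [ t ↦ T ]
      ω₃  = ω₂ [ M ↦ m ]
      on : ∀ i → ω₁′ (x i) ≈ ω₁ (y i)
      on i = trans (patch-on x i) (trans (sym (end i)) (sym (↦*-on (γ T) y-distinct i)))
      ω₃-kept : ∀ {v} → t ≢ v → M ≢ v → ω₃ v ≈ ω₁ v
      ω₃-kept t≢v M≢v = trans (↦-other M≢v) (↦-other t≢v)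
      initial : OnFlow ω₃
      initial = record
        { parameters = λ v∈ _ → trans (ω₃-kept (t≢θ v∈) (M≢θ v∈)) (↦*-off y _ (y≢θ v∈))
        ; radius = ↦-same M
        ; a = 0# ; b = T ; 0≤a = ≤-refl ; a≤b = 0≤T ; b≤T = ≤-refl
        ; duration = trans (↦-other (λ eq → t≢M (≡.sym eq))) (trans (↦-same t) (solve 1 (λ T → T :≡ T :- :con (+ 0)) refl T))
        ; source = λ i → trans (ω₃-kept (λ eq → x≢t i (≡.sym eq)) (λ eq → x≢M i (≡.sym eq)))
            (trans (↦*-off y _ (λ j eq → x≢y i j (≡.sym eq))) (sym (start i)))
        ; target = λ i → trans (ω₃-kept (λ eq → y≢t i (≡.sym eq)) (λ eq → y≢M i (≡.sym eq))) (↦*-on (γ T) y-distinct i)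
        }

    ∇-valid : Valid (∇ distinct φ)
    ∇-valid V ω = ⇔-valid {evolves} {region} (IsDLμ.wellFormed dlμ) region-wellFormed evolves⇒region region⇒evolves

corollary6p5 : ExcludedMiddle (lsuc 0ℓ) →
    (ℝ : CompleteOrderedField) (Vars : Variables) →
    let open Variables Vars
        open Syntax Vars
        open Semantics ℝ Vars
    in
    (φ : Formula) → IsDLμ φ →
    ∀ {N} (x : Vector 𝒳 N) (distinct : Distinct x) (θ : Vector Term N)
      (y z u : Vector 𝒳 N) (t M : 𝒳) (X : 𝒱) →
    Fresh x θ φ y z u t M →
    Valid (Axiom.∇ x θ y z u t M X distinct φ)
corollary6p5 em ℝ Vars φ dlμ x distinct θ y z u t M X fresh =
  Soundness.∇-valid em ℝ Vars φ dlμ x distinct θ y z u t M X (FormulaSemantics.fresh⇒apart em ℝ Vars fresh)
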